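{- Let $1\le m\le n$ and let $K(m,n)$ be the number of reduced $m\times n$ Latin rectangles. With the notation of the context, $$K(m,n)=\sum_{R}\ \sum_{C}\ (-1)^{nm+\sum W}\ \frac{\prod_{l=0}^{m}\prod_{Z}q(Z)!}{\prod_{\alpha\in A_m} r_\alpha!\ \prod_{\beta\in A_m}c_\beta!} =(-1)^{n(m-1)}\sum_{R}\ \sum_{C}\ \frac{\prod_{l=0}^{m}\prod_{Z}\langle -q(Z)\rangle_{q(Z)}}{\prod_{\alpha\in A_m} r_\alpha!\ \prod_{\beta\in A_m}c_\beta!},$$ where: the sum over $R$ is over all families $(r_\alpha)_{\alpha\in A_m}$ of nonnegative integers with $\sum_\alpha r_\alpha=n$; the sum over $C$ is over all families $(c_\beta)_{\beta\in A_m}$ of nonnegative integers satisfying, for every $l\in[m]$ and every $l$-component $Z$, the constraint $\sum_{\beta: Z_l(\beta)=Z}c_\beta=q(Z)$; for each $l\in[m]$ the inner product $\prod_Z$ runs over all $l$-components $Z$, while for $l=0$ it consists of the single factor with $q=n$; and $\sum W=\sum_{\alpha:\ \zeta(\alpha)\text{ odd}}r_\alpha$.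
   Context: A reduced $m\times n$ Latin rectangle is an $m\times n$ array with entries in $[n]=\{1,\dots,n\}$, with no entry repeated in any row or column, whose first row is $1\,2\,\dots\,n$. Let $A_m$ be the set of integer tuples $\alpha=(\alpha_m,\dots,\alpha_1)$ with $0\le\alpha_j\le j-1$ for all $j$ (so $|A_m|=m!$). Covering and components: for $\alpha\in A_m$ and a position $i$ with $\alpha_i>0$, let $\kappa(i)=\alpha_i<i$; positions with $\alpha_i=0$ have no image, and iterating $\kappa$ from any position reaches a position $h$ with $\alpha_h=0$. For each $h$ with $\alpha_h=0$, the component $Z_h(\alpha)$ is the set of positions $j$ with $\kappa^k(j)=h$ for some $k\ge0$, together with their values $\alpha_j$; if $\alpha_h\neq0$ then $\alpha$ has no component at $h$. An $l$-component is any object of the form $Z_l(\alpha)$ for some $\alpha\in A_m$. $\zeta(\alpha)$ is the number of $j$ with $\alpha_j=0$ (the number of components of $\alpha$). Given nonnegative integers $r_\alpha$ ($\alpha\in A_m$), for an $l$-component $Z$ put $q(Z)=\sum_{\alpha:\ Z_l(\alpha)=Z}r_\alpha$. $\langle x\rangle_k=x(x+1)\cdots(x+k-1)$ denotes the rising factorial (so $\langle -q\rangle_q=(-1)^q q!$). -}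

module Defs where

open import Data.Nat as ℕ using (ℕ; zero; suc; _∸_; _≡ᵇ_; NonZero; _!)
open import Data.Nat.Properties using (_!≢0; m*n≢0)
open import Data.Bool using (Bool; true; false; _∧_; _∨_; not; if_then_else_)
open import Data.List using (List; []; _∷_; [_]; _++_; map; concatMap; upTo; length; zip; filter; foldr; allFin)
open import Data.Product using (_×_; _,_; proj₁; proj₂)
open import Data.Fin as Fin using (Fin; toℕ)
open import Data.Fin.Properties using (all?)
open import Data.Vec as Vec using (Vec; lookup)
open import Data.Integer as ℤ using (ℤ; +_; -_)
open import Data.Rational as ℚ using (ℚ)
open import Relation.Nullary using (Dec)
open import Relation.Nullary.Decidable using (_×-dec_; _→-dec_; T?)
open import Relation.Binary.PropositionalEquality using (_≡_)

Rect : ℕ → ℕ → Set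
Rect m n = Vec (Vec (Fin n) n) m

entry : ∀ {m n} → Rect m n → Fin m → Fin n → Fin n
entry R i j = lookup (lookup R i) j

IsReducedLatin : ∀ m n → Rect m n → Set
IsReducedLatin m n R =
  (∀ i j k → entry R i j ≡ entry R i k → j ≡ k) ×
  (∀ i i' j → entry R i j ≡ entry R i' j → i ≡ i') ×
  (∀ i j → toℕ i ≡ 0 → entry R i j ≡ j)

isReducedLatin? : ∀ m n (R : Rect m n) → Dec (IsReducedLatin m n R)
isReducedLatin? m n R =
  all? (λ i → all? (λ j → all? (λ k → (entry R i j Fin.≟ entry R i k) →-dec (j Fin.≟ k)))) ×-dec
  (all? (λ i → all? (λ i' → all? (λ j → (entry R i j Fin.≟ entry R i' j) →-dec (i Fin.≟ i')))) ×-dec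
  all? (λ i → all? (λ j → (toℕ i ℕ.≟ 0) →-dec (entry R i j Fin.≟ j))))

anyB allB : ∀ {X : Set} → (X → Bool) → List X → Bool
anyB p = foldr (λ x b → p x ∨ b) false
allB p = foldr (λ x b → p x ∧ b) true

vecs : ∀ {A : Set} (k : ℕ) → List A → List (Vec A k)
vecs zero xs = [ Vec.[] ]
vecs (suc k) xs = concatMap (λ x → map (x Vec.∷_) (vecs k xs)) xs

allRects : ∀ m n → List (Rect m n)
allRects m n = vecs m (vecs n (allFin n))

K : ℕ → ℕ → ℕ
K m n = length (filter (isReducedLatin? m n) (allRects m n))

-- The set A_m.  An element α = (α_m,…,α_1) is stored as the list
-- α_1 ∷ α_2 ∷ … ∷ α_m ∷ [] ; positions are 1-indexed.

A : ℕ → List (List ℕ)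
A zero = [ [] ]
A (suc m) = concatMap (λ α → map (λ v → α ++ [ v ]) (upTo (suc m))) (A m)

at : List ℕ → ℕ → ℕ
at [] _ = 0
at (x ∷ xs) zero = 0
at (x ∷ xs) (suc zero) = x
at (x ∷ xs) (suc (suc j)) = at xs (suc j)

positions : ℕ → List ℕ
positions m = map suc (upTo m)

-- j, κ(j), κ²(j), … (fuel f; the orbit has at most m elements)
orbit : ℕ → List ℕ → ℕ → List ℕ
orbit zero α j = [ j ]
orbit (suc f) α j = j ∷ (if at α j ≡ᵇ 0 then [] else orbit f α (at α j))

-- j ∈ Z_l(α): κ^k(j) = l for some k ≥ 0
inComp : ℕ → List ℕ → ℕ → Bool
inComp l α j = anyB (_≡ᵇ l) (orbit (length α) α j)

-- Z_l(α) and Z_l(β) both exist and are equal (same positions, same values)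
sameComp : ℕ → ℕ → List ℕ → List ℕ → Bool
sameComp m l α β =
  (at α l ≡ᵇ 0) ∧ (at β l ≡ᵇ 0) ∧
  allB (λ j → ((inComp l α j ∧ inComp l β j) ∨ (not (inComp l α j) ∧ not (inComp l β j)))
             ∧ (not (inComp l α j) ∨ (at α j ≡ᵇ at β j)))
      (positions m)

ζ : List ℕ → ℕ
ζ α = length (filter (λ x → x ℕ.≟ 0) α)

-- Families indexed by A_m are lists aligned with the list  A m.

sumL : List ℕ → ℕ
sumL = foldr ℕ._+_ 0

prodL : List ℕ → ℕ
prodL = foldr ℕ._*_ 1

comps : ℕ → ℕ → List (List ℕ)
comps zero zero = [ [] ]
comps zero (suc t) = []
comps (suc k) t = concatMap (λ x → map (x ∷_) (comps k (t ∸ x))) (upTo (suc t))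

sumWhere : (List ℕ → Bool) → ℕ → List ℕ → ℕ
sumWhere b m r = sumL (map proj₂ (filter (λ p → T? (b (proj₁ p))) (zip (A m) r)))

qsum : ℕ → ℕ → List ℕ → List ℕ → ℕ
qsum m l r α = sumWhere (λ β → sameComp m l β α) m r

-- one representative α for each distinct l-component Z_l(α)
repsAux : ℕ → ℕ → List (List ℕ) → List (List ℕ) → List (List ℕ)
repsAux m l acc [] = acc
repsAux m l acc (α ∷ as) =
  if (at α l ≡ᵇ 0) ∧ not (anyB (λ z → sameComp m l z α) acc)
  then repsAux m l (α ∷ acc) as else repsAux m l acc as

comps-l : ℕ → ℕ → List (List ℕ)
comps-l m l = repsAux m l [] (A m)

prodComp : ∀ {X : Set} → (X → X → X) → X → (ℕ → X) → ℕ → ℕ → List ℕ → X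
prodComp _·_ one f m n r =
  f n · foldr _·_ one (map (λ l → foldr _·_ one (map (λ α → f (qsum m l r α)) (comps-l m l))) (positions m))

validC : ℕ → List ℕ → List ℕ → Bool
validC m r c =
  allB (λ l → allB (λ α → not (at α l ≡ᵇ 0) ∨ (qsum m l c α ≡ᵇ qsum m l r α)) (A m)) (positions m)

ΣW : ℕ → List ℕ → ℕ
ΣW m r = sumWhere (λ α → ζ α ℕ.% 2 ≡ᵇ 1) m r

denom : List ℕ → List ℕ → ℕ
denom r c = prodL (map _! r) ℕ.* prodL (map _! c)

prodL-fact-nz : ∀ xs → NonZero (prodL (map _! xs))
prodL-fact-nz [] = _
prodL-fact-nz (x ∷ xs) = m*n≢0 (x !) (prodL (map _! xs)) {{x !≢0}} {{prodL-fact-nz xs}}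

denom-nz : ∀ r c → NonZero (denom r c)
denom-nz r c = m*n≢0 _ _ {{prodL-fact-nz r}} {{prodL-fact-nz c}}

rising : ℤ → ℕ → ℤ
rising x zero = ℤ.+ 1
rising x (suc k) = x ℤ.* rising (x ℤ.+ ℤ.+ 1) k

sumℚ : List ℚ → ℚ
sumℚ = foldr ℚ._+_ ℚ.0ℚ

ΣRC : ℕ → ℕ → (List ℕ → List ℕ → ℚ) → ℚ
ΣRC m n t = sumℚ (map (λ r → sumℚ (map (λ c → t r c)
              (filter (λ c → T? (validC m r c)) (comps (length (A m)) n))))
            (comps (length (A m)) n))

sgn : ℕ → ℤ
sgn k = (ℤ.- ℤ.+ 1) ℤ.^ k

K₁ : ℕ → ℕ → ℚ
K₁ m n = ΣRC m n (λ r c →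
  ((sgn (n ℕ.* m ℕ.+ ΣW m r) ℤ.* ℤ.+ prodComp ℕ._*_ 1 _! m n r) ℚ./ denom r c) {{denom-nz r c}})

K₂ : ℕ → ℕ → ℚ
K₂ m n = ℚ._*_ (sgn (n ℕ.* (m ∸ 1)) ℚ./ 1) (ΣRC m n (λ r c →
  (prodComp ℤ._*_ (ℤ.+ 1) (λ q → rising (ℤ.- ℤ.+ q) q) m n r ℚ./ denom r c) {{denom-nz r c}}))

{-# OPTIONS --safe #-}
module Submission where

-- Expanding ∏_i (1 - Σ_{v<i} [x_i = x_v]) shows that the indicator of "x_1, …, x_m are distinct"
-- is the sum over α ∈ A_m of the signed conditions "x_i = x_{α_i} whenever α_i > 0".  Apply this
-- to every column of an array whose rows are permutations, choosing a tuple a_j for column j.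
-- Then every symbol s also acquires a tuple b_s, namely (b_s)_i = (a_j)_i where s stands in
-- column j of row i, and the cells occupied by s match its l-components with equal l-components
-- of columns.  Conversely, for given a and b the arrays are built row by row: row l is free
-- exactly up to a bijection, for every l-component Z, between the columns and the symbols
-- having Z, which gives ∏_Z q(Z)! choices if the counts agree and none otherwise.
-- Fixing the first row and summing over all a and b with given contents r and c turns the
-- multinomial coefficients into n! / (∏ r_α! ∏ c_β!).

open import Defs
open import Data.Bool using (Bool; true; false; _∧_; _∨_; not; if_then_else_; T)
open import Data.Bool.Properties using (T-∧)
open import Data.Empty using (⊥-elim)
open import Data.Fin as Fin using (Fin; zero; suc; toℕ)
open import Data.Fin.Properties
  using (all?; any?; suc-injective; pigeonhole; punchOut-injective; toℕ<n; toℕ-fromℕ<; toℕ-injective)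
open import Data.Integer as ℤ using (ℤ; +_; _+_; _*_; -_; 0ℤ; 1ℤ)
import Data.Integer.Properties as ℤₚ
open import Algebra.Properties.CommutativeSemigroup ℤₚ.*-commutativeSemigroup
  using (x∙yz≈y∙xz; x∙yz≈xz∙y; xy∙z≈xz∙y; xy∙z≈x∙zy; interchange)
import Algebra.Properties.CommutativeSemigroup ℤₚ.+-commutativeSemigroup as ℤ+
open import Data.List
  using (List; []; _∷_; [_]; _++_; map; concatMap; upTo; length; filter; allFin; zip; initLast; _∷ʳ′_; replicate)
open import Data.List.Membership.Propositional using (_∈_; find)
open import Data.List.Membership.Propositional.Properties
  using (∈-map⁻; ∈-map⁺; ∈-++⁻; ∈-filter⁻; ∈-upTo⁺; ∈-upTo⁻; ∈-allFin)
open import Data.List.Properties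
  using (map-tabulate; filter-all; upTo-∷ʳ; map-++; map-upTo; map-cong; map-cong-local; map-∘; length-++; ∷ʳ-injective;
         ∷-injective; ≡-dec; length-map; length-upTo; length-tabulate; length-replicate)
open import Data.List.Relation.Unary.All as All using (All; []; _∷_)
open import Data.List.Relation.Unary.All.Properties using (++⁺; ¬All⇒Any¬)
open import Data.List.Relation.Unary.AllPairs using ([]; _∷_)
open import Data.List.Relation.Unary.Any using (here; there)
open import Data.List.Relation.Unary.Unique.Propositional using (Unique)
import Data.List.Relation.Unary.Unique.Propositional.Properties as Uniqueₚ
open import Data.Nat as ℕ using (ℕ; zero; suc; _∸_; _≤_; _<_; z≤n; s≤s; NonZero; _!; _≡ᵇ_; _^_)
import Data.Nat.Properties as ℕₚ
import Algebra.Properties.CommutativeSemigroup ℕₚ.+-commutativeSemigroup as ℕ+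
open import Data.Product using (Σ; _×_; _,_; proj₁; proj₂; ∃-syntax)
import Data.Product.Properties as Productₚ
open import Data.Rational as ℚ using (ℚ; _/_)
import Data.Rational.Properties as ℚₚ
import Data.Rational.Unnormalised as ℚᵘ
import Data.Rational.Unnormalised.Properties as ℚᵘₚ
open import Data.Sum using (_⊎_; inj₁; inj₂)
import Data.Sum.Properties as Sumₚ
open import Data.Unit using (⊤; tt)
open import Data.Vec as Vec using (Vec; []; _∷_; lookup)
import Data.Vec.Properties as Vecₚ
open import Function using (_∘_; id; case_of_; Equivalence; _⟨_⟩_)
open import Relation.Binary using (DecidableEquality)
open import Relation.Binary.PropositionalEquality hiding ([_])
open import Relation.Nullary using (Dec; yes; no; does; ¬_)
open import Relation.Nullary.Decidable using (_×-dec_; _→-dec_; ¬?; T?)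

-- Two points carry the count. Row `l` never runs into a conflict: if column `j` must repeat in row
-- `l` the symbol `s` of row `v`, then column `j` and symbol `s` have the same component through
-- `v`, so `s` also has the value `v` at `l`; conversely a symbol with value `v` at `l` finds
-- exactly one column that asks for it. Hence the number of choices for a row depends only on the
-- contents `r` and `c`, not on the rows already built. The first row is fixed and offers no choice,
-- although the formula has a factor for `l = 1`. The freedom comes back from the sum over `b`: fix
-- one sequence `std` of content `c`; every sequence of that content is `std` rearranged by exactly
-- ∏ c_β! permutations, and such a permutation acts as a free first row against the symbol tuples
-- `std`. The same count for `a`, where no condition is left, gives n!, the factor for `l = 0`.
-- Division is postponed to the end: every pair of contents gets an integer `contribution`, which is
-- compared with the formula after multiplication by the denominator.

private variable
  X Y : Set
  P Q : Set

-- Indicators, sums and products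

𝟙 : Dec P → ℤ
𝟙 d = if does d then 1ℤ else 0ℤ

bit : Dec P → ℕ
bit d = if does d then 1 else 0

𝟙-yes : (d : Dec P) → P → 𝟙 d ≡ 1ℤ
𝟙-yes (yes _) p = refl
𝟙-yes (no ¬p) p = ⊥-elim (¬p p)

𝟙-no : (d : Dec P) → ¬ P → 𝟙 d ≡ 0ℤ
𝟙-no (yes p) ¬p = ⊥-elim (¬p p)
𝟙-no (no _) ¬p = refl

bit-yes : (d : Dec P) → P → bit d ≡ 1
bit-yes (yes _) p = refl
bit-yes (no ¬p) p = ⊥-elim (¬p p)

bit-no : (d : Dec P) → ¬ P → bit d ≡ 0
bit-no (yes p) ¬p = ⊥-elim (¬p p)
bit-no (no _) ¬p = refl

bit-⇔ : (d : Dec P) (e : Dec Q) → (P → Q) → (Q → P) → bit d ≡ bit e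
bit-⇔ (yes p) e f g = sym (bit-yes e (f p))
bit-⇔ (no ¬p) e f g = sym (bit-no e (¬p ∘ g))

+bit : (d : Dec P) → + bit d ≡ 𝟙 d
+bit (yes _) = refl
+bit (no _) = refl

𝟙-⇔ : (d : Dec P) (e : Dec Q) → (P → Q) → (Q → P) → 𝟙 d ≡ 𝟙 e
𝟙-⇔ (yes p) e f g = sym (𝟙-yes e (f p))
𝟙-⇔ (no ¬p) e f g = sym (𝟙-no e (¬p ∘ g))

𝟙-× : (d : Dec P) (e : Dec Q) → 𝟙 (d ×-dec e) ≡ 𝟙 d * 𝟙 e
𝟙-× (yes _) e = sym (ℤₚ.*-identityˡ _)
𝟙-× (no _) e = refl

-- Allows an equality that holds only under `P` to be applied inside a sum, next to the indicator of
-- `P`.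
𝟙-guard : (d : Dec P) {x y : ℤ} → (P → x ≡ y) → 𝟙 d * x ≡ 𝟙 d * y
𝟙-guard (yes p) h = cong (1ℤ *_) (h p)
𝟙-guard (no _) h = refl

∑ ∏ : List X → (X → ℤ) → ℤ
∑ [] f = 0ℤ
∑ (x ∷ xs) f = f x + ∑ xs f
∏ [] f = 1ℤ
∏ (x ∷ xs) f = f x * ∏ xs f

# : {P : X → Set} → (∀ x → Dec (P x)) → List X → ℕ
# P? [] = 0
# P? (x ∷ xs) = bit (P? x) ℕ.+ # P? xs

∑-cong : ∀ xs {f g : X → ℤ} → (∀ x → x ∈ xs → f x ≡ g x) → ∑ xs f ≡ ∑ xs g
∑-cong [] h = refl
∑-cong (x ∷ xs) h = cong₂ _+_ (h x (here refl)) (∑-cong xs λ y y∈ → h y (there y∈))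

∏-cong : ∀ xs {f g : X → ℤ} → (∀ x → x ∈ xs → f x ≡ g x) → ∏ xs f ≡ ∏ xs g
∏-cong [] h = refl
∏-cong (x ∷ xs) h = cong₂ _*_ (h x (here refl)) (∏-cong xs λ y y∈ → h y (there y∈))

#-cong : {P Q : X → Set} (P? : ∀ x → Dec (P x)) (Q? : ∀ x → Dec (Q x)) → ∀ xs →
  (∀ x → x ∈ xs → (P x → Q x) × (Q x → P x)) → # P? xs ≡ # Q? xs
#-cong P? Q? [] h = refl
#-cong P? Q? (x ∷ xs) h = cong₂ ℕ._+_
  (bit-⇔ (P? x) (Q? x) (proj₁ (h x (here refl))) (proj₂ (h x (here refl))))
  (#-cong P? Q? xs λ y y∈ → h y (there y∈))

∑-++ : ∀ xs {ys} {f : X → ℤ} → ∑ (xs ++ ys) f ≡ ∑ xs f + ∑ ys f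
∑-++ [] = sym (ℤₚ.+-identityˡ _)
∑-++ (x ∷ xs) {ys} {f} = trans (cong (_+_ (f x)) (∑-++ xs)) (sym (ℤₚ.+-assoc (f x) _ _))

∏-++ : ∀ xs {ys} {f : X → ℤ} → ∏ (xs ++ ys) f ≡ ∏ xs f * ∏ ys f
∏-++ [] = sym (ℤₚ.*-identityˡ _)
∏-++ (x ∷ xs) {ys} {f} = trans (cong (f x *_) (∏-++ xs)) (sym (ℤₚ.*-assoc (f x) _ _))

∑-map : ∀ (h : Y → X) ys {f : X → ℤ} → ∑ (map h ys) f ≡ ∑ ys (f ∘ h)
∑-map h [] = refl
∑-map h (y ∷ ys) {f} = cong (_+_ (f (h y))) (∑-map h ys)

∏-map : ∀ (h : Y → X) ys {f : X → ℤ} → ∏ (map h ys) f ≡ ∏ ys (f ∘ h)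
∏-map h [] = refl
∏-map h (y ∷ ys) {f} = cong (f (h y) *_) (∏-map h ys)

#-map : {P : X → Set} (P? : ∀ x → Dec (P x)) (h : Y → X) → ∀ ys → # P? (map h ys) ≡ # (P? ∘ h) ys
#-map P? h [] = refl
#-map P? h (y ∷ ys) = cong (bit (P? (h y)) ℕ.+_) (#-map P? h ys)

∑-concatMap : ∀ (h : Y → List X) ys {f : X → ℤ} → ∑ (concatMap h ys) f ≡ ∑ ys (λ y → ∑ (h y) f)
∑-concatMap h [] = refl
∑-concatMap h (y ∷ ys) {f} = trans (∑-++ (h y)) (cong (_+_ (∑ (h y) f)) (∑-concatMap h ys))

∑-0 : ∀ (xs : List X) → ∑ xs (λ _ → 0ℤ) ≡ 0ℤ
∑-0 [] = refl
∑-0 (x ∷ xs) = trans (ℤₚ.+-identityˡ _) (∑-0 xs)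

∑-zero : ∀ (xs : List X) {f} → (∀ x → x ∈ xs → f x ≡ 0ℤ) → ∑ xs f ≡ 0ℤ
∑-zero xs h = trans (∑-cong xs h) (∑-0 xs)

∑-+ : ∀ xs (f g : X → ℤ) → ∑ xs (λ x → f x + g x) ≡ ∑ xs f + ∑ xs g
∑-+ [] f g = refl
∑-+ (x ∷ xs) f g = trans (cong (_+_ (f x + g x)) (∑-+ xs f g)) (ℤ+.interchange (f x) (g x) _ _)

∏-* : ∀ xs (f g : X → ℤ) → ∏ xs (λ x → f x * g x) ≡ ∏ xs f * ∏ xs g
∏-* [] f g = refl
∏-* (x ∷ xs) f g = trans (cong (f x * g x *_) (∏-* xs f g)) (interchange (f x) (g x) _ _)

∏-1 : ∀ (xs : List X) {f} → (∀ x → x ∈ xs → f x ≡ 1ℤ) → ∏ xs f ≡ 1ℤ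
∏-1 [] h = refl
∏-1 (x ∷ xs) h = cong₂ _*_ (h x (here refl)) (∏-1 xs λ y y∈ → h y (there y∈))

*-∑ : ∀ c xs (f : X → ℤ) → c * ∑ xs f ≡ ∑ xs (λ x → c * f x)
*-∑ c [] f = ℤₚ.*-zeroʳ c
*-∑ c (x ∷ xs) f = trans (ℤₚ.*-distribˡ-+ c (f x) _) (cong (_+_ (c * f x)) (*-∑ c xs f))

∑-*ʳ : ∀ xs (f : X → ℤ) c → ∑ xs f * c ≡ ∑ xs (λ x → f x * c)
∑-*ʳ [] f c = refl
∑-*ʳ (x ∷ xs) f c = trans (ℤₚ.*-distribʳ-+ c (f x) _) (cong (_+_ (f x * c)) (∑-*ʳ xs f c))

∑-swap : ∀ xs ys (f : X → Y → ℤ) → ∑ xs (λ x → ∑ ys (f x)) ≡ ∑ ys (λ y → ∑ xs λ x → f x y)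
∑-swap [] ys f = sym (∑-0 ys)
∑-swap (x ∷ xs) ys f = trans (cong (_+_ (∑ ys (f x))) (∑-swap xs ys f)) (sym (∑-+ ys _ _))

∑-filter : {P : X → Set} (P? : ∀ x → Dec (P x)) → ∀ xs {f : X → ℤ} →
  ∑ (filter P? xs) f ≡ ∑ xs (λ x → 𝟙 (P? x) * f x)
∑-filter P? [] = refl
∑-filter P? (x ∷ xs) {f} with P? x
... | yes _ = cong₂ _+_ (sym (ℤₚ.*-identityˡ (f x))) (∑-filter P? xs)
... | no _ = trans (∑-filter P? xs) (sym (ℤₚ.+-identityˡ _))

+# : {P : X → Set} (P? : ∀ x → Dec (P x)) → ∀ xs → + # P? xs ≡ ∑ xs (λ x → 𝟙 (P? x))
+# P? [] = refl
+# P? (x ∷ xs) = cong₂ _+_ (+bit (P? x)) (+# P? xs)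

length-filter : {P : X → Set} (P? : ∀ x → Dec (P x)) → ∀ xs → length (filter P? xs) ≡ # P? xs
length-filter P? [] = refl
length-filter P? (x ∷ xs) with P? x
... | yes _ = cong suc (length-filter P? xs)
... | no _ = length-filter P? xs

#-none : {P : X → Set} (P? : ∀ x → Dec (P x)) → ∀ xs → (∀ x → x ∈ xs → ¬ P x) → # P? xs ≡ 0
#-none P? [] h = refl
#-none P? (x ∷ xs) h =
  cong₂ ℕ._+_ (bit-no (P? x) (h x (here refl))) (#-none P? xs λ y y∈ → h y (there y∈))

#-pos : {P : X → Set} (P? : ∀ x → Dec (P x)) → ∀ xs → # P? xs ≢ 0 → ∃[ x ] x ∈ xs × P x
#-pos P? [] h = ⊥-elim (h refl)
#-pos P? (x ∷ xs) h with P? x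
... | yes p = x , here refl , p
... | no _ with y , y∈ , p ← #-pos P? xs h = y , there y∈ , p

#-one : {P : X → Set} (P? : ∀ x → Dec (P x)) → ∀ xs → Unique xs → ∀ {x} → x ∈ xs → P x →
  (∀ y → y ∈ xs → P y → y ≡ x) → # P? xs ≡ 1
#-one P? (x ∷ xs) (x∉ ∷ u) (here refl) px h = cong₂ ℕ._+_ (bit-yes (P? x) px)
  (#-none P? xs λ y y∈ py → All.lookup x∉ y∈ (sym (h y (there y∈) py)))
#-one P? (x ∷ xs) (x∉ ∷ u) (there x∈) px h = cong₂ ℕ._+_
  (bit-no (P? x) λ p → All.lookup x∉ x∈ (h x (here refl) p))
  (#-one P? xs u x∈ px λ y y∈ → h y (there y∈))

𝟙-All : {P : X → Set} (P? : ∀ x → Dec (P x)) → ∀ xs → 𝟙 (All.all? P? xs) ≡ ∏ xs (λ x → 𝟙 (P? x))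
𝟙-All P? [] = refl
𝟙-All P? (x ∷ xs) = trans
  (𝟙-⇔ (All.all? P? (x ∷ xs)) (P? x ×-dec All.all? P? xs) (λ { (p ∷ ps) → p , ps }) (λ { (p , ps) → p ∷ ps }))
  (trans (𝟙-× (P? x) (All.all? P? xs)) (cong (𝟙 (P? x) *_) (𝟙-All P? xs)))

allFin-suc : ∀ k → allFin (suc k) ≡ zero ∷ map suc (allFin k)
allFin-suc k = cong (zero ∷_) (sym (map-tabulate id suc))

∏-allFin-suc : ∀ k (f : Fin (suc k) → ℤ) → ∏ (allFin (suc k)) f ≡ f zero * ∏ (allFin k) (f ∘ suc)
∏-allFin-suc k f = trans (cong (λ l → ∏ l f) (allFin-suc k)) (cong (f zero *_) (∏-map suc (allFin k)))

#-allFin-suc : ∀ k {P : Fin (suc k) → Set} (P? : ∀ x → Dec (P x)) →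
  # P? (allFin (suc k)) ≡ bit (P? zero) ℕ.+ # (P? ∘ suc) (allFin k)
#-allFin-suc k P? = trans (cong (# P?) (allFin-suc k)) (cong (bit (P? zero) ℕ.+_) (#-map P? suc (allFin k)))

∀-suc : ∀ {k} {P : Fin (suc k) → Set} → P zero → (∀ i → P (suc i)) → ∀ i → P i
∀-suc p ps zero = p
∀-suc p ps (suc i) = ps i

𝟙-∀ : ∀ {k} {P : Fin k → Set} (P? : ∀ j → Dec (P j)) → 𝟙 (all? P?) ≡ ∏ (allFin k) (λ j → 𝟙 (P? j))
𝟙-∀ {zero} P? = 𝟙-yes (all? P?) λ ()
𝟙-∀ {suc k} P? = trans
  (𝟙-⇔ (all? P?) (P? zero ×-dec all? (P? ∘ suc)) (λ h → h zero , h ∘ suc) (λ (p , ps) → ∀-suc p ps))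
  (trans (𝟙-× (P? zero) (all? (P? ∘ suc)))
  (trans (cong (𝟙 (P? zero) *_) (𝟙-∀ (P? ∘ suc))) (sym (∏-allFin-suc k (λ j → 𝟙 (P? j))))))

-- Sums over vectors, and lists in which an element occurs exactly once

∑-vecs-suc : ∀ k (xs : List X) (f : Vec X (suc k) → ℤ) →
  ∑ (vecs (suc k) xs) f ≡ ∑ xs (λ x → ∑ (vecs k xs) λ v → f (x ∷ v))
∑-vecs-suc k xs f = trans (∑-concatMap _ xs) (∑-cong xs λ x _ → ∑-map (x ∷_) (vecs k xs))

-- `vecs` grows vectors at the front, but the condition on a row of an array refers to the rows
-- above it, so the last row has to be split off.
∑-vecs-∷ʳ : ∀ k (xs : List X) (f : Vec X (suc k) → ℤ) →
  ∑ (vecs (suc k) xs) f ≡ ∑ (vecs k xs) (λ v → ∑ xs λ x → f (v Vec.∷ʳ x))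
∑-vecs-∷ʳ zero xs f = trans (∑-vecs-suc 0 xs f)
  (trans (∑-cong xs λ x _ → ℤₚ.+-identityʳ _) (sym (ℤₚ.+-identityʳ _)))
∑-vecs-∷ʳ (suc k) xs f = trans (∑-vecs-suc (suc k) xs f)
  (trans (∑-cong xs λ x _ → ∑-vecs-∷ʳ k xs (f ∘ (x ∷_))) (sym (∑-vecs-suc k xs _)))

∏-∑ : ∀ k (xs : List X) (F : Fin k → X → ℤ) →
  ∏ (allFin k) (λ j → ∑ xs (F j)) ≡ ∑ (vecs k xs) (λ v → ∏ (allFin k) λ j → F j (lookup v j))
∏-∑ zero xs F = refl
∏-∑ (suc k) xs F = begin
  ∏ (allFin (suc k)) (λ j → ∑ xs (F j))
    ≡⟨ ∏-allFin-suc k (λ j → ∑ xs (F j)) ⟩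
  ∑ xs (F zero) * ∏ (allFin k) (λ j → ∑ xs (F (suc j)))
    ≡⟨ cong (∑ xs (F zero) *_) (∏-∑ k xs (F ∘ suc)) ⟩
  ∑ xs (F zero) * ∑ (vecs k xs) (λ v → ∏ (allFin k) λ j → F (suc j) (lookup v j))
    ≡⟨ ∑-*ʳ xs (F zero) _ ⟩
  ∑ xs (λ x → F zero x * ∑ (vecs k xs) (λ v → ∏ (allFin k) λ j → F (suc j) (lookup v j)))
    ≡⟨ ∑-cong xs (λ x _ → trans (*-∑ (F zero x) (vecs k xs) _)
         (∑-cong (vecs k xs) λ v _ → sym (∏-allFin-suc k λ j → F j (lookup (x ∷ v) j)))) ⟩
  ∑ xs (λ x → ∑ (vecs k xs) λ v → ∏ (allFin (suc k)) λ j → F j (lookup (x ∷ v) j))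
    ≡⟨ ∑-vecs-suc k xs _ ⟨
  ∑ (vecs (suc k) xs) (λ v → ∏ (allFin (suc k)) λ j → F j (lookup v j)) ∎
  where open ≡-Reasoning

∈-concatMap : ∀ {A B : Set} {h : A → List B} {y} xs → y ∈ concatMap h xs → ∃[ x ] x ∈ xs × y ∈ h x
∈-concatMap {h = h} (x ∷ xs) y∈ with ∈-++⁻ (h x) y∈
... | inj₁ p = x , here refl , p
... | inj₂ p with z , z∈ , q ← ∈-concatMap xs p = z , there z∈ , q

∈-vecs : ∀ k {xs : List X} {v} → v ∈ vecs k xs → ∀ j → lookup v j ∈ xs
∈-vecs (suc k) {xs} v∈ with x , x∈ , p ← ∈-concatMap xs v∈ with w , w∈ , refl ← ∈-map⁻ (x ∷_) p =
  ∀-suc x∈ (∈-vecs k w∈)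

module _ {X : Set} (_≟_ : DecidableEquality X) where

  -- Membership and absence of repetition in one property, stated as a sifting rule for sums. This
  -- is the form in which it is used, and it passes through `concatMap` without an argument that the
  -- pieces are disjoint.
  Once : List X → X → Set
  Once xs x = (F : X → ℤ) → ∑ xs (λ y → 𝟙 (y ≟ x) * F y) ≡ F x

  once-∉ : ∀ xs {x} → All (x ≢_) xs → (F : X → ℤ) → ∑ xs (λ y → 𝟙 (y ≟ x) * F y) ≡ 0ℤ
  once-∉ xs {x} x∉ F = ∑-zero xs λ y y∈ →
    cong (_* F y) (𝟙-no (y ≟ x) λ e → All.lookup x∉ y∈ (sym e))

  unique⇒once : ∀ {xs x} → Unique xs → x ∈ xs → Once xs x
  unique⇒once {x ∷ xs} (x∉ ∷ u) (here refl) F = trans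
    (cong₂ _+_ (trans (cong (_* F x) (𝟙-yes (x ≟ x) refl)) (ℤₚ.*-identityˡ (F x))) (once-∉ xs x∉ F))
    (ℤₚ.+-identityʳ (F x))
  unique⇒once {x ∷ xs} {y} (x∉ ∷ u) (there y∈) F = trans
    (cong₂ _+_ (cong (_* F x) (𝟙-no (x ≟ y) (All.lookup x∉ y∈))) (unique⇒once u y∈ F))
    (ℤₚ.+-identityˡ (F y))

  once⇒# : ∀ {xs x} → Once xs x → # (_≟ x) xs ≡ 1
  once⇒# {xs} {x} o = ℤₚ.+-injective (trans (+# (_≟ x) xs)
    (trans (∑-cong xs λ y _ → sym (ℤₚ.*-identityʳ _)) (o λ _ → 1ℤ)))

-- `vecs`, `A` and `comps` are all generated by this pattern; the inner list `L x` may depend on `x`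
-- because in `comps` the remaining total does.
once-concatMap : ∀ {A B C : Set} (_≟A_ : DecidableEquality A) (_≟B_ : DecidableEquality B)
  (_≟C_ : DecidableEquality C) (h : A → B → C) → (∀ {a b a′ b′} → h a b ≡ h a′ b′ → a ≡ a′ × b ≡ b′) →
  (L : A → List B) → ∀ {xs a b} → Once _≟A_ xs a → Once _≟B_ (L a) b →
  Once _≟C_ (concatMap (λ x → map (h x) (L x)) xs) (h a b)
once-concatMap _≟A_ _≟B_ _≟C_ h inj L {xs} {a} {b} oa ob F = begin
  ∑ (concatMap (λ x → map (h x) (L x)) xs) (λ y → 𝟙 (y ≟C h a b) * F y)
    ≡⟨ ∑-concatMap _ xs ⟩
  ∑ xs (λ x → ∑ (map (h x) (L x)) λ y → 𝟙 (y ≟C h a b) * F y)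
    ≡⟨ ∑-cong xs (λ x _ → trans (∑-map (h x) (L x)) (∑-cong (L x) λ y _ → split x y)) ⟩
  ∑ xs (λ x → ∑ (L x) λ y → 𝟙 (x ≟A a) * (𝟙 (y ≟B b) * F (h x y)))
    ≡⟨ ∑-cong xs (λ x _ → sym (*-∑ (𝟙 (x ≟A a)) (L x) _)) ⟩
  ∑ xs (λ x → 𝟙 (x ≟A a) * ∑ (L x) λ y → 𝟙 (y ≟B b) * F (h x y))
    ≡⟨ oa _ ⟩
  ∑ (L a) (λ y → 𝟙 (y ≟B b) * F (h a y))
    ≡⟨ ob _ ⟩
  F (h a b) ∎
  where
  open ≡-Reasoning
  split : ∀ x y → 𝟙 (h x y ≟C h a b) * F (h x y) ≡ 𝟙 (x ≟A a) * (𝟙 (y ≟B b) * F (h x y))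
  split x y = trans (cong (_* F (h x y)) (trans
    (𝟙-⇔ (h x y ≟C h a b) ((x ≟A a) ×-dec (y ≟B b)) inj (λ { (refl , refl) → refl }))
    (𝟙-× (x ≟A a) (y ≟B b)))) (ℤₚ.*-assoc (𝟙 (x ≟A a)) _ _)

-- Matchings between coloured columns and coloured symbols

Distinct : ∀ {Y : Set} {k} → Vec Y k → Set
Distinct σ = ∀ i j → lookup σ i ≡ lookup σ j → i ≡ j

#-trivial : ∀ {Y : Set} (S : List Y) → # (λ _ → yes tt) S ≡ length S
#-trivial [] = refl
#-trivial (y ∷ S) = cong suc (#-trivial S)

module _ {X : Set} (_≟_ : DecidableEquality X) where

  -- The product of the factorials of the colour-class sizes, found by inserting indices one at a
  -- time: an index that enlarges a class of size q contributes the factor q + 1. This form requires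
  -- no enumeration of the colours.
  Φ : ∀ {k} → (Fin k → X) → ℕ
  Φ {zero} f = 1
  Φ {suc k} f = suc (# (λ j → f (suc j) ≟ f zero) (allFin k)) ℕ.* Φ (f ∘ suc)

  module _ {Z : Set} {In : Z → X → Set} (In? : ∀ u x → Dec (In u x)) where

    -- A new index of colour `x` turns q! into (q + 1)! for exactly those classes that contain `x`,
    -- all of size `Q`; the exponent counts these classes.
    ∏!-step : ∀ U x Q (q : Z → ℕ) → (∀ u → u ∈ U → In u x → q u ≡ Q) →
      prodL (map (λ u → (bit (In? u x) ℕ.+ q u) !) U) ≡
      suc Q ^ # (λ u → In? u x) U ℕ.* prodL (map (λ u → q u !) U)
    ∏!-step [] x Q q h = refl
    ∏!-step (u ∷ U) x Q q h with ih ← ∏!-step U x Q q (λ v v∈ → h v (there v∈)) | In? u x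
    ... | yes p = begin
      suc (q u) ! ℕ.* _
        ≡⟨ cong₂ ℕ._*_ (cong (λ z → suc z ℕ.* q u !) (h u (here refl) p)) ih ⟩
      (suc Q ℕ.* q u !) ℕ.* (suc Q ^ c ℕ.* R)
        ≡⟨ ℕₚ.[m*n]*[o*p]≡[m*o]*[n*p] (suc Q) (q u !) (suc Q ^ c) R ⟩
      (suc Q ℕ.* suc Q ^ c) ℕ.* (q u ! ℕ.* R) ∎
      where
      open ≡-Reasoning
      c = # (λ u → In? u x) U
      R = prodL (map (λ u → q u !) U)
    ... | no _ = begin
      q u ! ℕ.* _ ≡⟨ cong (q u ! ℕ.*_) ih ⟩
      q u ! ℕ.* (suc Q ^ c ℕ.* R) ≡⟨ ℕₚ.*-assoc (q u !) (suc Q ^ c) R ⟨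
      q u ! ℕ.* suc Q ^ c ℕ.* R ≡⟨ cong (ℕ._* R) (ℕₚ.*-comm (q u !) (suc Q ^ c)) ⟩
      suc Q ^ c ℕ.* q u ! ℕ.* R ≡⟨ ℕₚ.*-assoc (suc Q ^ c) (q u !) R ⟩
      suc Q ^ c ℕ.* (q u ! ℕ.* R) ∎
      where
      open ≡-Reasoning
      c = # (λ u → In? u x) U
      R = prodL (map (λ u → q u !) U)

    -- Either one listed class contains the colour of `j` and it is the full colour class, or none
    -- does and no other index shares the colour, so that its class would contribute only 1! = 1.
    -- The second case is that of a column forced to repeat a symbol.
    Classified : ∀ {k} → List Z → (Fin k → X) → Fin k → Set
    Classified U f j =
      (# (λ u → In? u (f j)) U ≡ 1 ×
        (∀ u → u ∈ U → In u (f j) → ∀ j′ → (In u (f j′) → f j′ ≡ f j) × (f j′ ≡ f j → In u (f j′)))) ⊎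
      (# (λ u → In? u (f j)) U ≡ 0 × (∀ j′ → f j′ ≡ f j → j′ ≡ j))

    classified-suc : ∀ {k U} (f : Fin (suc k) → X) j → Classified U f (suc j) → Classified U (f ∘ suc) j
    classified-suc f j (inj₁ (c , h)) = inj₁ (c , λ u u∈ i j′ → h u u∈ i (suc j′))
    classified-suc f j (inj₂ (c , h)) = inj₂ (c , λ j′ e → suc-injective (h (suc j′) e))

    Φ-classes : ∀ {k} U (f : Fin k → X) → (∀ j → Classified U f j) →
      Φ f ≡ prodL (map (λ u → (# (λ j → In? u (f j)) (allFin k)) !) U)
    Φ-classes {zero} U f h = sym (ones U)
      where
      ones : ∀ V → prodL (map (λ _ → 1) V) ≡ 1
      ones [] = refl
      ones (_ ∷ V) = trans (ℕₚ.*-identityˡ _) (ones V)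
    Φ-classes {suc k} U f h = sym (begin
      prodL (map (λ u → (# (λ j → In? u (f j)) (allFin (suc k))) !) U)
        ≡⟨ cong prodL (map-cong (λ u → cong _! (#-allFin-suc k λ j → In? u (f j))) U) ⟩
      prodL (map (λ u → (bit (In? u (f zero)) ℕ.+ q u) !) U)
        ≡⟨ ∏!-step U (f zero) q₀ q agree ⟩
      suc q₀ ^ # (λ u → In? u (f zero)) U ℕ.* prodL (map (λ u → q u !) U)
        ≡⟨ cong₂ ℕ._*_ exponent (sym (Φ-classes U (f ∘ suc) λ j → classified-suc f j (h (suc j)))) ⟩
      suc q₀ ℕ.* Φ (f ∘ suc) ∎)
      where
      open ≡-Reasoning
      q = λ u → # (λ j → In? u (f (suc j))) (allFin k)
      q₀ = # (λ j → f (suc j) ≟ f zero) (allFin k)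
      agree : ∀ u → u ∈ U → In u (f zero) → q u ≡ q₀
      agree u u∈ p with h zero
      ... | inj₁ (_ , e) = #-cong _ _ (allFin k) λ j _ → e u u∈ p (suc j)
      ... | inj₂ (c , _) = ⊥-elim (absurd U u∈ c)
        where
        absurd : ∀ V → u ∈ V → # (λ u → In? u (f zero)) V ≢ 0
        absurd (v ∷ V) (here refl) e with In? v (f zero)
        ... | no ¬p = ¬p p
        absurd (v ∷ V) (there u∈) e = absurd V u∈ (ℕₚ.m+n≡0⇒n≡0 (bit (In? v (f zero))) e)
      exponent : suc q₀ ^ # (λ u → In? u (f zero)) U ≡ suc q₀
      exponent with h zero
      ... | inj₁ (c , _) = trans (cong (suc q₀ ^_) c) (ℕₚ.*-identityʳ (suc q₀))
      ... | inj₂ (c , l) = trans (cong (suc q₀ ^_) c) (cong suc (sym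
        (#-none _ (allFin k) λ j _ e → case (l (suc j) e) of λ ())))

module Matchings {X Y : Set} (_≟_ : DecidableEquality X) (_≟Y_ : DecidableEquality Y) where

  distinct? : ∀ {k} (σ : Vec Y k) → Dec (Distinct σ)
  distinct? σ = all? λ i → all? λ j → (lookup σ i ≟Y lookup σ j) →-dec (i Fin.≟ j)

  Matching : ∀ {k} → (Fin k → X) → (Y → X) → Vec Y k → Set
  Matching f g σ = Distinct σ × (∀ j → f j ≡ g (lookup σ j))

  matching? : ∀ {k} (f : Fin k → X) (g : Y → X) (σ : Vec Y k) → Dec (Matching f g σ)
  matching? f g σ = distinct? σ ×-dec all? (λ j → f j ≟ g (lookup σ j))

  avoids? : ∀ {k} (s : Y) (σ : Vec Y k) → Dec (∀ j → lookup σ j ≢ s)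
  avoids? s σ = all? λ j → ¬? (lookup σ j ≟Y s)

  remove : Y → List Y → List Y
  remove s = filter (λ y → ¬? (y ≟Y s))

  -- Trades the injectivity condition against the first column for a shorter list of symbols, so
  -- that the induction on columns meets a problem of the same kind.
  ∑-avoiding : ∀ k S s (F : Vec Y k → ℤ) →
    ∑ (vecs k S) (λ σ → 𝟙 (avoids? s σ) * F σ) ≡ ∑ (vecs k (remove s S)) F
  ∑-avoiding zero S s F = cong (λ z → z * F [] + 0ℤ) (𝟙-yes (avoids? s []) λ ()) ⟨ trans ⟩
    cong (_+ 0ℤ) (ℤₚ.*-identityˡ (F []))
  ∑-avoiding (suc k) S s F = begin
    ∑ (vecs (suc k) S) (λ σ → 𝟙 (avoids? s σ) * F σ)
      ≡⟨ ∑-vecs-suc k S _ ⟩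
    ∑ S (λ x → ∑ (vecs k S) λ σ → 𝟙 (avoids? s (x ∷ σ)) * F (x ∷ σ))
      ≡⟨ ∑-cong S (λ x _ → trans (∑-cong (vecs k S) λ σ _ → step x σ) (sym (*-∑ (𝟙 (¬? (x ≟Y s))) (vecs k S) _))) ⟩
    ∑ S (λ x → 𝟙 (¬? (x ≟Y s)) * ∑ (vecs k S) λ σ → 𝟙 (avoids? s σ) * F (x ∷ σ))
      ≡⟨ ∑-cong S (λ x _ → cong (𝟙 (¬? (x ≟Y s)) *_) (∑-avoiding k S s (F ∘ (x ∷_)))) ⟩
    ∑ S (λ x → 𝟙 (¬? (x ≟Y s)) * ∑ (vecs k (remove s S)) (F ∘ (x ∷_)))
      ≡⟨ ∑-filter (λ y → ¬? (y ≟Y s)) S ⟨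
    ∑ (remove s S) (λ x → ∑ (vecs k (remove s S)) (F ∘ (x ∷_)))
      ≡⟨ ∑-vecs-suc k (remove s S) F ⟨
    ∑ (vecs (suc k) (remove s S)) F ∎
    where
    open ≡-Reasoning
    step : ∀ x σ → 𝟙 (avoids? s (x ∷ σ)) * F (x ∷ σ) ≡ 𝟙 (¬? (x ≟Y s)) * (𝟙 (avoids? s σ) * F (x ∷ σ))
    step x σ = trans (cong (_* F (x ∷ σ)) (trans
      (𝟙-⇔ (avoids? s (x ∷ σ)) (¬? (x ≟Y s) ×-dec avoids? s σ) (λ h → h zero , h ∘ suc) (λ (p , q) → ∀-suc p q))
      (𝟙-× (¬? (x ≟Y s)) (avoids? s σ)))) (ℤₚ.*-assoc (𝟙 (¬? (x ≟Y s))) (𝟙 (avoids? s σ)) (F (x ∷ σ)))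

  #-remove : {P : Y → Set} (P? : ∀ y → Dec (P y)) → ∀ {S s} → Unique S → s ∈ S →
    # P? S ≡ bit (P? s) ℕ.+ # P? (remove s S)
  #-remove P? {y ∷ S} {s} (y∉ ∷ u) (here refl) with y ≟Y y
  ... | yes _ = cong (λ l → bit (P? y) ℕ.+ # P? l)
    (sym (filter-all (λ z → ¬? (z ≟Y y)) (All.map (λ y≢z z≡y → y≢z (sym z≡y)) y∉)))
  ... | no y≢y = ⊥-elim (y≢y refl)
  #-remove P? {y ∷ S} {s} (y∉ ∷ u) (there s∈) with y ≟Y s
  ... | yes y≡s = ⊥-elim (All.lookup y∉ s∈ y≡s)
  ... | no _ = trans (cong (bit (P? y) ℕ.+_) (#-remove P? u s∈)) (ℕ+.x∙yz≈y∙xz (bit (P? y)) (bit (P? s)) _)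

  length-remove : ∀ {S s} → Unique S → s ∈ S → length S ≡ suc (length (remove s S))
  length-remove {S} {s} u s∈ = begin
    length S ≡⟨ #-trivial S ⟨
    # (λ _ → yes tt) S ≡⟨ #-remove (λ _ → yes tt) u s∈ ⟩
    suc (# (λ _ → yes tt) (remove s S)) ≡⟨ cong suc (#-trivial (remove s S)) ⟩
    suc (length (remove s S)) ∎
    where open ≡-Reasoning

  𝟙-matching-∷ : ∀ {k} (f : Fin (suc k) → X) g s σ → 𝟙 (matching? f g (s ∷ σ)) ≡
    𝟙 (f zero ≟ g s) * (𝟙 (avoids? s σ) * 𝟙 (matching? (f ∘ suc) g σ))
  𝟙-matching-∷ f g s σ = trans
    (𝟙-⇔ (matching? f g (s ∷ σ)) ((f zero ≟ g s) ×-dec (avoids? s σ ×-dec matching? (f ∘ suc) g σ)) to from)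
    (trans (𝟙-× (f zero ≟ g s) (avoids? s σ ×-dec matching? (f ∘ suc) g σ))
           (cong (𝟙 (f zero ≟ g s) *_) (𝟙-× (avoids? s σ) (matching? (f ∘ suc) g σ))))
    where
    to : Matching f g (s ∷ σ) → f zero ≡ g s × (∀ j → lookup σ j ≢ s) × Matching (f ∘ suc) g σ
    to (d , h) = h zero , (λ j e → case d (suc j) zero e of λ ()) ,
      (λ i j e → suc-injective (d (suc i) (suc j) e)) , h ∘ suc
    from : f zero ≡ g s × (∀ j → lookup σ j ≢ s) × Matching (f ∘ suc) g σ → Matching f g (s ∷ σ)
    from (p , a , d , h) = dist , ∀-suc p h
      where
      dist : Distinct (s ∷ σ)
      dist zero zero e = refl
      dist zero (suc j) e = ⊥-elim (a j (sym e))
      dist (suc i) zero e = ⊥-elim (a i e)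
      dist (suc i) (suc j) e = cong suc (d i j e)

  ∑-matching-suc : ∀ {k} (f : Fin (suc k) → X) g S → ∑ (vecs (suc k) S) (λ σ → 𝟙 (matching? f g σ)) ≡
    ∑ S (λ s → 𝟙 (f zero ≟ g s) * ∑ (vecs k (remove s S)) (λ σ → 𝟙 (matching? (f ∘ suc) g σ)))
  ∑-matching-suc {k} f g S = trans (∑-vecs-suc k S _) (∑-cong S λ s _ → begin
    ∑ (vecs k S) (λ σ → 𝟙 (matching? f g (s ∷ σ)))
      ≡⟨ ∑-cong (vecs k S) (λ σ _ → 𝟙-matching-∷ f g s σ) ⟩
    ∑ (vecs k S) (λ σ → 𝟙 (f zero ≟ g s) * (𝟙 (avoids? s σ) * 𝟙 (matching? (f ∘ suc) g σ)))
      ≡⟨ *-∑ (𝟙 (f zero ≟ g s)) (vecs k S) _ ⟨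
    𝟙 (f zero ≟ g s) * ∑ (vecs k S) (λ σ → 𝟙 (avoids? s σ) * 𝟙 (matching? (f ∘ suc) g σ))
      ≡⟨ cong (𝟙 (f zero ≟ g s) *_) (∑-avoiding k S s _) ⟩
    𝟙 (f zero ≟ g s) * ∑ (vecs k (remove s S)) (λ σ → 𝟙 (matching? (f ∘ suc) g σ)) ∎)
    where open ≡-Reasoning

  unique-remove : ∀ {S} s → Unique S → Unique (remove s S)
  unique-remove s = Uniqueₚ.filter⁺ (λ y → ¬? (y ≟Y s))

  #f : ∀ {k} → (Fin k → X) → X → ℕ
  #f {k} f z = # (λ j → f j ≟ z) (allFin k)

  #g : (Y → X) → List Y → X → ℕ
  #g g S z = # (λ y → g y ≟ z) S

  -- Pairing the first column with a symbol of its colour lowers both counts of that colour by one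
  -- and leaves the others alone, so balance and imbalance both survive.
  counts-step : ∀ {k} (f : Fin (suc k) → X) g {S s} → Unique S → s ∈ S → f zero ≡ g s → ∀ z →
    (#f f z ≡ #g g S z → #f (f ∘ suc) z ≡ #g g (remove s S) z) ×
    (#f (f ∘ suc) z ≡ #g g (remove s S) z → #f f z ≡ #g g S z)
  counts-step {k} f g {S} {s} u s∈ p z =
    (λ e → ℕₚ.+-cancelˡ-≡ (bit (g s ≟ z)) _ _ (trans (sym lhs) (trans e rhs))) ,
    (λ e → trans lhs (trans (cong (bit (g s ≟ z) ℕ.+_) e) (sym rhs)))
    where
    lhs : #f f z ≡ bit (g s ≟ z) ℕ.+ #f (f ∘ suc) z
    lhs = trans (#-allFin-suc k λ j → f j ≟ z) (cong (λ x → bit (x ≟ z) ℕ.+ #f (f ∘ suc) z) p)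
    rhs : #g g S z ≡ bit (g s ≟ z) ℕ.+ #g g (remove s S) z
    rhs = #-remove (λ y → g y ≟ z) u s∈

  -- The first column has as many partners as there are symbols of its colour. By balance this is
  -- one more than the number of remaining columns of that colour, which is the leading factor of
  -- `Φ`.
  ∑-matching : ∀ {k} (f : Fin k → X) g S → Unique S → (∀ z → #f f z ≡ #g g S z) →
    ∑ (vecs k S) (λ σ → 𝟙 (matching? f g σ)) ≡ + Φ _≟_ f
  ∑-matching {zero} f g S u h =
    trans (ℤₚ.+-identityʳ _) (𝟙-yes (matching? f g []) ((λ ()) , λ ()))
  ∑-matching {suc k} f g S u h = begin
    ∑ (vecs (suc k) S) (λ σ → 𝟙 (matching? f g σ))
      ≡⟨ ∑-matching-suc f g S ⟩
    ∑ S (λ s → 𝟙 (f zero ≟ g s) * ∑ (vecs k (remove s S)) (λ σ → 𝟙 (matching? (f ∘ suc) g σ)))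
      ≡⟨ ∑-cong S (λ s s∈ → trans
           (𝟙-guard (f zero ≟ g s) λ p → ∑-matching (f ∘ suc) g (remove s S) (unique-remove s u)
             λ z → proj₁ (counts-step f g u s∈ p z) (h z))
           (cong (_* + Φ _≟_ (f ∘ suc)) (𝟙-⇔ (f zero ≟ g s) (g s ≟ f zero) sym sym))) ⟩
    ∑ S (λ s → 𝟙 (g s ≟ f zero) * + Φ _≟_ (f ∘ suc))
      ≡⟨ ∑-*ʳ S _ _ ⟨
    ∑ S (λ s → 𝟙 (g s ≟ f zero)) * + Φ _≟_ (f ∘ suc)
      ≡⟨ cong (_* + Φ _≟_ (f ∘ suc)) (+# (λ s → g s ≟ f zero) S) ⟨
    + #g g S (f zero) * + Φ _≟_ (f ∘ suc)
      ≡⟨ cong (λ c → + c * + Φ _≟_ (f ∘ suc)) (trans (sym (h (f zero))) (#-allFin-suc k λ j → f j ≟ f zero)) ⟩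
    + (bit (f zero ≟ f zero) ℕ.+ #f (f ∘ suc) (f zero)) * + Φ _≟_ (f ∘ suc)
      ≡⟨ cong (λ c → + (c ℕ.+ #f (f ∘ suc) (f zero)) * + Φ _≟_ (f ∘ suc)) (bit-yes (f zero ≟ f zero) refl) ⟩
    + suc (#f (f ∘ suc) (f zero)) * + Φ _≟_ (f ∘ suc)
      ≡⟨ ℤₚ.pos-* (suc (#f (f ∘ suc) (f zero))) (Φ _≟_ (f ∘ suc)) ⟨
    + Φ _≟_ f ∎
    where open ≡-Reasoning

  -- The imbalance at `z` survives every choice of a partner, so it would still be there once
  -- columns and symbols are both exhausted.
  ∑-mismatch : ∀ {k} (f : Fin k → X) g S → Unique S → k ≡ length S → ∀ z → #f f z ≢ #g g S z →
    ∑ (vecs k S) (λ σ → 𝟙 (matching? f g σ)) ≡ 0ℤ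
  ∑-mismatch {zero} f g [] u l z h = ⊥-elim (h refl)
  ∑-mismatch {suc k} f g S u l z h = trans (∑-matching-suc f g S) (∑-zero S λ s s∈ → trans
    (𝟙-guard (f zero ≟ g s) λ p → ∑-mismatch (f ∘ suc) g (remove s S) (unique-remove s u)
      (ℕₚ.suc-injective (trans l (length-remove u s∈))) z (h ∘ proj₂ (counts-step f g u s∈ p z)))
    (ℤₚ.*-zeroʳ (𝟙 (f zero ≟ g s))))

-- Positions and the tuples of A_m

_≟L_ : DecidableEquality (List ℕ)
_≟L_ = ≡-dec ℕ._≟_

positions-suc : ∀ m → positions (suc m) ≡ positions m ++ [ suc m ]
positions-suc m = trans (cong (map suc) (sym (upTo-∷ʳ m))) (map-++ suc (upTo m) [ m ])

positions-cons : ∀ m → positions (suc m) ≡ 1 ∷ map suc (positions m)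
positions-cons m = cong (1 ∷_) (cong (map suc) (sym (map-upTo suc m)))

∈-positions : ∀ {m i} → i < m → suc i ∈ positions m
∈-positions i<m = ∈-map⁺ suc (∈-upTo⁺ i<m)

positions⁻ : ∀ {m i} → i ∈ positions m → ∃[ k ] k < m × i ≡ suc k
positions⁻ i∈ with k , k∈ , e ← ∈-map⁻ suc i∈ = k , ∈-upTo⁻ k∈ , e

length-positions : ∀ m → length (positions m) ≡ m
length-positions m = trans (length-map suc (upTo m)) (length-upTo m)

at-positions : ∀ α → map (at α) (positions (length α)) ≡ α
at-positions [] = refl
at-positions (x ∷ α) = begin
  map (at (x ∷ α)) (positions (suc (length α)))
    ≡⟨ cong (map (at (x ∷ α))) (positions-cons (length α)) ⟩
  x ∷ map (at (x ∷ α)) (map suc (positions (length α)))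
    ≡⟨ cong (x ∷_) (cong (map (at (x ∷ α))) (sym (map-∘ (upTo (length α))))) ⟩
  x ∷ map (at (x ∷ α)) (map (λ k → suc (suc k)) (upTo (length α)))
    ≡⟨ cong (x ∷_) (sym (map-∘ (upTo (length α)))) ⟩
  x ∷ map (at α ∘ suc) (upTo (length α))
    ≡⟨ cong (x ∷_) (map-∘ (upTo (length α))) ⟩
  x ∷ map (at α) (positions (length α))
    ≡⟨ cong (x ∷_) (at-positions α) ⟩
  x ∷ α ∎
  where open ≡-Reasoning

at-map-positions : ∀ m (f : ℕ → ℕ) {i} → i < m → at (map f (positions m)) (suc i) ≡ f (suc i)
at-map-positions (suc m) f {i} i<m = trans (cong (λ l → at (map f l) (suc i)) (positions-cons m)) (aux i i<m)
  where
  aux : ∀ i → i < suc m → at (f 1 ∷ map f (map suc (positions m))) (suc i) ≡ f (suc i)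
  aux zero _ = refl
  aux (suc i) (s≤s i<m) = trans (cong (λ l → at l (suc i)) (sym (map-∘ (positions m))))
    (at-map-positions m (f ∘ suc) i<m)

at-++ˡ : ∀ α v {i} → i ≤ length α → at (α ++ [ v ]) i ≡ at α i
at-++ˡ [] v z≤n = refl
at-++ˡ (x ∷ α) v {zero} i≤ = refl
at-++ˡ (x ∷ α) v {suc zero} i≤ = refl
at-++ˡ (x ∷ α) v {suc (suc i)} (s≤s i≤) = at-++ˡ α v i≤

at-++ʳ : ∀ α v → at (α ++ [ v ]) (suc (length α)) ≡ v
at-++ʳ [] v = refl
at-++ʳ (x ∷ α) v = at-++ʳ α v

at-zero : ∀ α → at α 0 ≡ 0
at-zero [] = refl
at-zero (_ ∷ _) = refl

-- Membership in `A m` without reference to how the list is generated; `A-tuple` and `once-A` give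
-- the equivalence. The bound is `i` at position `suc i` because positions start at 1.
record IsTuple (m : ℕ) (α : List ℕ) : Set where
  field
    len : length α ≡ m
    at-≤ : ∀ {i} → i < m → at α (suc i) ≤ i
open IsTuple

tuple-∷ʳ : ∀ {m α v} → IsTuple m α → v ≤ m → IsTuple (suc m) (α ++ [ v ])
tuple-∷ʳ {α = α} {v} record { len = refl ; at-≤ = h } v≤m = record
  { len = trans (length-++ α) (ℕₚ.+-comm (length α) 1)
  ; at-≤ = λ {i} i< → bound i (ℕₚ.m≤n⇒m<n∨m≡n i<)
  }
  where
  bound : ∀ i → suc i < suc (length α) ⊎ suc i ≡ suc (length α) → at (α ++ [ v ]) (suc i) ≤ i
  bound i (inj₁ (s≤s i<)) = subst (_≤ i) (sym (at-++ˡ α v i<)) (h i<)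
  bound i (inj₂ refl) = subst (_≤ i) (sym (at-++ʳ α v)) v≤m

tuple-init : ∀ {m α v} → IsTuple (suc m) (α ++ [ v ]) → IsTuple m α × v ≤ m
tuple-init {m} {α} {v} t with len-α
  where
  len-α : length α ≡ m
  len-α = ℕₚ.suc-injective (trans (trans (ℕₚ.+-comm 1 (length α)) (sym (length-++ α))) (len t))
... | refl = record { len = refl ; at-≤ = λ i< → subst (_≤ _) (at-++ˡ α v i<) (at-≤ t (ℕₚ.m≤n⇒m≤1+n i<)) } ,
  subst (_≤ m) (at-++ʳ α v) (at-≤ t ℕₚ.≤-refl)

A-tuple : ∀ m {α} → α ∈ A m → IsTuple m α
A-tuple zero (here refl) = record { len = refl ; at-≤ = λ () }
A-tuple (suc m) α∈ with β , β∈ , p ← ∈-concatMap (A m) α∈ with v , v∈ , refl ← ∈-map⁻ (λ v → β ++ [ v ]) p =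
  tuple-∷ʳ (A-tuple m β∈) (ℕₚ.≤-pred (∈-upTo⁻ v∈))

once-upTo : ∀ {m v} → v < m → Once ℕ._≟_ (upTo m) v
once-upTo {m} v< = unique⇒once ℕ._≟_ (Uniqueₚ.upTo⁺ m) (∈-upTo⁺ v<)

once-A : ∀ m {α} → IsTuple m α → Once _≟L_ (A m) α
once-A zero {[]} t F = trans (ℤₚ.+-identityʳ _) (ℤₚ.*-identityˡ (F []))
once-A (suc m) {α} t with initLast α
... | β ∷ʳ′ v = once-concatMap _≟L_ ℕ._≟_ _≟L_ (λ α v → α ++ [ v ]) (∷ʳ-injective _ _) (λ _ → upTo (suc m)) {A m} {β} {v}
  (once-A m (proj₁ (tuple-init t))) (once-upTo (s≤s (proj₂ (tuple-init {α = β} t))))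
once-A (suc m) {α} t | [] with () ← len t

tuple-≡ : ∀ {m α β} → IsTuple m α → IsTuple m β → (∀ {i} → i < m → at α (suc i) ≡ at β (suc i)) → α ≡ β
tuple-≡ {m} {α} {β} s t h = begin
  α ≡⟨ at-positions α ⟨
  map (at α) (positions (length α)) ≡⟨ cong (map (at α) ∘ positions) (len s) ⟩
  map (at α) (positions m) ≡⟨ map-cong-local (All.tabulate λ i∈ → pointwise (positions⁻ i∈)) ⟩
  map (at β) (positions m) ≡⟨ cong (map (at β) ∘ positions) (len t) ⟨
  map (at β) (positions (length β)) ≡⟨ at-positions β ⟩
  β ∎
  where
  open ≡-Reasoning
  pointwise : ∀ {i} → ∃[ k ] k < m × i ≡ suc k → at α i ≡ at β i
  pointwise (k , k< , refl) = h k<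

-- Components

T-∧⁻ : ∀ {x y} → T (x ∧ y) → T x × T y
T-∧⁻ = Equivalence.to T-∧

T-∧⁺ : ∀ {x y} → T x → T y → T (x ∧ y)
T-∧⁺ p q = Equivalence.from T-∧ (p , q)

T-allB⁻ : ∀ {X : Set} {p : X → Bool} xs → T (allB p xs) → ∀ {x} → x ∈ xs → T (p x)
T-allB⁻ {p = p} (x ∷ xs) h (here refl) = proj₁ (T-∧⁻ {p x} h)
T-allB⁻ {p = p} (x ∷ xs) h (there x∈) = T-allB⁻ xs (proj₂ (T-∧⁻ {p x} h)) x∈

T-allB⁺ : ∀ {X : Set} {p : X → Bool} xs → (∀ {x} → x ∈ xs → T (p x)) → T (allB p xs)
T-allB⁺ [] h = tt
T-allB⁺ {p = p} (x ∷ xs) h = T-∧⁺ {p x} (h (here refl)) (T-allB⁺ xs λ x∈ → h (there x∈))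

T-not⁻ : ∀ {x} → T (not x) → ¬ T x
T-not⁻ {false} _ ()

T-not⁺ : ∀ {x} → ¬ T x → T (not x)
T-not⁺ {true} h = h tt
T-not⁺ {false} h = tt

-- The last element of `orbit f α i`, run with the same fuel.
root : ℕ → List ℕ → ℕ → ℕ
root zero α i = i
root (suc f) α i = if at α i ≡ᵇ 0 then i else root f α (at α i)

root-fixed : ∀ f α {i} → at α i ≡ 0 → root f α i ≡ i
root-fixed zero α e = refl
root-fixed (suc f) α e rewrite e = refl

inComp-root : ∀ f α i → T (anyB (_≡ᵇ root f α i) (orbit f α i))
inComp-root zero α i = T-≡ᵇ
  where
  T-≡ᵇ : T ((i ≡ᵇ i) ∨ false)
  T-≡ᵇ with i ≡ᵇ i | ℕₚ.≡⇒≡ᵇ i i refl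
  ... | true | _ = tt
inComp-root (suc f) α i with at α i ≡ᵇ 0
... | true with i ≡ᵇ i | ℕₚ.≡⇒≡ᵇ i i refl
...   | true | _ = tt
inComp-root (suc f) α i | false with i ≡ᵇ root f α (at α i)
... | true = tt
... | false = inComp-root f α (at α i)

-- Values lie below their positions, so a walk from `i` stops within `i` steps and more fuel changes
-- nothing.
root-stable : ∀ {m α} → IsTuple m α → ∀ f {i} → i ≤ f → i ≤ m → root (suc f) α i ≡ root f α i
root-stable {α = α} t f {zero} i≤f i≤m = trans (root-fixed (suc f) α (at-zero α)) (sym (root-fixed f α (at-zero α)))
root-stable {α = α} t (suc f) {suc i} (s≤s i≤f) i<m with at α (suc i) ≡ᵇ 0
... | true = refl
... | false = root-stable t f (ℕₚ.≤-trans (at-≤ t i<m) i≤f) (ℕₚ.≤-trans (at-≤ t i<m) (ℕₚ.<⇒≤ i<m))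

-- One step of the walk uses one unit of fuel, while both sides start with `length α`; `root-stable`
-- makes up the difference.
root-step : ∀ {m α i v} → IsTuple m α → i < m → at α (suc i) ≡ suc v →
  root (length α) α (suc i) ≡ root (length α) α (suc v)
root-step {m} {α} {i} {v} t i<m e with length α | len t
root-step {suc m} {α} {i} {v} t i<m e | _ | refl = trans step (sym (root-stable t m v≤m (ℕₚ.m≤n⇒m≤1+n v≤m)))
  where
  step : root (suc m) α (suc i) ≡ root m α (suc v)
  step rewrite e = refl
  v≤m : suc v ≤ m
  v≤m = ℕₚ.≤-trans (subst (_≤ i) e (at-≤ t i<m)) (ℕₚ.≤-pred i<m)

-- The component of l as a list over all positions: 0 outside, 1 + (value) inside.
entryOf : ℕ → List ℕ → ℕ → ℕ
entryOf l α k = if inComp l α k then suc (at α k) else 0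

mask : ℕ → ℕ → List ℕ → List ℕ
mask m l α = map (entryOf l α) (positions m)

map-≡⁻ : ∀ {X Y : Set} {f g : X → Y} xs → map f xs ≡ map g xs → ∀ {x} → x ∈ xs → f x ≡ g x
map-≡⁻ (x ∷ xs) e (here refl) = proj₁ (∷-injective e)
map-≡⁻ (x ∷ xs) e (there x∈) = map-≡⁻ xs (proj₂ (∷-injective e)) x∈

-- Values inside a component are stored shifted by one, so such an entry cannot be matched by a
-- position outside the other component.
mask-at : ∀ {m l l′} α β {i} → mask m l α ≡ mask m l′ β → i < m → T (inComp l α (suc i)) →
  at α (suc i) ≡ at β (suc i)
mask-at {m} {l} {l′} α β {i} e i<m p
  with inComp l α (suc i) | inComp l′ β (suc i) | map-≡⁻ (positions m) e (∈-positions i<m)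
... | true | true | q = ℕₚ.suc-injective q

-- The component through `i`, whatever its root; it compares a column with a symbol also at
-- positions that are not roots.
class : ℕ → List ℕ → ℕ → List ℕ
class m α i = mask m (root (length α) α i) α

class-fixed : ∀ m α {i} → at α i ≡ 0 → class m α i ≡ mask m i α
class-fixed m α e = cong (λ l → mask m l α) (root-fixed (length α) α e)

class-step : ∀ {m α i v} → IsTuple m α → i < m → at α (suc i) ≡ suc v → class m α (suc i) ≡ class m α (suc v)
class-step {m} {α} t i<m e = cong (λ l → mask m l α) (root-step t i<m e)

-- The value `suc v` puts position `suc i` into the component of `suc v`. That component therefore
-- records the value at `suc i`, and a tuple with the same component has it too.
class-at : ∀ {m α β i v} → IsTuple m α → i < m → class m α (suc v) ≡ class m β (suc v) →
  at α (suc i) ≡ suc v → at β (suc i) ≡ suc v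
class-at {m} {α} {β} {i} t i<m e p = trans (sym (mask-at α β (trans (class-step t i<m p) e) i<m
  (inComp-root (length α) α (suc i)))) p

-- As an equality of lists, agreement of components is visibly symmetric and transitive, which the
-- positionwise Boolean test does not show.
SameComp : ℕ → ℕ → List ℕ → List ℕ → Set
SameComp m l α β = at α l ≡ 0 × at β l ≡ 0 × mask m l α ≡ mask m l β

agreeᵇ : Bool → Bool → ℕ → ℕ → Bool
agreeᵇ x y p q = ((x ∧ y) ∨ (not x ∧ not y)) ∧ (not x ∨ (p ≡ᵇ q))

agree⁻ : ∀ x y p q → T (agreeᵇ x y p q) → (if x then suc p else 0) ≡ (if y then suc q else 0)
agree⁻ true true p q h = cong suc (ℕₚ.≡ᵇ⇒≡ p q h)
agree⁻ false false p q h = refl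

agree⁺ : ∀ x y p q → (if x then suc p else 0) ≡ (if y then suc q else 0) → T (agreeᵇ x y p q)
agree⁺ true true p q h = ℕₚ.≡⇒≡ᵇ p q (ℕₚ.suc-injective h)
agree⁺ false false p q h = tt

sameComp⁻ : ∀ m l α β → T (sameComp m l α β) → SameComp m l α β
sameComp⁻ m l α β h with p , h′ ← T-∧⁻ {at α l ≡ᵇ 0} h with q , r ← T-∧⁻ {at β l ≡ᵇ 0} h′ =
  ℕₚ.≡ᵇ⇒≡ _ _ p , ℕₚ.≡ᵇ⇒≡ _ _ q , map-cong-local (All.tabulate λ {k} k∈ →
    agree⁻ (inComp l α k) (inComp l β k) (at α k) (at β k) (T-allB⁻ (positions m) r k∈))

sameComp⁺ : ∀ m l α β → SameComp m l α β → T (sameComp m l α β)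
sameComp⁺ m l α β (p , q , r) = T-∧⁺ {at α l ≡ᵇ 0} (ℕₚ.≡⇒≡ᵇ _ _ p) (T-∧⁺ {at β l ≡ᵇ 0} (ℕₚ.≡⇒≡ᵇ _ _ q)
  (T-allB⁺ (positions m) λ {k} k∈ →
    agree⁺ (inComp l α k) (inComp l β k) (at α k) (at β k) (map-≡⁻ (positions m) r k∈)))

same? : ∀ m l α β → Dec (T (sameComp m l α β))
same? m l α β = T? (sameComp m l α β)

same-refl : ∀ m l α → at α l ≡ 0 → T (sameComp m l α α)
same-refl m l α e = sameComp⁺ m l α α (e , e , refl)

same-sym : ∀ m l α β → T (sameComp m l α β) → T (sameComp m l β α)
same-sym m l α β p = let e , q , r = sameComp⁻ m l α β p in sameComp⁺ m l β α (q , e , sym r)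

same-sym-trans : ∀ m l α β γ → T (sameComp m l α γ) → T (sameComp m l β γ) → T (sameComp m l α β)
same-sym-trans m l α β γ p q with a , _ , e ← sameComp⁻ m l α γ p | b , _ , f ← sameComp⁻ m l β γ q =
  sameComp⁺ m l α β (a , b , trans e (sym f))

-- Every l-component has exactly one representative

anyB-true : ∀ {X : Set} (p : X → Bool) xs → T (anyB p xs) → # (λ x → T? (p x)) xs ≢ 0
anyB-true p (x ∷ xs) h with p x
... | true = λ ()
... | false = anyB-true p xs h

anyB-false : ∀ {X : Set} (p : X → Bool) xs → ¬ T (anyB p xs) → ∀ {x} → x ∈ xs → ¬ T (p x)
anyB-false p (x ∷ xs) h x∈ t with p x in e
anyB-false p (x ∷ xs) h x∈ t | true = h tt
anyB-false p (x ∷ xs) h (here refl) t | false = subst T e t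
anyB-false p (x ∷ xs) h (there x∈) t | false = anyB-false p xs h x∈ t

-- Invariant of the scan: the component of `α` has one representative in `acc`, or it has none and
-- `α` is still to come.
repsAux-one : ∀ m l α acc L → at α l ≡ 0 →
  (# (λ z → same? m l z α) acc ≡ 1 ⊎ # (λ z → same? m l z α) acc ≡ 0 × α ∈ L) →
  # (λ z → same? m l z α) (repsAux m l acc L) ≡ 1
repsAux-one m l α acc [] e (inj₁ c) = c
repsAux-one m l α acc (x ∷ L) e h with (at x l ≡ᵇ 0) ∧ not (anyB (λ z → sameComp m l z x) acc) in eq
repsAux-one m l α acc (x ∷ L) e (inj₁ c) | true = repsAux-one m l α (x ∷ acc) L e (inj₁
  (cong₂ ℕ._+_ (bit-no (same? m l x α) new) c))
  where
  new : ¬ T (sameComp m l x α)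
  new s with z , z∈ , p ← #-pos (λ z → same? m l z α) acc (λ c0 → case trans (sym c) c0 of λ ()) =
    anyB-false _ acc (T-not⁻ (proj₂ (T-∧⁻ {at x l ≡ᵇ 0} (subst T (sym eq) tt)))) z∈ (same-sym-trans m l z x α p s)
repsAux-one m l α acc (x ∷ L) e (inj₂ (c , α∈)) | true with same? m l x α | α∈
... | yes s | _ = repsAux-one m l α (x ∷ acc) L e (inj₁ (cong₂ ℕ._+_ (bit-yes (same? m l x α) s) c))
... | no ¬s | here refl = ⊥-elim (¬s (same-refl m l x e))
... | no ¬s | there α∈L =
  repsAux-one m l α (x ∷ acc) L e (inj₂ (cong₂ ℕ._+_ (bit-no (same? m l x α) ¬s) c , α∈L))
repsAux-one m l α acc (x ∷ L) e (inj₁ c) | false = repsAux-one m l α acc L e (inj₁ c)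
repsAux-one m l α acc (x ∷ L) e (inj₂ (c , there α∈)) | false = repsAux-one m l α acc L e (inj₂ (c , α∈))
repsAux-one m l α acc (x ∷ L) e (inj₂ (c , here refl)) | false = ⊥-elim (subst T eq
  (T-∧⁺ {at x l ≡ᵇ 0} (ℕₚ.≡⇒≡ᵇ (at x l) 0 e) (T-not⁺ λ t → anyB-true (λ z → sameComp m l z x) acc t c)))

comps-l-one : ∀ m l {α} → α ∈ A m → at α l ≡ 0 → # (λ z → same? m l z α) (comps-l m l) ≡ 1
comps-l-one m l {α} α∈ e = repsAux-one m l α [] (A m) e (inj₂ (refl , α∈))

-- Contents of sequences of tuples

content : ∀ m {n} → Vec (List ℕ) n → List ℕ
content m {n} a = map (λ α → # (λ j → lookup a j ≟L α) (allFin n)) (A m)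

+sumWhere : ∀ b m r → + sumWhere b m r ≡ ∑ (zip (A m) r) (λ p → 𝟙 (T? (b (proj₁ p))) * + proj₂ p)
+sumWhere b m r = trans (aux (filter (λ p → T? (b (proj₁ p))) (zip (A m) r)))
  (∑-filter (λ p → T? (b (proj₁ p))) (zip (A m) r))
  where
  aux : ∀ ps → + sumL (map proj₂ ps) ≡ ∑ ps (λ p → + proj₂ p)
  aux [] = refl
  aux (p ∷ ps) = cong (_+_ (+ proj₂ p)) (aux ps)

∑-zip-map : ∀ {X Y : Set} (h : X → Y) xs (f : X × Y → ℤ) → ∑ (zip xs (map h xs)) f ≡ ∑ xs (λ x → f (x , h x))
∑-zip-map h [] f = refl
∑-zip-map h (x ∷ xs) f = cong (_+_ (f (x , h x))) (∑-zip-map h xs f)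

-- Turns sums over families, such as `qsum` and `ΣW`, into numbers of columns: each column
-- contributes 1 to exactly one entry of the content.
sumWhere-content : ∀ b m {n} (a : Vec (List ℕ) n) → (∀ j → lookup a j ∈ A m) →
  sumWhere b m (content m a) ≡ # (λ j → T? (b (lookup a j))) (allFin n)
sumWhere-content b m {n} a a∈ = ℤₚ.+-injective (begin
  + sumWhere b m (content m a)
    ≡⟨ +sumWhere b m (content m a) ⟩
  ∑ (zip (A m) (content m a)) (λ p → 𝟙 (T? (b (proj₁ p))) * + proj₂ p)
    ≡⟨ ∑-zip-map (λ α → # (λ j → lookup a j ≟L α) (allFin n)) (A m) _ ⟩
  ∑ (A m) (λ α → 𝟙 (T? (b α)) * + # (λ j → lookup a j ≟L α) (allFin n))
    ≡⟨ ∑-cong (A m) (λ α _ → trans (cong (𝟙 (T? (b α)) *_) (+# (λ j → lookup a j ≟L α) (allFin n)))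
         (*-∑ (𝟙 (T? (b α))) (allFin n) _)) ⟩
  ∑ (A m) (λ α → ∑ (allFin n) λ j → 𝟙 (T? (b α)) * 𝟙 (lookup a j ≟L α))
    ≡⟨ ∑-swap (A m) (allFin n) _ ⟩
  ∑ (allFin n) (λ j → ∑ (A m) λ α → 𝟙 (T? (b α)) * 𝟙 (lookup a j ≟L α))
    ≡⟨ ∑-cong (allFin n) (λ j _ → trans
         (∑-cong (A m) λ α _ → trans (ℤₚ.*-comm (𝟙 (T? (b α))) (𝟙 (lookup a j ≟L α)))
           (cong (_* 𝟙 (T? (b α))) (𝟙-⇔ (lookup a j ≟L α) (α ≟L lookup a j) sym sym)))
         (once-A m (A-tuple m (a∈ j)) λ α → 𝟙 (T? (b α)))) ⟩
  ∑ (allFin n) (λ j → 𝟙 (T? (b (lookup a j))))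
    ≡⟨ +# (λ j → T? (b (lookup a j))) (allFin n) ⟨
  + # (λ j → T? (b (lookup a j))) (allFin n) ∎)
  where open ≡-Reasoning

-- The number of admissible choices of one row

distinct-surjective : ∀ {n} (σ : Vec (Fin n) n) → Distinct σ → ∀ s → ∃[ j ] lookup σ j ≡ s
distinct-surjective {suc n} σ d s with any? (λ j → lookup σ j Fin.≟ s)
... | yes p = p
... | no ¬p = ⊥-elim (omitted λ j e → ¬p (j , sym e))
  where
  omitted : ¬ (∀ j → s ≢ lookup σ j)
  omitted h with i , j , i<j , e ← pigeonhole ℕₚ.≤-refl (λ j → Fin.punchOut (h j)) =
    ℕₚ.<-irrefl (cong toℕ (d i j (punchOut-injective (h i) (h j) e))) i<j

rows : ∀ n → List (Vec (Fin n) n)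
rows n = vecs n (allFin n)

-- `inj₁ (v , s)` stands for a cell bound to repeat the symbol `s` of row `v`, and `inj₂ z` for a
-- free cell whose component has the entries `z`.
Colour : ℕ → Set
Colour n = (ℕ × Fin n) ⊎ List ℕ

_≟C_ : ∀ {n} → DecidableEquality (Colour n)
_≟C_ = Sumₚ.≡-dec (Productₚ.≡-dec ℕ._≟_ Fin._≟_) _≟L_

module _ {n : ℕ} where
  open Matchings {Colour n} {Fin n} _≟C_ Fin._≟_ public using () renaming
    (Matching to Match; matching? to match?; ∑-matching to ∑-match; ∑-mismatch to ∑-nomatch; distinct? to distinctRow?)

colour : ∀ {n} → ℕ → (ℕ → Fin n) → List ℕ → Colour n
colour zero p z = inj₂ z
colour (suc v) p z = inj₁ (suc v , p (suc v))

colour-inj₁⁻ : ∀ {n} x {p : ℕ → Fin n} {z w s} → colour x p z ≡ inj₁ (w , s) → x ≡ w × p w ≡ s × w ≢ 0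
colour-inj₁⁻ (suc v) refl = refl , refl , λ ()

colour-inj₁⁺ : ∀ {n x} {p : ℕ → Fin n} {z v s} → x ≡ suc v → p (suc v) ≡ s → colour x p z ≡ inj₁ (suc v , s)
colour-inj₁⁺ refl refl = refl

colour-inj₂⁻ : ∀ {n} x {p : ℕ → Fin n} {z y} → colour x p z ≡ inj₂ y → x ≡ 0 × z ≡ y
colour-inj₂⁻ zero refl = refl , refl

colour-inj₂⁺ : ∀ {n x} {p : ℕ → Fin n} {z y} → x ≡ 0 → z ≡ y → colour x p z ≡ inj₂ y
colour-inj₂⁺ refl refl = refl

countsAgree : ℕ → ℕ → List ℕ → List ℕ → Bool
countsAgree m l r c = allB (λ α → not (at α l ≡ᵇ 0) ∨ (qsum m l c α ≡ᵇ qsum m l r α)) (A m)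

∏q! : ℕ → ℕ → List ℕ → ℕ
∏q! m l r = prodL (map (λ α → qsum m l r α !) (comps-l m l))

-- In row l, a column with entry v > 0 must repeat its symbol from row v, and a column
-- with entry 0 must receive a symbol of which it shares the l-component.
columnColour : ∀ {n} m → Vec (List ℕ) n → (ℕ → Vec (Fin n) n) → ℕ → Fin n → Colour n
columnColour m a ρ l j = colour (at (lookup a j) l) (λ v → lookup (ρ v) j) (mask m l (lookup a j))

symbolColour : ∀ {n} m → Vec (List ℕ) n → ℕ → Fin n → Colour n
symbolColour m b l s = colour (at (lookup b s) l) (λ _ → s) (mask m l (lookup b s))

-- The invariant carried from row to row: wherever a symbol stands in a column, the two tuples have
-- the same component through that row, even if the row is not its root.
Compatible : ∀ {n} m → (a b : Vec (List ℕ) n) → (ℕ → Vec (Fin n) n) → ℕ → Set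
Compatible m a b ρ i = ∀ {v} → v < i → Distinct (ρ (suc v)) ×
  (∀ j → class m (lookup a j) (suc v) ≡ class m (lookup b (lookup (ρ (suc v)) j)) (suc v))

module Row {m n} (a b : Vec (List ℕ) n) (a∈ : ∀ j → lookup a j ∈ A m) (b∈ : ∀ s → lookup b s ∈ A m)
  (ρ : ℕ → Vec (Fin n) n) (i : ℕ) (i<m : i < m) (compatible : Compatible m a b ρ i) where

  private
    l = suc i
    f = columnColour m a ρ l
    g = symbolColour m b l

  tupleᵃ : ∀ j → IsTuple m (lookup a j)
  tupleᵃ j = A-tuple m (a∈ j)

  tupleᵇ : ∀ j → IsTuple m (lookup b j)
  tupleᵇ j = A-tuple m (b∈ j)

  #f #g : Colour n → ℕ
  #f z = # (λ j → f j ≟C z) (allFin n)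
  #g z = # (λ s → g s ≟C z) (allFin n)

  uniqueFin : Unique (allFin n)
  uniqueFin = Uniqueₚ.allFin⁺ n

  bound : ∀ {α v} → IsTuple m α → at α l ≡ suc v → v < i
  bound t e = subst (_≤ i) e (at-≤ t i<m)

  value-agrees : ∀ {v} → v < i → ∀ j → (at (lookup a j) l ≡ suc v → at (lookup b (lookup (ρ (suc v)) j)) l ≡ suc v) ×
    (at (lookup b (lookup (ρ (suc v)) j)) l ≡ suc v → at (lookup a j) l ≡ suc v)
  value-agrees {v} v<i j = class-at {β = lookup b (lookup (ρ (suc v)) j)} (tupleᵃ j) i<m (proj₂ (compatible v<i) j) ,
    class-at {β = lookup a j} (tupleᵇ _) i<m (sym (proj₂ (compatible v<i) j))

  -- A colour `(suc v , s)` occurs at most once on either side: only `s` can have it among the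
  -- symbols, and only the column holding `s` in row `suc v` among the columns. By `value-agrees`
  -- both have it or neither does.
  repeated-counts : ∀ w s → #f (inj₁ (w , s)) ≡ #g (inj₁ (w , s))
  repeated-counts zero s = trans
    (#-none _ (allFin n) λ j _ e → proj₂ (proj₂ (colour-inj₁⁻ (at (lookup a j) l) e)) refl)
    (sym (#-none _ (allFin n) λ j _ e → proj₂ (proj₂ (colour-inj₁⁻ (at (lookup b j) l) e)) refl))
  repeated-counts (suc v) s with at (lookup b s) l ℕ.≟ suc v
  ... | yes p = trans
    (#-one _ (allFin n) uniqueFin (∈-allFin j₀) (colour-inj₁⁺ (proj₂ (value-agrees v<i j₀)
      (subst (λ s → at (lookup b s) l ≡ suc v) (sym j₀↦s) p)) j₀↦s)
      λ j _ e → proj₁ (compatible v<i) j j₀ (trans (proj₁ (proj₂ (colour-inj₁⁻ (at (lookup a j) l) e))) (sym j₀↦s)))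
    (sym (#-one _ (allFin n) uniqueFin (∈-allFin s) (colour-inj₁⁺ p refl)
      λ s′ _ e → proj₁ (proj₂ (colour-inj₁⁻ (at (lookup b s′) l) e))))
    where
    v<i = bound (tupleᵇ s) p
    j₀ = proj₁ (distinct-surjective (ρ (suc v)) (proj₁ (compatible v<i)) s)
    j₀↦s = proj₂ (distinct-surjective (ρ (suc v)) (proj₁ (compatible v<i)) s)
  ... | no ¬p = trans
    (#-none _ (allFin n) λ j _ e → ¬p (column j
      (proj₁ (colour-inj₁⁻ (at (lookup a j) l) e)) (proj₁ (proj₂ (colour-inj₁⁻ (at (lookup a j) l) e)))))
    (sym (#-none _ (allFin n) λ s′ _ e → ¬p (symbol s′
      (proj₁ (colour-inj₁⁻ (at (lookup b s′) l) e)) (proj₁ (proj₂ (colour-inj₁⁻ (at (lookup b s′) l) e))))))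
    where
    column : ∀ j → at (lookup a j) l ≡ suc v → lookup (ρ (suc v)) j ≡ s → at (lookup b s) l ≡ suc v
    column j q refl = proj₁ (value-agrees (bound (tupleᵃ j) q) j) q
    symbol : ∀ s′ → at (lookup b s′) l ≡ suc v → s′ ≡ s → at (lookup b s) l ≡ suc v
    symbol s′ q refl = q

  #fˢ #gˢ : List ℕ → ℕ
  #fˢ α = # (λ j → same? m l (lookup a j) α) (allFin n)
  #gˢ α = # (λ s → same? m l (lookup b s) α) (allFin n)

  #f-mask : ∀ α → at α l ≡ 0 → #f (inj₂ (mask m l α)) ≡ #fˢ α
  #f-mask α e = #-cong _ _ (allFin n) λ j _ →
    (λ p → let q , r = colour-inj₂⁻ (at (lookup a j) l) p in sameComp⁺ m l (lookup a j) α (q , e , r)) ,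
    (λ p → let q , _ , r = sameComp⁻ m l (lookup a j) α p in colour-inj₂⁺ q r)

  #g-mask : ∀ α → at α l ≡ 0 → #g (inj₂ (mask m l α)) ≡ #gˢ α
  #g-mask α e = #-cong _ _ (allFin n) λ j _ →
    (λ p → let q , r = colour-inj₂⁻ (at (lookup b j) l) p in sameComp⁺ m l (lookup b j) α (q , e , r)) ,
    (λ p → let q , _ , r = sameComp⁻ m l (lookup b j) α p in colour-inj₂⁺ q r)

  CountsAgree : Set
  CountsAgree = All (λ α → at α l ≡ 0 → #fˢ α ≡ #gˢ α) (A m)

  countsAgree? : Dec CountsAgree
  countsAgree? = All.all? (λ α → (at α l ℕ.≟ 0) →-dec (#fˢ α ℕ.≟ #gˢ α)) (A m)

  -- Agreement is known for components of tuples in `A m`; any other colour of this kind occurs on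
  -- neither side.
  root-counts : CountsAgree → ∀ z → #f (inj₂ z) ≡ #g (inj₂ z)
  root-counts h z with #f (inj₂ z) ℕ.≟ 0 | #g (inj₂ z) ℕ.≟ 0
  ... | yes p | yes q = trans p (sym q)
  ... | no p | _ with j , _ , e ← #-pos (λ j → f j ≟C inj₂ z) (allFin n) p with q , refl ← colour-inj₂⁻ (at (lookup a j) l) e =
    trans (#f-mask (lookup a j) q) (trans (All.lookup h (a∈ j) q) (sym (#g-mask (lookup a j) q)))
  ... | yes _ | no p with j , _ , e ← #-pos (λ j → g j ≟C inj₂ z) (allFin n) p with q , refl ← colour-inj₂⁻ (at (lookup b j) l) e =
    trans (#f-mask (lookup b j) q) (trans (All.lookup h (b∈ j) q) (sym (#g-mask (lookup b j) q)))

  #fˢ-qsum : ∀ α → qsum m l (content m a) α ≡ #fˢ α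
  #fˢ-qsum α = sumWhere-content (λ β → sameComp m l β α) m a a∈

  #gˢ-qsum : ∀ α → qsum m l (content m b) α ≡ #gˢ α
  #gˢ-qsum α = sumWhere-content (λ β → sameComp m l β α) m b b∈

  countsAgree⁻ : T (countsAgree m l (content m a) (content m b)) → CountsAgree
  countsAgree⁻ h = All.tabulate λ {α} α∈ e →
    trans (sym (#fˢ-qsum α)) (trans (sym (ℕₚ.≡ᵇ⇒≡ _ _ (simplify e (T-allB⁻ (A m) h α∈)))) (#gˢ-qsum α))
    where
    simplify : ∀ {x y} → x ≡ 0 → T (not (x ≡ᵇ 0) ∨ y) → T y
    simplify refl t = t

  countsAgree⁺ : CountsAgree → T (countsAgree m l (content m a) (content m b))
  countsAgree⁺ h = T-allB⁺ (A m) λ {α} α∈ → complicate (at α l) λ e → ℕₚ.≡⇒≡ᵇ _ _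
    (trans (#gˢ-qsum α) (trans (sym (All.lookup h α∈ e)) (sym (#fˢ-qsum α))))
    where
    complicate : ∀ x {y} → (x ≡ 0 → T y) → T (not (x ≡ᵇ 0) ∨ y)
    complicate zero k = k refl
    complicate (suc x) k = tt

  In : List ℕ → Colour n → Set
  In u x = at u l ≡ 0 × x ≡ inj₂ (mask m l u)

  in? : ∀ u x → Dec (In u x)
  in? u x = (at u l ℕ.≟ 0) ×-dec (x ≟C inj₂ (mask m l u))

  in⇒same : ∀ u j → In u (f j) → T (sameComp m l u (lookup a j))
  in⇒same u j (e , p) = let q , r = colour-inj₂⁻ (at (lookup a j) l) p in sameComp⁺ m l u (lookup a j) (e , q , sym r)

  same⇒in : ∀ u j → T (sameComp m l u (lookup a j)) → In u (f j)
  same⇒in u j p = let e , q , r = sameComp⁻ m l u (lookup a j) p in e , colour-inj₂⁺ q (sym r)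

  -- A free cell lies in the class of the one representative of its component. Two bound cells of
  -- equal colour would hold the same symbol in the same earlier row, so they coincide.
  classified : ∀ j → Classified _≟C_ in? (comps-l m l) f j
  classified j with f j in eq
  ... | inj₂ z = inj₁ (
    trans (#-cong _ _ (comps-l m l) λ u _ → (λ { (e , p) → in⇒same u j (e , trans eq p) }) ,
      (λ p → let e , q = same⇒in u j p in e , trans (sym eq) q))
          (comps-l-one m l (a∈ j) (proj₁ (colour-inj₂⁻ (at (lookup a j) l) eq))) ,
    λ u _ (e , p) j′ → (λ (_ , q) → trans q (sym p)) , (λ q → e , trans q p))
  ... | inj₁ (w , s) = inj₂ (#-none _ (comps-l m l) (λ { u _ (_ , ()) }) , λ j′ e →
    lonely w j′ (colour-inj₁⁻ (at (lookup a j) l) eq) (colour-inj₁⁻ (at (lookup a j′) l) e))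
    where
    lonely : ∀ w j′ {s} → at (lookup a j) l ≡ w × lookup (ρ w) j ≡ s × w ≢ 0 →
      at (lookup a j′) l ≡ w × lookup (ρ w) j′ ≡ s × w ≢ 0 → j′ ≡ j
    lonely zero j′ (_ , _ , ne) _ = ⊥-elim (ne refl)
    lonely (suc v) j′ (p , q , _) (_ , r , _) = proj₁ (compatible (bound (tupleᵃ j) p)) j′ j (trans r (sym q))

  Φ-row : Φ _≟C_ f ≡ ∏q! m l (content m a)
  Φ-row = trans (Φ-classes _≟C_ in? (comps-l m l) f classified) (cong prodL (map-cong (λ u → cong _! (trans
    (#-cong _ _ (allFin n) λ j _ →
      (λ p → same-sym m l u (lookup a j) (in⇒same u j p)) , (λ p → same⇒in u j (same-sym m l (lookup a j) u p)))
    (sym (#fˢ-qsum u)))) (comps-l m l)))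

  -- The rows above enter only through `compatible`. They always balance the bound colours, so the
  -- existence of a matching is decided by the free colours, whose counts depend on the contents
  -- alone.
  ∑-row : ∑ (rows n) (λ σ → 𝟙 (match? f g σ)) ≡
    𝟙 (T? (countsAgree m l (content m a) (content m b))) * + ∏q! m l (content m a)
  ∑-row with countsAgree?
  ... | yes h = trans (∑-match f g (allFin n) uniqueFin counts)
    (trans (cong +_ Φ-row) (sym (trans (cong (_* + ∏q! m l (content m a)) (𝟙-yes (T? _) (countsAgree⁺ h))) (ℤₚ.*-identityˡ _))))
    where
    counts : ∀ z → #f z ≡ #g z
    counts (inj₁ (w , s)) = repeated-counts w s
    counts (inj₂ z) = root-counts h z
  ... | no ¬h with α , _ , ¬p ← find (¬All⇒Any¬ (λ α → (at α l ℕ.≟ 0) →-dec (#fˢ α ℕ.≟ #gˢ α)) (A m) ¬h) = trans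
    (∑-nomatch f g (allFin n) uniqueFin (sym (length-tabulate id)) (inj₂ (mask m l α))
    (¬p ∘ λ p e → trans (sym (#f-mask α e)) (trans p (#g-mask α e))))
    (sym (cong (_* + ∏q! m l (content m a)) (𝟙-no (T? _) (¬h ∘ countsAgree⁻))))

-- Summing over arrays row by row

-- Rows are numbered from 1, in line with positions; index 0 and indices past the end give the
-- identity row as a default.
rowAt : ∀ {n k} → Vec (Vec (Fin n) n) k → ℕ → Vec (Fin n) n
rowAt [] _ = Vec.allFin _
rowAt (σ ∷ R) zero = Vec.allFin _
rowAt (σ ∷ R) (suc zero) = σ
rowAt (σ ∷ R) (suc (suc i)) = rowAt R (suc i)

rowAt-∷ʳˡ : ∀ {n k} (R : Vec (Vec (Fin n) n) k) σ {i} → i < k → rowAt (R Vec.∷ʳ σ) (suc i) ≡ rowAt R (suc i)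
rowAt-∷ʳˡ (x ∷ R) σ {zero} i<k = refl
rowAt-∷ʳˡ (x ∷ R) σ {suc i} (s≤s i<k) = rowAt-∷ʳˡ R σ i<k

rowAt-∷ʳʳ : ∀ {n k} (R : Vec (Vec (Fin n) n) k) σ → rowAt (R Vec.∷ʳ σ) (suc k) ≡ σ
rowAt-∷ʳʳ [] σ = refl
rowAt-∷ʳʳ (x ∷ R) σ = rowAt-∷ʳʳ R σ

rowAt-lookup : ∀ {n k} (R : Vec (Vec (Fin n) n) k) i → rowAt R (suc (toℕ i)) ≡ lookup R i
rowAt-lookup (x ∷ R) zero = refl
rowAt-lookup (x ∷ R) (suc i) = rowAt-lookup R i

_≟R_ : ∀ {n} → DecidableEquality (Vec (Fin n) n)
_≟R_ = Vecₚ.≡-dec Fin._≟_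

once-vecs : ∀ {X : Set} (_≟_ : DecidableEquality X) {k xs} (v : Vec X k) → (∀ j → Once _≟_ xs (lookup v j)) →
  Once (Vecₚ.≡-dec _≟_) (vecs k xs) v
once-vecs _≟_ [] h F = trans (ℤₚ.+-identityʳ _) (ℤₚ.*-identityˡ (F []))
once-vecs _≟_ {suc k} {xs} (x ∷ v) h = once-concatMap _≟_ (Vecₚ.≡-dec _≟_) (Vecₚ.≡-dec _≟_) _∷_ Vecₚ.∷-injective
  (λ _ → vecs k xs) {xs} {x} {v} (h zero) (once-vecs _≟_ v (h ∘ suc))

once-rows : ∀ {n} (σ : Vec (Fin n) n) → Once _≟R_ (rows n) σ
once-rows {n} σ = once-vecs Fin._≟_ σ λ j → unique⇒once Fin._≟_ (Uniqueₚ.allFin⁺ n) (∈-allFin (lookup σ j))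

FirstRow : ∀ {n} → ℕ → Vec (Fin n) n → Set
FirstRow {n} l σ = l ≡ 1 → σ ≡ Vec.allFin n

firstRow? : ∀ {n} l (σ : Vec (Fin n) n) → Dec (FirstRow l σ)
firstRow? {n} l σ = (l ℕ.≟ 1) →-dec (σ ≟R Vec.allFin n)

module _ {n} (m : ℕ) (a b : Vec (List ℕ) n) where

  RowOK : (ℕ → Vec (Fin n) n) → ℕ → Vec (Fin n) n → Set
  RowOK ρ l σ = FirstRow l σ × Match (columnColour m a ρ l) (symbolColour m b l) σ

  rowOK? : ∀ ρ l σ → Dec (RowOK ρ l σ)
  rowOK? ρ l σ = firstRow? l σ ×-dec match? (columnColour m a ρ l) (symbolColour m b l) σ

  Good : ∀ {k} → Vec (Vec (Fin n) n) k → Set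
  Good {k} R = All (λ l → RowOK (rowAt R) l (rowAt R l)) (positions k)

  good? : ∀ {k} (R : Vec (Vec (Fin n) n) k) → Dec (Good R)
  good? {k} R = All.all? (λ l → rowOK? (rowAt R) l (rowAt R l)) (positions k)

  goodRow : ∀ {k} (R : Vec (Vec (Fin n) n) k) → Good R → ∀ {i} → i < k → RowOK (rowAt R) (suc i) (rowAt R (suc i))
  goodRow R h i<k = All.lookup h (∈-positions i<k)

  -- What remains of the matching condition of row 1 once that row is the identity: column `j` holds
  -- symbol `j`, and every tuple has value 0 at position 1.
  firstComponents? : Dec (∀ j → mask m 1 (lookup a j) ≡ mask m 1 (lookup b j))
  firstComponents? = all? λ j → mask m 1 (lookup a j) ≟L mask m 1 (lookup b j)

  rowFactor : ℕ → ℤ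
  rowFactor l = 𝟙 (T? (countsAgree m l (content m a) (content m b))) * + ∏q! m l (content m a)

colour-value : ∀ {n} x y {p q : ℕ → Fin n} {z w} → colour x p z ≡ colour y q w → x ≡ y
colour-value zero zero e = refl
colour-value (suc x) (suc y) e = cong proj₁ (Sumₚ.inj₁-injective e)

colour-symbol : ∀ {n x} y {p q : ℕ → Fin n} {z w v} → colour x p z ≡ colour y q w → x ≡ suc v → p x ≡ q y
colour-symbol (suc y) e refl = cong proj₂ (Sumₚ.inj₁-injective e)

colour-mask : ∀ {n x} y {p q : ℕ → Fin n} {z w} → colour x p z ≡ colour y q w → x ≡ 0 → z ≡ w
colour-mask zero refl refl = refl

colour-cong : ∀ {n x y} {p q : ℕ → Fin n} {z w} → x ≡ y → (∀ {v} → x ≡ suc v → p x ≡ q x) → (x ≡ 0 → z ≡ w) →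
  colour x p z ≡ colour y q w
colour-cong {x = zero} refl f g = cong inj₂ (g refl)
colour-cong {x = suc x} refl f g = cong (λ s → inj₁ (suc x , s)) (f refl)

module _ {n} {m} (a b : Vec (List ℕ) n) (a∈ : ∀ j → lookup a j ∈ A m) (b∈ : ∀ s → lookup b s ∈ A m) where

  -- Values at position `suc i` are at most `i`, so the colours of a row depend only on the rows
  -- above it.
  columnColour-cong : ∀ (ρ ρ′ : ℕ → Vec (Fin n) n) {i} → i < m → (∀ {v} → v < i → ρ (suc v) ≡ ρ′ (suc v)) →
    ∀ j → columnColour m a ρ (suc i) j ≡ columnColour m a ρ′ (suc i) j
  columnColour-cong ρ ρ′ {i} i<m h j = colour-cong refl
    (λ {v} e → cong (λ σ → lookup σ j) (subst (λ x → ρ x ≡ ρ′ x) (sym e) (h (subst (_≤ i) e (at-≤ (A-tuple m (a∈ j)) i<m)))))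
    (λ _ → refl)

  rowOK-cong : ∀ (ρ ρ′ : ℕ → Vec (Fin n) n) {i σ} → i < m → (∀ {v} → v < i → ρ (suc v) ≡ ρ′ (suc v)) →
    RowOK m a b ρ (suc i) σ → RowOK m a b ρ′ (suc i) σ
  rowOK-cong ρ ρ′ i<m h (p , d , q) = p , d , λ j → trans (sym (columnColour-cong ρ ρ′ i<m h j)) (q j)

  𝟙-good-∷ʳ : ∀ {k} → k < m → ∀ (R : Vec (Vec (Fin n) n) k) σ →
    𝟙 (good? m a b (R Vec.∷ʳ σ)) ≡ 𝟙 (good? m a b R) * 𝟙 (rowOK? m a b (rowAt R) (suc k) σ)
  𝟙-good-∷ʳ {k} k<m R σ = trans
    (𝟙-⇔ (good? m a b R′) (good? m a b R ×-dec rowOK? m a b (rowAt R) (suc k) σ) to from)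
    (𝟙-× (good? m a b R) (rowOK? m a b (rowAt R) (suc k) σ))
    where
    R′ = R Vec.∷ʳ σ
    old : ∀ {i} → i < k → rowAt R′ (suc i) ≡ rowAt R (suc i)
    old = rowAt-∷ʳˡ R σ
    to : Good m a b R′ → Good m a b R × RowOK m a b (rowAt R) (suc k) σ
    to h = All.tabulate (λ l∈ → row (positions⁻ l∈)) ,
      subst (RowOK m a b (rowAt R) (suc k)) (rowAt-∷ʳʳ R σ) (rowOK-cong (rowAt R′) (rowAt R) k<m old (goodRow m a b R′ h ℕₚ.≤-refl))
      where
      row : ∀ {l} → ∃[ i ] i < k × l ≡ suc i → RowOK m a b (rowAt R) l (rowAt R l)
      row (i , i<k , refl) = subst (RowOK m a b (rowAt R) (suc i)) (old i<k)
        (rowOK-cong (rowAt R′) (rowAt R) (ℕₚ.<-trans i<k k<m) (λ v<i → old (ℕₚ.<-trans v<i i<k))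
          (goodRow m a b R′ h (ℕₚ.m≤n⇒m≤1+n i<k)))
    from : Good m a b R × RowOK m a b (rowAt R) (suc k) σ → Good m a b R′
    from (h , ok) = subst (All _) (sym (positions-suc k)) (++⁺ (All.tabulate λ l∈ → row (positions⁻ l∈)) (last ∷ []))
      where
      last : RowOK m a b (rowAt R′) (suc k) (rowAt R′ (suc k))
      last = rowOK-cong (rowAt R) (rowAt R′) k<m (λ v<k → sym (old v<k)) (subst (RowOK m a b (rowAt R) (suc k)) (sym (rowAt-∷ʳʳ R σ)) ok)
      row : ∀ {l} → ∃[ i ] i < k × l ≡ suc i → RowOK m a b (rowAt R′) l (rowAt R′ l)
      row (i , i<k , refl) = rowOK-cong (rowAt R) (rowAt R′) (ℕₚ.<-trans i<k k<m) (λ v<i → sym (old (ℕₚ.<-trans v<i i<k)))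
        (subst (RowOK m a b (rowAt R) (suc i)) (sym (old i<k)) (goodRow m a b R h i<k))

  -- Induction along κ. At a root, equal colours carry equal components. At a value `suc u`, equal
  -- colours say that row `suc u` of the column holds the same symbol, and the components agree
  -- there by induction.
  good⇒compatible : ∀ {k} → k ≤ m → ∀ (R : Vec (Vec (Fin n) n) k) → Good m a b R → Compatible m a b (rowAt R) k
  good⇒compatible {k} k≤m R h {v} v<k =
    proj₁ (proj₂ (goodRow m a b R h v<k)) , classes v v ℕₚ.≤-refl v<k
    where
    -- The recursion descends on the bound `w`, since κ may jump over several rows at once.
    classes : ∀ w v → v ≤ w → v < k → ∀ j →
      class m (lookup a j) (suc v) ≡ class m (lookup b (lookup (rowAt R (suc v)) j)) (suc v)
    classes w v v≤w v<k j = go (at (lookup a j) (suc v)) refl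
      where
      s = lookup (rowAt R (suc v)) j
      v<m = ℕₚ.<-≤-trans v<k k≤m
      same : columnColour m a (rowAt R) (suc v) j ≡ symbolColour m b (suc v) s
      same = proj₂ (proj₂ (goodRow m a b R h v<k)) j
      value : at (lookup a j) (suc v) ≡ at (lookup b s) (suc v)
      value = colour-value (at (lookup a j) (suc v)) (at (lookup b s) (suc v)) same
      earlier : ∀ w → v ≤ w → ∀ u → u < v → class m (lookup a j) (suc u) ≡ class m (lookup b (lookup (rowAt R (suc u)) j)) (suc u)
      earlier zero v≤w u u<v = case ℕₚ.<-≤-trans u<v v≤w of λ ()
      earlier (suc w) v≤w u u<v = classes w u (ℕₚ.≤-pred (ℕₚ.<-≤-trans u<v v≤w)) (ℕₚ.<-trans u<v v<k) j
      go : ∀ x → at (lookup a j) (suc v) ≡ x → class m (lookup a j) (suc v) ≡ class m (lookup b s) (suc v)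
      go zero e = trans (class-fixed m (lookup a j) e) (trans
        (colour-mask (at (lookup b s) (suc v)) same e)
        (sym (class-fixed m (lookup b s) (trans (sym value) e))))
      go (suc u) e = begin
        class m (lookup a j) (suc v) ≡⟨ class-step (A-tuple m (a∈ j)) v<m e ⟩
        class m (lookup a j) (suc u) ≡⟨ earlier w v≤w u (subst (_≤ v) e (at-≤ (A-tuple m (a∈ j)) v<m)) ⟩
        class m (lookup b (lookup (rowAt R (suc u)) j)) (suc u) ≡⟨ cong (λ s → class m (lookup b s) (suc u))
              (trans (cong (λ x → lookup (rowAt R x) j) (sym e)) (colour-symbol (at (lookup b s) (suc v)) same e)) ⟩
        class m (lookup b s) (suc u) ≡⟨ class-step (A-tuple m (b∈ s)) v<m (trans (sym value) e) ⟨
        class m (lookup b s) (suc v) ∎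
        where open ≡-Reasoning

  ∑-good-suc : ∀ {k} → k < m → ∑ (vecs (suc k) (rows n)) (λ R → 𝟙 (good? m a b R)) ≡
    ∑ (vecs k (rows n)) (λ R → 𝟙 (good? m a b R) * ∑ (rows n) (λ σ → 𝟙 (rowOK? m a b (rowAt R) (suc k) σ)))
  ∑-good-suc {k} k<m = trans (∑-vecs-∷ʳ k (rows n) _) (∑-cong (vecs k (rows n)) λ R _ →
    trans (∑-cong (rows n) λ σ _ → 𝟙-good-∷ʳ k<m R σ) (sym (*-∑ (𝟙 (good? m a b R)) (rows n) _)))

  at-first : ∀ {α} → 0 < m → α ∈ A m → at α 1 ≡ 0
  at-first 0<m α∈ = ℕₚ.n≤0⇒n≡0 (at-≤ (A-tuple m α∈) 0<m)

  firstRow-match : 0 < m → ∀ ρ σ → Match (columnColour m a ρ 1) (symbolColour m b 1) σ →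
    ∀ j → mask m 1 (lookup a j) ≡ mask m 1 (lookup b (lookup σ j))
  firstRow-match 0<m ρ σ (_ , h) j = colour-mask (at (lookup b (lookup σ j)) 1) (h j) (at-first 0<m (a∈ j))

  match-firstRow : 0 < m → ∀ ρ σ → Distinct σ → (∀ j → mask m 1 (lookup a j) ≡ mask m 1 (lookup b (lookup σ j))) →
    Match (columnColour m a ρ 1) (symbolColour m b 1) σ
  match-firstRow 0<m ρ σ d h = d , λ j → colour-cong
    (trans (at-first 0<m (a∈ j)) (sym (at-first 0<m (b∈ (lookup σ j)))))
    (λ e → case trans (sym (at-first 0<m (a∈ j))) e of λ ()) (λ _ → h j)

  ∑-firstRow : 0 < m → ∀ ρ → ∑ (rows n) (λ σ → 𝟙 (rowOK? m a b ρ 1 σ)) ≡ 𝟙 (firstComponents? m a b)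
  ∑-firstRow 0<m ρ = trans (∑-cong (rows n) λ σ _ → trans
    (𝟙-⇔ (rowOK? m a b ρ 1 σ) ((σ ≟R Vec.allFin n) ×-dec firstComponents? m a b) (to σ) (from σ))
    (𝟙-× (σ ≟R Vec.allFin n) (firstComponents? m a b)))
    (once-rows (Vec.allFin n) λ _ → 𝟙 (firstComponents? m a b))
    where
    to : ∀ σ → RowOK m a b ρ 1 σ → σ ≡ Vec.allFin n × (∀ j → mask m 1 (lookup a j) ≡ mask m 1 (lookup b j))
    to σ (p , q) with refl ← p refl = refl , λ j → trans (firstRow-match 0<m ρ (Vec.allFin n) q j)
      (cong (λ s → mask m 1 (lookup b s)) (Vecₚ.lookup-allFin j))
    from : ∀ σ → σ ≡ Vec.allFin n × (∀ j → mask m 1 (lookup a j) ≡ mask m 1 (lookup b j)) → RowOK m a b ρ 1 σ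
    from σ (refl , h) = (λ _ → refl) , match-firstRow 0<m ρ (Vec.allFin n)
      (λ i j e → trans (sym (Vecₚ.lookup-allFin i)) (trans e (Vecₚ.lookup-allFin j)))
      (λ j → trans (h j) (cong (λ s → mask m 1 (lookup b s)) (sym (Vecₚ.lookup-allFin j))))

  ∑-laterRow : ∀ {k} (R : Vec (Vec (Fin n) n) (suc k)) → suc k < m → Good m a b R →
    ∑ (rows n) (λ σ → 𝟙 (rowOK? m a b (rowAt R) (suc (suc k)) σ)) ≡ rowFactor m a b (suc (suc k))
  ∑-laterRow {k} R k<m h = trans
    (∑-cong (rows n) λ σ _ → 𝟙-⇔ (rowOK? m a b (rowAt R) (suc (suc k)) σ)
      (match? (columnColour m a (rowAt R) (suc (suc k))) (symbolColour m b (suc (suc k))) σ) proj₂ λ p → (λ ()) , p)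
    (Row.∑-row a b a∈ b∈ (rowAt R) (suc k) k<m (good⇒compatible (ℕₚ.<⇒≤ k<m) R h))

  -- Each later row multiplies the count by a factor independent of the array built so far. The
  -- product runs over rows 2, ..., k + 1 only: the fixed row 1 yields a condition in place of a
  -- factor.
  ∑-good : ∀ k → k < m → ∑ (vecs (suc k) (rows n)) (λ R → 𝟙 (good? m a b R)) ≡
    𝟙 (firstComponents? m a b) * ∏ (map suc (positions k)) (rowFactor m a b)
  ∑-good zero k<m = begin
    ∑ (vecs 1 (rows n)) (λ R → 𝟙 (good? m a b R))
      ≡⟨ ∑-good-suc k<m ⟩
    1ℤ * ∑ (rows n) (λ σ → 𝟙 (rowOK? m a b (rowAt []) 1 σ)) + 0ℤ
      ≡⟨ ℤₚ.+-identityʳ _ ⟩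
    1ℤ * ∑ (rows n) (λ σ → 𝟙 (rowOK? m a b (rowAt []) 1 σ))
      ≡⟨ ℤₚ.*-identityˡ _ ⟩
    ∑ (rows n) (λ σ → 𝟙 (rowOK? m a b (rowAt []) 1 σ))
      ≡⟨ ∑-firstRow k<m (rowAt []) ⟩
    𝟙 (firstComponents? m a b)
      ≡⟨ ℤₚ.*-identityʳ _ ⟨
    𝟙 (firstComponents? m a b) * 1ℤ ∎
    where open ≡-Reasoning
  ∑-good (suc k) k<m = begin
    ∑ (vecs (suc (suc k)) (rows n)) (λ R → 𝟙 (good? m a b R))
      ≡⟨ ∑-good-suc k<m ⟩
    ∑ (vecs (suc k) (rows n)) (λ R → 𝟙 (good? m a b R) * ∑ (rows n) (λ σ → 𝟙 (rowOK? m a b (rowAt R) (suc (suc k)) σ)))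
      ≡⟨ ∑-cong (vecs (suc k) (rows n)) (λ R _ → 𝟙-guard (good? m a b R) (∑-laterRow R k<m)) ⟩
    ∑ (vecs (suc k) (rows n)) (λ R → 𝟙 (good? m a b R) * F)
      ≡⟨ ∑-*ʳ (vecs (suc k) (rows n)) _ F ⟨
    ∑ (vecs (suc k) (rows n)) (λ R → 𝟙 (good? m a b R)) * F
      ≡⟨ cong (_* F) (∑-good k (ℕₚ.<⇒≤ k<m)) ⟩
    𝟙 (firstComponents? m a b) * ∏ (map suc (positions k)) (rowFactor m a b) * F
      ≡⟨ ℤₚ.*-assoc (𝟙 (firstComponents? m a b)) _ F ⟩
    𝟙 (firstComponents? m a b) * (∏ (map suc (positions k)) (rowFactor m a b) * F)
      ≡⟨ cong (𝟙 (firstComponents? m a b) *_) (sym extend) ⟩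
    𝟙 (firstComponents? m a b) * ∏ (map suc (positions (suc k))) (rowFactor m a b) ∎
    where
    open ≡-Reasoning
    F = rowFactor m a b (suc (suc k))
    extend : ∏ (map suc (positions (suc k))) (rowFactor m a b) ≡ ∏ (map suc (positions k)) (rowFactor m a b) * F
    extend = trans (cong (λ l → ∏ l (rowFactor m a b)) (trans (cong (map suc) (positions-suc k)) (map-++ suc (positions k) _)))
      (trans (∏-++ (map suc (positions k)) {f = rowFactor m a b}) (cong (∏ (map suc (positions k)) (rowFactor m a b) *_) (ℤₚ.*-identityʳ F)))

-- The tuples of the symbols are determined by the array and the tuples of the columns

_≟V_ : ∀ {n} → DecidableEquality (Vec (List ℕ) n)
_≟V_ = Vecₚ.≡-dec _≟L_

preimage : ∀ {n} → Vec (Fin n) n → Fin n → Fin n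
preimage σ s with any? (λ j → lookup σ j Fin.≟ s)
... | yes (j , _) = j
... | no _ = s

lookup-preimage : ∀ {n} (σ : Vec (Fin n) n) → Distinct σ → ∀ s → lookup σ (preimage σ s) ≡ s
lookup-preimage σ d s with any? (λ j → lookup σ j Fin.≟ s)
... | yes (_ , e) = e
... | no ¬p = ⊥-elim (¬p (distinct-surjective σ d s))

RowsOK : ∀ {n} m → (ℕ → Vec (Fin n) n) → Set
RowsOK m ρ = All (λ l → FirstRow l (ρ l) × Distinct (ρ l)) (positions m)

rowsOK? : ∀ {n} m (ρ : ℕ → Vec (Fin n) n) → Dec (RowsOK m ρ)
rowsOK? m ρ = All.all? (λ l → firstRow? l (ρ l) ×-dec distinctRow? (ρ l)) (positions m)

Respects : ∀ {n} → ℕ → (ℕ → Fin n) → List ℕ → Set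
Respects m x α = All (λ l → at α l ≢ 0 → x l ≡ x (at α l)) (positions m)

respects? : ∀ {n} m (x : ℕ → Fin n) α → Dec (Respects m x α)
respects? m x α = All.all? (λ l → ¬? (at α l ℕ.≟ 0) →-dec (x l Fin.≟ x (at α l))) (positions m)

column : ∀ {n} → (ℕ → Vec (Fin n) n) → Fin n → ℕ → Fin n
column ρ j l = lookup (ρ l) j

Admissible : ∀ {n} m → (ℕ → Vec (Fin n) n) → Vec (List ℕ) n → Set
Admissible m ρ a = RowsOK m ρ × (∀ j → Respects m (column ρ j) (lookup a j))

admissible? : ∀ {n} m (ρ : ℕ → Vec (Fin n) n) a → Dec (Admissible m ρ a)
admissible? m ρ a = rowsOK? m ρ ×-dec all? (λ j → respects? m (column ρ j) (lookup a j))

-- The colour of a bound cell names the symbol of the earlier row, the colour of a symbol names the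
-- symbol itself; their equality is the required repetition.
good⇒admissible : ∀ {n m} (a b : Vec (List ℕ) n) (R : Vec (Vec (Fin n) n) m) → Good m a b R → Admissible m (rowAt R) a
good⇒admissible {m = m} a b R h = All.map (λ (p , d , _) → p , d) h , λ j → All.map (λ {l} (_ , _ , e) → respects l j (e j)) h
  where
  respects : ∀ l j → columnColour m a (rowAt R) l j ≡ symbolColour m b l (lookup (rowAt R l) j) →
    at (lookup a j) l ≢ 0 → lookup (rowAt R l) j ≡ lookup (rowAt R (at (lookup a j) l)) j
  respects l j e ne with at (lookup a j) l in eq
  ... | zero = ⊥-elim (ne refl)
  ... | suc v = sym (colour-symbol (at (lookup b (lookup (rowAt R l) j)) l) {p = column (rowAt R) j} {z = mask m l (lookup a j)} e refl)

module Symbols {n m} (ρ : ℕ → Vec (Fin n) n) (a : Vec (List ℕ) n) (a∈ : ∀ j → lookup a j ∈ A m)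
  (admissible : Admissible m ρ a) where

  distinct : ∀ {i} → i < m → Distinct (ρ (suc i))
  distinct i<m = proj₂ (All.lookup (proj₁ admissible) (∈-positions i<m))

  repeats : ∀ {i v} j → i < m → at (lookup a j) (suc i) ≡ suc v → lookup (ρ (suc v)) j ≡ lookup (ρ (suc i)) j
  repeats j i<m e = sym (trans
    (All.lookup (proj₂ admissible j) (∈-positions i<m) (λ z → case trans (sym z) e of λ ()))
    (cong (λ x → lookup (ρ x) j) e))

  symbolTuple : Fin n → List ℕ
  symbolTuple s = map (λ l → at (lookup a (preimage (ρ l) s)) l) (positions m)

  symbols : Vec (List ℕ) n
  symbols = Vec.tabulate symbolTuple

  at-symbolTuple : ∀ {i} → i < m → ∀ j → at (symbolTuple (lookup (ρ (suc i)) j)) (suc i) ≡ at (lookup a j) (suc i)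
  at-symbolTuple {i} i<m j = trans (at-map-positions m _ i<m) (cong (λ k → at (lookup a k) (suc i))
    (distinct i<m _ _ (lookup-preimage (ρ (suc i)) (distinct i<m) (lookup (ρ (suc i)) j))))

  symbolTuple-isTuple : ∀ s → IsTuple m (symbolTuple s)
  symbolTuple-isTuple s = record
    { len = trans (length-map _ (positions m)) (length-positions m)
    ; at-≤ = λ {i} i<m → subst (_≤ i) (sym (at-map-positions m _ i<m)) (at-≤ (A-tuple m (a∈ _)) i<m)
    }

  -- κ leads from a cell holding `s` to a cell further up the same column that also holds `s`, so
  -- the walk in the tuple of the symbol stays in this column and copies its values.
  orbit-symbolTuple : ∀ f i j s → i < m → lookup (ρ (suc i)) j ≡ s →
    orbit f (lookup a j) (suc i) ≡ orbit f (symbolTuple s) (suc i) ×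
    All (λ k → lookup (ρ k) j ≡ s) (orbit f (lookup a j) (suc i))
  orbit-symbolTuple zero i j s i<m e = refl , e ∷ []
  orbit-symbolTuple (suc f) i j s i<m e
    with at (lookup a j) (suc i) in eq | trans (cong (λ s → at (symbolTuple s) (suc i)) (sym e)) (at-symbolTuple i<m j)
  ... | zero | p rewrite p = refl , e ∷ []
  ... | suc v | p with v<i ← subst (_≤ i) eq (at-≤ (A-tuple m (a∈ j)) i<m)
    with q , h ← orbit-symbolTuple f v j s (ℕₚ.<-trans v<i i<m) (trans (repeats j i<m eq) e)
    rewrite p = cong (suc i ∷_) q , e ∷ h

  anyB⇒∈ : ∀ l xs → T (anyB (_≡ᵇ l) xs) → l ∈ xs
  anyB⇒∈ l (x ∷ xs) t with x ≡ᵇ l in eq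
  ... | true = here (sym (ℕₚ.≡ᵇ⇒≡ x l (subst T (sym eq) tt)))
  ... | false = there (anyB⇒∈ l xs t)

  if-≡ : ∀ {x y p q} → (T x → T y × p ≡ q) → (T y → T x) → (if x then suc p else 0) ≡ (if y then suc q else 0)
  if-≡ {true} {true} f g = cong suc (proj₂ (f tt))
  if-≡ {true} {false} f g = ⊥-elim (proj₁ (f tt))
  if-≡ {false} {true} f g = ⊥-elim (g tt)
  if-≡ {false} {false} f g = refl

  -- In the rows of the column's component, column `j` holds `s`, so the symbol has these positions
  -- with the same values. Conversely, a walk of `s` that reaches row `l` stays in one column, which
  -- holds `s` in row `l` and therefore is `j`.
  mask-symbolTuple : ∀ {i} → i < m → ∀ j →
    mask m (suc i) (lookup a j) ≡ mask m (suc i) (symbolTuple (lookup (ρ (suc i)) j))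
  mask-symbolTuple {i} i<m j = map-cong-local (All.tabulate λ k∈ → entry-≡ (positions⁻ k∈))
    where
    l = suc i
    s = lookup (ρ l) j
    inComp-≡ : ∀ {k} j′ → k < m → lookup (ρ (suc k)) j′ ≡ s → inComp l (lookup a j′) (suc k) ≡ inComp l (symbolTuple s) (suc k)
    inComp-≡ {k} j′ k<m e = cong (anyB (_≡ᵇ l)) (trans
      (proj₁ (orbit-symbolTuple (length (lookup a j′)) k j′ s k<m e))
      (cong (λ f → orbit f (symbolTuple s) (suc k)) (trans (len (A-tuple m (a∈ j′))) (sym (len (symbolTuple-isTuple s))))))
    reaches : ∀ {k} j′ → k < m → T (inComp l (lookup a j′) (suc k)) → lookup (ρ l) j′ ≡ lookup (ρ (suc k)) j′
    reaches {k} j′ k<m t = All.lookup (proj₂ (orbit-symbolTuple (length (lookup a j′)) k j′ _ k<m refl)) (anyB⇒∈ l _ t)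
    entry-≡ : ∀ {k} → ∃[ k′ ] k′ < m × k ≡ suc k′ → entryOf l (lookup a j) k ≡ entryOf l (symbolTuple s) k
    entry-≡ (k , k<m , refl) = if-≡ to from
      where
      to : T (inComp l (lookup a j) (suc k)) → T (inComp l (symbolTuple s) (suc k)) × at (lookup a j) (suc k) ≡ at (symbolTuple s) (suc k)
      to t = subst T (inComp-≡ j k<m e) t , sym (trans (cong (λ s → at (symbolTuple s) (suc k)) (sym e)) (at-symbolTuple k<m j))
        where
        e : lookup (ρ (suc k)) j ≡ s
        e = sym (reaches j k<m t)
      from : T (inComp l (symbolTuple s) (suc k)) → T (inComp l (lookup a j) (suc k))
      from t = subst (λ j → T (inComp l (lookup a j) (suc k))) (distinct i<m j′ j (trans (reaches j′ k<m t′) e)) t′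
        where
        j′ = preimage (ρ (suc k)) s
        e = lookup-preimage (ρ (suc k)) (distinct k<m) s
        t′ = subst T (sym (inComp-≡ j′ k<m e)) t

module _ {n m} (R : Vec (Vec (Fin n) n) m) (a : Vec (List ℕ) n) (a∈ : ∀ j → lookup a j ∈ A m) where

  good-symbols : (adm : Admissible m (rowAt R) a) → Good m a (Symbols.symbols (rowAt R) a a∈ adm) R
  good-symbols adm = All.tabulate λ l∈ → row (positions⁻ l∈)
    where
    open Symbols (rowAt R) a a∈ adm
    row : ∀ {l} → ∃[ i ] i < m × l ≡ suc i → RowOK m a symbols (rowAt R) l (rowAt R l)
    row (i , i<m , refl) = proj₁ (All.lookup (proj₁ adm) (∈-positions i<m)) , distinct i<m , λ j →
      subst (λ β → columnColour m a (rowAt R) (suc i) j ≡ colour (at β (suc i)) (λ _ → lookup (rowAt R (suc i)) j) (mask m (suc i) β))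
        (sym (Vecₚ.lookup∘tabulate symbolTuple (lookup (rowAt R (suc i)) j)))
        (colour-cong (sym (at-symbolTuple i<m j)) (λ {v} e → trans (cong (λ x → lookup (rowAt R x) j) e) (repeats j i<m e))
          (λ _ → mask-symbolTuple i<m j))

  symbols-unique : (adm : Admissible m (rowAt R) a) → ∀ b → (∀ s → lookup b s ∈ A m) → Good m a b R →
    b ≡ Symbols.symbols (rowAt R) a a∈ adm
  symbols-unique adm b b∈ h = trans (sym (Vecₚ.tabulate∘lookup b)) (Vecₚ.tabulate-cong λ s →
    tuple-≡ (A-tuple m (b∈ s)) (symbolTuple-isTuple s) λ {i} i<m →
      let σ = rowAt R (suc i)
          j = preimage σ s
          e = lookup-preimage σ (distinct i<m) s
          v = colour-value (at (lookup a j) (suc i)) (at (lookup b (lookup σ j)) (suc i)) (proj₂ (proj₂ (goodRow m a b R h i<m)) j)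
      in trans (cong (λ s → at (lookup b s) (suc i)) (sym e)) (trans (sym v)
           (trans (sym (at-symbolTuple i<m j)) (cong (λ s → at (symbolTuple s) (suc i)) e))))
    where open Symbols (rowAt R) a a∈ adm

  -- Introducing `b` does not change the count, as an admissible array has exactly one sequence of
  -- symbol tuples. The gain is a condition that can be checked and counted row by row.
  ∑-symbols : ∑ (vecs n (A m)) (λ b → 𝟙 (good? m a b R)) ≡ 𝟙 (admissible? m (rowAt R) a)
  ∑-symbols with admissible? m (rowAt R) a
  ... | no ¬adm = trans
    (∑-zero (vecs n (A m)) λ b _ → 𝟙-no (good? m a b R) λ h → ¬adm (good⇒admissible a b R h))
    (sym (𝟙-no (admissible? m (rowAt R) a) ¬adm))
  ... | yes adm = trans (trans (∑-cong (vecs n (A m)) λ b b∈ → trans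
      (𝟙-⇔ (good? m a b R) (b ≟V symbols) (symbols-unique adm b (∈-vecs n b∈)) λ { refl → good-symbols adm })
      (sym (ℤₚ.*-identityʳ _)))
    (once-vecs _≟L_ symbols (λ s → subst (Once _≟L_ (A m)) (sym (Vecₚ.lookup∘tabulate symbolTuple s))
      (once-A m (symbolTuple-isTuple s))) λ _ → 1ℤ))
    (sym (𝟙-yes (admissible? m (rowAt R) a) adm))
    where open Symbols (rowAt R) a a∈ adm

-- Expanding the condition that a column has no repetition

-- Distinctness, stated by adding one entry at a time in step with the recursion of `A`.
ColumnOK : ∀ {n} → (ℕ → Fin n) → ℕ → Set
ColumnOK x zero = ⊤
ColumnOK x (suc m) = ColumnOK x m × All (λ l → x (suc m) ≢ x l) (positions m)

columnOK? : ∀ {n} (x : ℕ → Fin n) m → Dec (ColumnOK x m)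
columnOK? x zero = yes tt
columnOK? x (suc m) = columnOK? x m ×-dec All.all? (λ l → ¬? (x (suc m) Fin.≟ x l)) (positions m)

columnOK-injective : ∀ {n} (x : ℕ → Fin n) m → ColumnOK x m → ∀ {i k} → i < m → k < m → x (suc i) ≡ x (suc k) → i ≡ k
columnOK-injective x (suc m) (h , new) {i} {k} i<m k<m e with ℕₚ.m≤n⇒m<n∨m≡n i<m | ℕₚ.m≤n⇒m<n∨m≡n k<m
... | inj₁ (s≤s p) | inj₁ (s≤s q) = columnOK-injective x m h p q e
... | inj₁ (s≤s p) | inj₂ refl = ⊥-elim (All.lookup new (∈-positions p) (sym e))
... | inj₂ refl | inj₁ (s≤s q) = ⊥-elim (All.lookup new (∈-positions q) e)
... | inj₂ refl | inj₂ refl = refl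

injective-columnOK : ∀ {n} (x : ℕ → Fin n) m → (∀ {i k} → i < m → k < m → x (suc i) ≡ x (suc k) → i ≡ k) → ColumnOK x m
injective-columnOK x zero h = tt
injective-columnOK x (suc m) h = injective-columnOK x m (λ p q → h (ℕₚ.m≤n⇒m≤1+n p) (ℕₚ.m≤n⇒m≤1+n q)) ,
  All.tabulate λ l∈ → new (positions⁻ l∈)
  where
  new : ∀ {l} → ∃[ k ] k < m × l ≡ suc k → x (suc m) ≢ x l
  new (k , k<m , refl) e = ℕₚ.<-irrefl (sym (h ℕₚ.≤-refl (ℕₚ.m≤n⇒m≤1+n k<m) e)) k<m

signOf : ℕ → ℤ
signOf zero = 1ℤ
signOf (suc _) = - 1ℤ

factor : ∀ {n} → (ℕ → Fin n) → ℕ → ℕ → ℤ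
factor x l v = signOf v * 𝟙 (¬? (v ℕ.≟ 0) →-dec (x l Fin.≟ x v))

weight : ∀ {n} → (ℕ → Fin n) → ℕ → List ℕ → ℤ
weight x m α = ∏ (positions m) λ l → factor x l (at α l)

-- Among distinct x 1, …, x m at most one equals x (suc m), so 1 - #{v | x (suc m) = x v} is an indicator.
∑-factor : ∀ {n} (x : ℕ → Fin n) m → ColumnOK x m → ∑ (upTo (suc m)) (factor x (suc m)) ≡
  𝟙 (All.all? (λ l → ¬? (x (suc m) Fin.≟ x l)) (positions m))
∑-factor x m h = begin
  1ℤ + ∑ (Data.List.applyUpTo suc m) (factor x (suc m))
    ≡⟨ cong (λ l → 1ℤ + ∑ l (factor x (suc m))) (sym (map-upTo suc m)) ⟩
  1ℤ + ∑ (positions m) (factor x (suc m))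
    ≡⟨ cong (_+_ 1ℤ) (∑-cong (positions m) λ l l∈ → simplify (positions⁻ l∈)) ⟩
  1ℤ + ∑ (positions m) (λ l → - 1ℤ * 𝟙 (x (suc m) Fin.≟ x l))
    ≡⟨ cong (_+_ 1ℤ) (trans (sym (*-∑ (- 1ℤ) (positions m) _)) (cong (- 1ℤ *_) (sym (+# (λ l → x (suc m) Fin.≟ x l) (positions m))))) ⟩
  1ℤ + - 1ℤ * + # (λ l → x (suc m) Fin.≟ x l) (positions m)
    ≡⟨ count ⟩
  𝟙 (All.all? (λ l → ¬? (x (suc m) Fin.≟ x l)) (positions m)) ∎
  where
  open ≡-Reasoning
  simplify : ∀ {l} → ∃[ k ] k < m × l ≡ suc k → factor x (suc m) l ≡ - 1ℤ * 𝟙 (x (suc m) Fin.≟ x l)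
  simplify (k , _ , refl) = cong (- 1ℤ *_) (𝟙-⇔ (¬? (suc k ℕ.≟ 0) →-dec (x (suc m) Fin.≟ x (suc k)))
    (x (suc m) Fin.≟ x (suc k)) (λ f → f λ ()) λ e _ → e)
  unique : ∀ {l l′} → ∃[ k ] k < m × l ≡ suc k → ∃[ k ] k < m × l′ ≡ suc k → x l ≡ x l′ → l ≡ l′
  unique (_ , p , refl) (_ , q , refl) e = cong suc (columnOK-injective x m h p q e)
  one : ∀ {l} → l ∈ positions m → x (suc m) ≡ x l → # (λ l → x (suc m) Fin.≟ x l) (positions m) ≡ 1
  one l∈ e = #-one (λ l → x (suc m) Fin.≟ x l) (positions m) (Uniqueₚ.map⁺ ℕₚ.suc-injective (Uniqueₚ.upTo⁺ m)) l∈ e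
    λ l′ l′∈ e′ → unique (positions⁻ l′∈) (positions⁻ l∈) (trans (sym e′) e)
  count : 1ℤ + - 1ℤ * + # (λ l → x (suc m) Fin.≟ x l) (positions m) ≡ 𝟙 (All.all? (λ l → ¬? (x (suc m) Fin.≟ x l)) (positions m))
  count with # (λ l → x (suc m) Fin.≟ x l) (positions m) ℕ.≟ 0
  ... | yes c = trans (cong (λ c → 1ℤ + - 1ℤ * + c) c) (sym (𝟙-yes (All.all? _ (positions m)) (All.tabulate λ l∈ e →
    case trans (sym c) (one l∈ e) of λ ())))
  ... | no c with l , l∈ , e ← #-pos (λ l → x (suc m) Fin.≟ x l) (positions m) c =
    trans (cong (λ c → 1ℤ + - 1ℤ * + c) (one l∈ e)) (sym (𝟙-no (All.all? _ (positions m)) λ new → All.lookup new l∈ e))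

weight-∷ʳ : ∀ {n} (x : ℕ → Fin n) m {α} → IsTuple m α → ∀ v →
  weight x (suc m) (α ++ [ v ]) ≡ weight x m α * factor x (suc m) v
weight-∷ʳ x m {α} record { len = refl } v = begin
  weight x (suc m) (α ++ [ v ])
    ≡⟨ cong (λ ls → ∏ ls λ l → factor x l (at (α ++ [ v ]) l)) (positions-suc m) ⟩
  ∏ (positions m ++ [ suc m ]) (λ l → factor x l (at (α ++ [ v ]) l))
    ≡⟨ ∏-++ (positions m) {f = λ l → factor x l (at (α ++ [ v ]) l)} ⟩
  ∏ (positions m) (λ l → factor x l (at (α ++ [ v ]) l)) * (factor x (suc m) (at (α ++ [ v ]) (suc m)) * 1ℤ)
    ≡⟨ cong₂ _*_ (∏-cong (positions m) λ l l∈ → cong (factor x l) (old (positions⁻ l∈)))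
         (trans (ℤₚ.*-identityʳ _) (cong (factor x (suc m)) (at-++ʳ α v))) ⟩
  weight x m α * factor x (suc m) v ∎
  where
  open ≡-Reasoning
  old : ∀ {l} → ∃[ k ] k < m × l ≡ suc k → at (α ++ [ v ]) l ≡ at α l
  old (k , k<m , refl) = at-++ˡ α v k<m

∑-weight : ∀ {n} (x : ℕ → Fin n) m → ∑ (A m) (weight x m) ≡ 𝟙 (columnOK? x m)
∑-weight x zero = refl
∑-weight x (suc m) = begin
  ∑ (A (suc m)) (weight x (suc m))
    ≡⟨ ∑-concatMap _ (A m) ⟩
  ∑ (A m) (λ α → ∑ (map (λ v → α ++ [ v ]) (upTo (suc m))) (weight x (suc m)))
    ≡⟨ ∑-cong (A m) (λ α α∈ → trans (∑-map (λ v → α ++ [ v ]) (upTo (suc m)) {weight x (suc m)})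
         (trans (∑-cong (upTo (suc m)) λ v _ → weight-∷ʳ x m (A-tuple m α∈) v) (sym (*-∑ (weight x m α) (upTo (suc m)) _)))) ⟩
  ∑ (A m) (λ α → weight x m α * ∑ (upTo (suc m)) (factor x (suc m)))
    ≡⟨ ∑-*ʳ (A m) (weight x m) _ ⟨
  ∑ (A m) (weight x m) * ∑ (upTo (suc m)) (factor x (suc m))
    ≡⟨ cong (_* ∑ (upTo (suc m)) (factor x (suc m))) (∑-weight x m) ⟩
  𝟙 (columnOK? x m) * ∑ (upTo (suc m)) (factor x (suc m))
    -- The sum for the last position is evaluated under distinctness of the earlier entries, which
    -- the indicator already split off supplies.
    ≡⟨ 𝟙-guard (columnOK? x m) (∑-factor x m) ⟩
  𝟙 (columnOK? x m) * 𝟙 (All.all? (λ l → ¬? (x (suc m) Fin.≟ x l)) (positions m))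
    ≡⟨ 𝟙-× (columnOK? x m) (All.all? (λ l → ¬? (x (suc m) Fin.≟ x l)) (positions m)) ⟨
  𝟙 (columnOK? x (suc m)) ∎
  where open ≡-Reasoning

tupleSign : ℕ → List ℕ → ℤ
tupleSign m α = ∏ (positions m) λ l → signOf (at α l)

weight-respects : ∀ {n} (x : ℕ → Fin n) m α → weight x m α ≡ tupleSign m α * 𝟙 (respects? m x α)
weight-respects x m α = trans (∏-* (positions m) (λ l → signOf (at α l)) _)
  (cong (tupleSign m α *_) (sym (𝟙-All (λ l → ¬? (at α l ℕ.≟ 0) →-dec (x l Fin.≟ x (at α l))) (positions m))))

-- Reduced Latin rectangles as a signed count of arrays with tuples

module _ {m n} (R : Rect m n) where

  entry-rowAt : ∀ i j → entry R i j ≡ column (rowAt R) j (suc (toℕ i))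
  entry-rowAt i j = cong (λ σ → lookup σ j) (sym (rowAt-lookup R i))

  reduced⇒ : IsReducedLatin m n R → RowsOK m (rowAt R) × (∀ j → ColumnOK (column (rowAt R) j) m)
  reduced⇒ (rowsDistinct , columnsDistinct , first) =
    All.tabulate (λ l∈ → row (positions⁻ l∈)) ,
    λ j → injective-columnOK _ m λ {i} {k} i<m k<m e → trans (sym (toℕ-fromℕ< i<m)) (trans
      (cong toℕ (columnsDistinct (Fin.fromℕ< i<m) (Fin.fromℕ< k<m) j (trans (entry-< i<m j) (trans e (sym (entry-< k<m j))))))
      (toℕ-fromℕ< k<m))
    where
    entry-< : ∀ {i} (i<m : i < m) j → entry R (Fin.fromℕ< i<m) j ≡ column (rowAt R) j (suc i)
    entry-< i<m j = trans (entry-rowAt (Fin.fromℕ< i<m) j) (cong (λ i → column (rowAt R) j (suc i)) (toℕ-fromℕ< i<m))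
    row : ∀ {l} → ∃[ i ] i < m × l ≡ suc i → FirstRow l (rowAt R l) × Distinct (rowAt R l)
    row (i , i<m , refl) =
      (λ l≡1 → trans (sym (Vecₚ.tabulate∘lookup _)) (Vecₚ.tabulate-cong λ j →
        trans (sym (entry-< i<m j)) (first (Fin.fromℕ< i<m) j (trans (toℕ-fromℕ< i<m) (ℕₚ.suc-injective l≡1))))) ,
      λ j k e → rowsDistinct (Fin.fromℕ< i<m) j k (trans (entry-< i<m j) (trans e (sym (entry-< i<m k))))

  reduced⇐ : RowsOK m (rowAt R) × (∀ j → ColumnOK (column (rowAt R) j) m) → IsReducedLatin m n R
  reduced⇐ (rowsOK , columnsOK) =
    (λ i j k e → proj₂ (row i) j k (trans (sym (entry-rowAt i j)) (trans e (entry-rowAt i k)))) ,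
    (λ i k j e → toℕ-injective (columnOK-injective _ m (columnsOK j) (toℕ<n i) (toℕ<n k)
      (trans (sym (entry-rowAt i j)) (trans e (entry-rowAt k j))))) ,
    (λ i j e → trans (entry-rowAt i j) (trans (cong (λ σ → lookup σ j) (proj₁ (row i) (cong suc e))) (Vecₚ.lookup-allFin j)))
    where
    row : ∀ i → FirstRow (suc (toℕ i)) (rowAt R (suc (toℕ i))) × Distinct (rowAt R (suc (toℕ i)))
    row i = All.lookup rowsOK (∈-positions (toℕ<n i))

  𝟙-reduced : 𝟙 (isReducedLatin? m n R) ≡ ∑ (vecs n (A m)) (λ a →
    ∏ (allFin n) (λ j → tupleSign m (lookup a j)) * 𝟙 (admissible? m (rowAt R) a))
  𝟙-reduced = begin
    𝟙 (isReducedLatin? m n R)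
      ≡⟨ 𝟙-⇔ (isReducedLatin? m n R) (rowsOK? m (rowAt R) ×-dec all? (λ j → columnOK? (col j) m)) reduced⇒ reduced⇐ ⟩
    𝟙 (rowsOK? m (rowAt R) ×-dec all? (λ j → columnOK? (col j) m))
      ≡⟨ 𝟙-× (rowsOK? m (rowAt R)) (all? (λ j → columnOK? (col j) m)) ⟩
    ok * 𝟙 (all? (λ j → columnOK? (col j) m))
      ≡⟨ cong (ok *_) (trans (𝟙-∀ (λ j → columnOK? (col j) m)) (∏-cong (allFin n) λ j _ → sym (∑-weight (col j) m))) ⟩
    ok * ∏ (allFin n) (λ j → ∑ (A m) (weight (col j) m))
      ≡⟨ cong (ok *_) (∏-∑ n (A m) λ j → weight (col j) m) ⟩
    ok * ∑ (vecs n (A m)) (λ a → ∏ (allFin n) λ j → weight (col j) m (lookup a j))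
      ≡⟨ *-∑ ok (vecs n (A m)) _ ⟩
    ∑ (vecs n (A m)) (λ a → ok * ∏ (allFin n) λ j → weight (col j) m (lookup a j))
      ≡⟨ ∑-cong (vecs n (A m)) (λ a _ → expand a) ⟩
    ∑ (vecs n (A m)) (λ a → ∏ (allFin n) (λ j → tupleSign m (lookup a j)) * 𝟙 (admissible? m (rowAt R) a)) ∎
    where
    open ≡-Reasoning
    col = column (rowAt R)
    ok = 𝟙 (rowsOK? m (rowAt R))
    expand : ∀ a → ok * ∏ (allFin n) (λ j → weight (col j) m (lookup a j)) ≡
      ∏ (allFin n) (λ j → tupleSign m (lookup a j)) * 𝟙 (admissible? m (rowAt R) a)
    expand a = begin
      ok * ∏ (allFin n) (λ j → weight (col j) m (lookup a j))
        ≡⟨ cong (ok *_) (trans (∏-cong (allFin n) λ j _ → weight-respects (col j) m (lookup a j))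
             (trans (∏-* (allFin n) (λ j → tupleSign m (lookup a j)) _) (cong (S *_) (sym (𝟙-∀ resp?))))) ⟩
      ok * (S * 𝟙 (all? resp?))
        ≡⟨ x∙yz≈y∙xz ok S (𝟙 (all? resp?)) ⟩
      S * (ok * 𝟙 (all? resp?))
        ≡⟨ cong (S *_) (sym (𝟙-× (rowsOK? m (rowAt R)) (all? resp?))) ⟩
      S * 𝟙 (admissible? m (rowAt R) a) ∎
      where
      S = ∏ (allFin n) (λ j → tupleSign m (lookup a j))
      resp? = λ j → respects? m (col j) (lookup a j)

-- Exchanging the sums puts the arrays innermost, where `∑-good` counts them for fixed `a` and `b`.
-- What is left depends on `a` and `b` only through their contents, except for `firstComponents?`.
+K : ∀ k n → let m = suc k in + K m n ≡ ∑ (vecs n (A m)) (λ a → ∑ (vecs n (A m)) λ b →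
  ∏ (allFin n) (λ j → tupleSign m (lookup a j)) *
  (𝟙 (firstComponents? m a b) * ∏ (map suc (positions k)) (rowFactor m a b)))
+K k n = begin
  + K m n
    ≡⟨ trans (cong +_ (length-filter (isReducedLatin? m n) (allRects m n))) (+# (isReducedLatin? m n) (allRects m n)) ⟩
  ∑ Rs (λ R → 𝟙 (isReducedLatin? m n R))
    ≡⟨ ∑-cong Rs (λ R _ → trans (𝟙-reduced R) (∑-cong As λ a a∈ →
         trans (cong (S a *_) (sym (∑-symbols R a (∈-vecs n a∈)))) (*-∑ (S a) As _))) ⟩
  ∑ Rs (λ R → ∑ As λ a → ∑ As λ b → S a * 𝟙 (good? m a b R))
    ≡⟨ trans (∑-swap Rs As _) (∑-cong As λ a _ → ∑-swap Rs As _) ⟩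
  ∑ As (λ a → ∑ As λ b → ∑ Rs λ R → S a * 𝟙 (good? m a b R))
    ≡⟨ ∑-cong As (λ a a∈ → ∑-cong As λ b b∈ → trans (sym (*-∑ (S a) Rs _))
         (cong (S a *_) (∑-good a b (∈-vecs n a∈) (∈-vecs n b∈) k ℕₚ.≤-refl))) ⟩
  ∑ As (λ a → ∑ As λ b → S a * (𝟙 (firstComponents? m a b) * ∏ (map suc (positions k)) (rowFactor m a b))) ∎
  where
  open ≡-Reasoning
  m = suc k
  Rs = allRects m n
  As = vecs n (A m)
  S : Vec (List ℕ) n → ℤ
  S a = ∏ (allFin n) (λ j → tupleSign m (lookup a j))

length-allFin : ∀ n → length (allFin n) ≡ n
length-allFin n = length-tabulate id

-- Sequences of tuples with a given content

unique-A : ∀ m → Unique (A m)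
unique-A m = #⇒unique (A m) λ α∈ → once⇒# _≟L_ {A m} (once-A m (A-tuple m α∈))
  where
  #⇒unique : ∀ xs → (∀ {x} → x ∈ xs → # (_≟L x) xs ≡ 1) → Unique xs
  #⇒unique [] h = []
  #⇒unique (x ∷ xs) h = x∉ ∷ #⇒unique xs λ {y} y∈ →
    trans (cong (ℕ._+ # (_≟L y) xs) (sym (bit-no (x ≟L y) (All.lookup x∉ y∈)))) (h (there y∈))
    where
    #xs≡0 : # (_≟L x) xs ≡ 0
    #xs≡0 = ℕₚ.suc-injective (trans (cong (ℕ._+ # (_≟L x) xs) (sym (bit-yes (x ≟L x) refl))) (h (here refl)))
    absent : ∀ ys {y} → # (_≟L x) ys ≡ 0 → y ∈ ys → x ≢ y
    absent (y ∷ ys) c (here refl) e = case trans (sym (cong (ℕ._+ # (_≟L x) ys) (bit-yes (y ≟L x) (sym e)))) c of λ ()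
    absent (y ∷ ys) c (there z∈) = absent ys (ℕₚ.m+n≡0⇒n≡0 (bit (y ≟L x)) c) z∈
    x∉ : All (x ≢_) xs
    x∉ = All.tabulate (absent xs #xs≡0)

once-comps : ∀ k t {u} → length u ≡ k → sumL u ≡ t → Once _≟L_ (comps k t) u
once-comps zero .0 {[]} refl refl F = trans (ℤₚ.+-identityʳ _) (ℤₚ.*-identityˡ (F []))
once-comps (suc k) .(x ℕ.+ sumL u) {x ∷ u} l refl = once-concatMap ℕ._≟_ _≟L_ _≟L_ _∷_ ∷-injective
  (λ y → comps k (x ℕ.+ sumL u ∸ y)) {upTo (suc (x ℕ.+ sumL u))} {x} {u} (once-upTo (s≤s (ℕₚ.m≤m+n x (sumL u))))
  (once-comps k (x ℕ.+ sumL u ∸ x) (ℕₚ.suc-injective l) (sym (ℕₚ.m+n∸m≡n x (sumL u))))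

comps⁻ : ∀ k t {u} → u ∈ comps k t → length u ≡ k × sumL u ≡ t
comps⁻ zero zero (here refl) = refl , refl
comps⁻ (suc k) t u∈ with x , x∈ , p ← ∈-concatMap (upTo (suc t)) u∈ with w , w∈ , refl ← ∈-map⁻ (x ∷_) p
  with l , s ← comps⁻ k (t ∸ x) w∈ =
  cong suc l , trans (cong (x ℕ.+_) s) (ℕₚ.m+[n∸m]≡n (ℕₚ.≤-pred (∈-upTo⁻ x∈)))

+sumL : ∀ {X : Set} (h : X → ℕ) xs → + sumL (map h xs) ≡ ∑ xs (λ x → + h x)
+sumL h [] = refl
+sumL h (x ∷ xs) = cong (_+_ (+ h x)) (+sumL h xs)

+prodL : ∀ {X : Set} (h : X → ℕ) xs → + prodL (map h xs) ≡ ∏ xs (λ x → + h x)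
+prodL h [] = refl
+prodL h (x ∷ xs) = trans (ℤₚ.pos-* (h x) _) (cong (+ h x *_) (+prodL h xs))

content-sum : ∀ m {n} (a : Vec (List ℕ) n) → (∀ j → lookup a j ∈ A m) → sumL (content m a) ≡ n
content-sum m {n} a a∈ = ℤₚ.+-injective (begin
  + sumL (content m a)
    ≡⟨ trans (+sumL (λ α → # (λ j → lookup a j ≟L α) (allFin n)) (A m))
         (∑-cong (A m) λ α _ → +# (λ j → lookup a j ≟L α) (allFin n)) ⟩
  ∑ (A m) (λ α → ∑ (allFin n) λ j → 𝟙 (lookup a j ≟L α))
    ≡⟨ ∑-swap (A m) (allFin n) _ ⟩
  ∑ (allFin n) (λ j → ∑ (A m) λ α → 𝟙 (lookup a j ≟L α))
    ≡⟨ ∑-cong (allFin n) (λ j _ → trans (∑-cong (A m) λ α _ →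
         trans (𝟙-⇔ (lookup a j ≟L α) (α ≟L lookup a j) sym sym) (sym (ℤₚ.*-identityʳ _)))
         (once-A m (A-tuple m (a∈ j)) λ _ → 1ℤ)) ⟩
  ∑ (allFin n) (λ _ → 1ℤ)
    ≡⟨ +# (λ _ → yes tt) (allFin n) ⟨
  + # (λ _ → yes tt) (allFin n)
    ≡⟨ cong +_ (trans (#-trivial (allFin n)) (length-allFin _)) ⟩
  + n ∎)
  where open ≡-Reasoning

#-toList : ∀ {X : Set} {P : X → Set} (P? : ∀ x → Dec (P x)) {n} (v : Vec X n) →
  # (λ j → P? (lookup v j)) (allFin n) ≡ # P? (Vec.toList v)
#-toList P? [] = refl
#-toList P? {suc n} (x ∷ v) = trans (#-allFin-suc n λ j → P? (lookup (x ∷ v) j)) (cong (bit (P? x) ℕ.+_) (#-toList P? v))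

repeated : ∀ {X : Set} → List X → List ℕ → List X
repeated [] _ = []
repeated (x ∷ xs) [] = []
repeated (x ∷ xs) (k ∷ ks) = replicate k x ++ repeated xs ks

#-++ : ∀ {X : Set} {P : X → Set} (P? : ∀ x → Dec (P x)) xs {ys} → # P? (xs ++ ys) ≡ # P? xs ℕ.+ # P? ys
#-++ P? [] = refl
#-++ P? (x ∷ xs) = trans (cong (bit (P? x) ℕ.+_) (#-++ P? xs)) (sym (ℕₚ.+-assoc (bit (P? x)) _ _))

repeated-⊆ : ∀ {X : Set} (xs : List X) ks {y} → y ∈ repeated xs ks → y ∈ xs
repeated-⊆ (x ∷ xs) (k ∷ ks) y∈ with ∈-++⁻ (replicate k x) y∈
... | inj₁ p = here (constant k p)
  where
  constant : ∀ k {y} → y ∈ replicate k x → y ≡ x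
  constant (suc k) (here refl) = refl
  constant (suc k) (there y∈) = constant k y∈
... | inj₂ p = there (repeated-⊆ xs ks p)

#-replicate-yes : ∀ k {α β} → α ≡ β → # (_≟L β) (replicate k α) ≡ k
#-replicate-yes zero e = refl
#-replicate-yes (suc k) {α} {β} e = cong₂ ℕ._+_ (bit-yes (α ≟L β) e) (#-replicate-yes k e)

#-replicate-no : ∀ k {α β} → α ≢ β → # (_≟L β) (replicate k α) ≡ 0
#-replicate-no zero e = refl
#-replicate-no (suc k) {α} {β} e = cong₂ ℕ._+_ (bit-no (α ≟L β) e) (#-replicate-no k e)

length-repeated : ∀ {X : Set} (xs : List X) ks → length ks ≡ length xs → length (repeated xs ks) ≡ sumL ks
length-repeated [] [] e = refl
length-repeated (x ∷ xs) (k ∷ ks) e = trans (length-++ (replicate k x))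
  (cong₂ ℕ._+_ (length-replicate k) (length-repeated xs ks (ℕₚ.suc-injective e)))

content-repeated : ∀ xs ks → Unique xs → length ks ≡ length xs → map (λ α → # (_≟L α) (repeated xs ks)) xs ≡ ks
content-repeated [] [] u e = refl
content-repeated (x ∷ xs) (k ∷ ks) (x∉ ∷ u) e = cong₂ _∷_
  (trans (#-++ (_≟L x) (replicate k x)) (trans (cong₂ ℕ._+_ (#-replicate-yes k refl)
    (#-none (_≟L x) (repeated xs ks) λ y y∈ y≡x → All.lookup x∉ (repeated-⊆ xs ks y∈) (sym y≡x))) (ℕₚ.+-identityʳ k)))
  (trans (map-cong-local (All.tabulate λ {y} y∈ → trans (#-++ (_≟L y) (replicate k x))
      (cong (ℕ._+ # (_≟L y) (repeated xs ks)) (#-replicate-no k (All.lookup x∉ y∈)))))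
    (content-repeated xs ks u (ℕₚ.suc-injective e)))

content-surjective : ∀ m n r → r ∈ comps (length (A m)) n →
  ∃[ a ] (∀ j → lookup a j ∈ A m) × content m {n} a ≡ r
content-surjective m n r r∈ with l , s ← comps⁻ (length (A m)) n r∈ =
  subst (λ k → Σ (Vec (List ℕ) k) λ a → (∀ j → lookup a j ∈ A m) × content m a ≡ r)
    (trans (length-repeated (A m) r l) s)
    (Vec.fromList L , (λ j → repeated-⊆ (A m) r (∈-lookup L j)) , trans
      (map-cong (λ α → trans (#-toList (_≟L α) (Vec.fromList L)) (cong (# (_≟L α)) (Vecₚ.toList∘fromList L))) (A m))
      (content-repeated (A m) r (unique-A m) l))
  where
  L = repeated (A m) r
  ∈-lookup : ∀ {X : Set} (xs : List X) j → lookup (Vec.fromList xs) j ∈ xs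
  ∈-lookup (x ∷ xs) zero = here refl
  ∈-lookup (x ∷ xs) (suc j) = there (∈-lookup xs j)

module Exchange {n} m (std : Vec (List ℕ) n) (std∈ : ∀ j → lookup std j ∈ A m) where

  open Matchings {List ℕ} {Fin n} _≟L_ Fin._≟_

  permuted : Vec (Fin n) n → Vec (List ℕ) n
  permuted σ = Vec.tabulate λ j → lookup std (lookup σ j)

  content! : List ℕ → ℤ
  content! r = + prodL (map _! r)

  count : Vec (List ℕ) n → List ℕ → ℕ
  count b α = # (λ j → lookup b j ≟L α) (allFin n)

  Φ-content : ∀ (b : Vec (List ℕ) n) → (∀ j → lookup b j ∈ A m) → Φ _≟L_ (lookup b) ≡ prodL (map _! (content m b))
  Φ-content b b∈ = trans
    (Φ-classes _≟L_ (λ u x → x ≟L u) (A m) (lookup b) λ j → inj₁ (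
      trans (#-cong _ _ (A m) λ u _ → sym , sym) (once⇒# _≟L_ {A m} (once-A m (A-tuple m (b∈ j)))) ,
      λ u _ e j′ → (λ e′ → trans e′ (sym e)) , λ e′ → trans e′ e))
    (cong prodL (map-∘ (A m)))

  -- A matching of `b` with `std` is a permutation that rearranges `std` into `b`. It exists only
  -- for equal contents and may permute equal tuples freely, which gives the factorials.
  ∑-matching-content : ∀ (b : Vec (List ℕ) n) → (∀ j → lookup b j ∈ A m) →
    𝟙 (content m std ≟L content m b) * content! (content m std) ≡ ∑ (rows n) (λ σ → 𝟙 (matching? (lookup b) (lookup std) σ))
  ∑-matching-content b b∈ = aux (All.all? (λ α → count b α ℕ.≟ count std α) (A m))
    where
    r = content m std
    aux : Dec (All (λ α → count b α ≡ count std α) (A m)) →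
      𝟙 (r ≟L content m b) * content! r ≡ ∑ (rows n) (λ σ → 𝟙 (matching? (lookup b) (lookup std) σ))
    aux (yes h) = begin
      𝟙 (r ≟L content m b) * content! r ≡⟨ cong (_* content! r) (𝟙-yes (r ≟L content m b) (sym e)) ⟩
      1ℤ * content! r ≡⟨ ℤₚ.*-identityˡ _ ⟩
      content! r ≡⟨ cong content! e ⟨
      content! (content m b) ≡⟨ cong +_ (Φ-content b b∈) ⟨
      + Φ _≟L_ (lookup b) ≡⟨ ∑-matching (lookup b) (lookup std) (allFin n) (Uniqueₚ.allFin⁺ n) counts ⟨
      ∑ (rows n) (λ σ → 𝟙 (matching? (lookup b) (lookup std) σ)) ∎
      where
      open ≡-Reasoning
      e : content m b ≡ r
      e = map-cong-local h
      counts : ∀ z → count b z ≡ count std z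
      counts z with count b z ℕ.≟ 0 | count std z ℕ.≟ 0
      ... | yes p | yes q = trans p (sym q)
      ... | no p | _ with j , _ , refl ← #-pos (λ j → lookup b j ≟L z) (allFin n) p = All.lookup h (b∈ j)
      ... | yes _ | no q with j , _ , refl ← #-pos (λ j → lookup std j ≟L z) (allFin n) q = All.lookup h (std∈ j)
    aux (no ¬h) with α , α∈ , ne ← find (¬All⇒Any¬ (λ α → count b α ℕ.≟ count std α) (A m) ¬h) = trans
      (cong (_* content! r) (𝟙-no (r ≟L content m b) λ e → ne (map-≡⁻ (A m) (sym e) α∈)))
      (sym (∑-mismatch (lookup b) (lookup std) (allFin n) (Uniqueₚ.allFin⁺ n) (sym (length-allFin _)) α ne))

  𝟙-matching-permuted : ∀ b σ → 𝟙 (matching? (lookup b) (lookup std) σ) ≡ 𝟙 (distinctRow? σ) * 𝟙 (b ≟V permuted σ)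
  𝟙-matching-permuted b σ = trans
    (𝟙-⇔ (matching? (lookup b) (lookup std) σ) (distinctRow? σ ×-dec (b ≟V permuted σ))
      (λ (d , h) → d , trans (sym (Vecₚ.tabulate∘lookup b)) (Vecₚ.tabulate-cong h))
      (λ { (d , refl) → d , Vecₚ.lookup∘tabulate _ }))
    (𝟙-× (distinctRow? σ) (b ≟V permuted σ))

  -- Replaces a sum over the sequences of a given content by a sum over permutations, which hits
  -- each sequence as often as the product of factorials says; multiplying by that number keeps the
  -- identity within the integers.
  ∑-content : ∀ H → ∑ (vecs n (A m)) (λ b → 𝟙 (content m std ≟L content m b) * H b) * content! (content m std) ≡
    ∑ (rows n) (λ σ → 𝟙 (distinctRow? σ) * H (permuted σ))
  ∑-content H = begin
    ∑ Bs (λ b → 𝟙 (r ≟L content m b) * H b) * content! r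
      ≡⟨ ∑-*ʳ Bs _ _ ⟩
    ∑ Bs (λ b → 𝟙 (r ≟L content m b) * H b * content! r)
      ≡⟨ ∑-cong Bs (λ b b∈ → trans (xy∙z≈xz∙y (𝟙 (r ≟L content m b)) (H b) (content! r))
           (trans (cong (_* H b) (∑-matching-content b (∈-vecs n b∈))) (∑-*ʳ (rows n) _ (H b)))) ⟩
    ∑ Bs (λ b → ∑ (rows n) λ σ → 𝟙 (matching? (lookup b) (lookup std) σ) * H b)
      ≡⟨ ∑-swap Bs (rows n) _ ⟩
    ∑ (rows n) (λ σ → ∑ Bs λ b → 𝟙 (matching? (lookup b) (lookup std) σ) * H b)
      ≡⟨ ∑-cong (rows n) (λ σ _ → trans (∑-cong Bs λ b _ → trans (cong (_* H b) (𝟙-matching-permuted b σ))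
           (ℤₚ.*-assoc (𝟙 (distinctRow? σ)) (𝟙 (b ≟V permuted σ)) (H b)))
         (sym (*-∑ (𝟙 (distinctRow? σ)) Bs _))) ⟩
    ∑ (rows n) (λ σ → 𝟙 (distinctRow? σ) * ∑ Bs λ b → 𝟙 (b ≟V permuted σ) * H b)
      ≡⟨ ∑-cong (rows n) (λ σ _ → cong (𝟙 (distinctRow? σ) *_) (once-vecs _≟L_ (permuted σ) (λ j →
           subst (Once _≟L_ (A m)) (sym (Vecₚ.lookup∘tabulate _ j)) (once-A m (A-tuple m (std∈ _)))) H)) ⟩
    ∑ (rows n) (λ σ → 𝟙 (distinctRow? σ) * H (permuted σ)) ∎
    where
    open ≡-Reasoning
    Bs = vecs n (A m)
    r = content m std

-- Permutations are the matchings in the case where all columns and symbols share one colour.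
∑-distinct : ∀ n → ∑ (rows n) (λ σ → 𝟙 (distinctRow? σ)) ≡ + (n !)
∑-distinct n = begin
  ∑ (rows n) (λ σ → 𝟙 (distinctRow? σ))
    ≡⟨ ∑-cong (rows n) (λ σ _ → 𝟙-⇔ (distinctRow? σ) (matching? {n} white white σ) (λ d → d , λ _ → refl) proj₁) ⟩
  ∑ (rows n) (λ σ → 𝟙 (matching? {n} white white σ))
    ≡⟨ ∑-matching {n} white white (allFin n) (Uniqueₚ.allFin⁺ n) (λ z → refl) ⟩
  + Φ ℕ._≟_ {n} white
    ≡⟨ cong +_ (Φ-constant n) ⟩
  + (n !) ∎
  where
  open ≡-Reasoning
  open Matchings {ℕ} {Fin n} ℕ._≟_ Fin._≟_
  white : ∀ {k} → Fin k → ℕ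
  white _ = 0
  Φ-constant : ∀ k → Φ ℕ._≟_ {k} white ≡ k !
  Φ-constant zero = refl
  Φ-constant (suc k) = cong₂ (λ c p → suc c ℕ.* p)
    (trans (#-cong (λ _ → 0 ℕ.≟ 0) (λ _ → yes tt) (allFin k) λ _ _ → (λ _ → tt) , λ _ → refl)
      (trans (#-trivial (allFin k)) (length-allFin k)))
    (Φ-constant k)

-- Recovers the factor of row 1. With the symbol tuples `std` held fixed, the permutation that
-- rearranges them obeys exactly the conditions on an unrestricted first row, so `∑-row` applies
-- with no rows above.
∑-firstComponents : ∀ {n m} → 0 < m → (a std : Vec (List ℕ) n) → (∀ j → lookup a j ∈ A m) → (∀ j → lookup std j ∈ A m) →
  ∑ (vecs n (A m)) (λ b → 𝟙 (content m std ≟L content m b) * 𝟙 (firstComponents? m a b)) * + prodL (map _! (content m std)) ≡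
  rowFactor m a std 1
∑-firstComponents {n} {m} 0<m a std a∈ std∈ = begin
  _ ≡⟨ ∑-content (λ b → 𝟙 (firstComponents? m a b)) ⟩
  ∑ (rows n) (λ σ → 𝟙 (distinctRow? σ) * 𝟙 (firstComponents? m a (permuted σ)))
    ≡⟨ ∑-cong (rows n) (λ σ _ → trans (sym (𝟙-× (distinctRow? σ) (firstComponents? m a (permuted σ))))
         (𝟙-⇔ (distinctRow? σ ×-dec firstComponents? m a (permuted σ)) (match? (columnColour m a rowAt₀ 1) (symbolColour m std 1) σ)
           (λ (d , h) → match-firstRow a std a∈ std∈ 0<m rowAt₀ σ d λ j → trans (h j) (cong (mask m 1) (Vecₚ.lookup∘tabulate _ j)))
           (λ p → proj₁ p , λ j → trans (firstRow-match a std a∈ std∈ 0<m rowAt₀ σ p j) (cong (mask m 1)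
             (sym (Vecₚ.lookup∘tabulate _ j)))))) ⟩
  ∑ (rows n) (λ σ → 𝟙 (match? (columnColour m a rowAt₀ 1) (symbolColour m std 1) σ))
    ≡⟨ Row.∑-row a std a∈ std∈ rowAt₀ 0 0<m (λ ()) ⟩
  rowFactor m a std 1 ∎
  where
  open ≡-Reasoning
  open Exchange m std std∈
  rowAt₀ : ℕ → Vec (Fin n) n
  rowAt₀ _ = Vec.allFin n

-- Signs

sgn-+ : ∀ i j → sgn (i ℕ.+ j) ≡ sgn i * sgn j
sgn-+ i j = ℤₚ.^-distribˡ-+-* (- 1ℤ) i j

sgn-square : ∀ i → sgn i * sgn i ≡ 1ℤ
sgn-square zero = refl
sgn-square (suc i) = begin
  - 1ℤ * sgn i * (- 1ℤ * sgn i) ≡⟨ interchange (- 1ℤ) (sgn i) (- 1ℤ) (sgn i) ⟩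
  1ℤ * (sgn i * sgn i) ≡⟨ ℤₚ.*-identityˡ _ ⟩
  sgn i * sgn i ≡⟨ sgn-square i ⟩
  1ℤ ∎
  where open ≡-Reasoning

sgn-# : ∀ {X : Set} {P : X → Set} (P? : ∀ x → Dec (P x)) xs → sgn (# P? xs) ≡ ∏ xs (λ x → sgn (bit (P? x)))
sgn-# P? [] = refl
sgn-# P? (x ∷ xs) = trans (sgn-+ (bit (P? x)) _) (cong (sgn (bit (P? x)) *_) (sgn-# P? xs))

sgn-parity : ∀ k → sgn (bit (T? (k ℕ.% 2 ≡ᵇ 1))) ≡ sgn k
sgn-parity zero = refl
sgn-parity (suc zero) = refl
sgn-parity (suc (suc k)) = trans (sgn-parity k) (sym (trans (sym (ℤₚ.*-assoc (- 1ℤ) (- 1ℤ) (sgn k))) (ℤₚ.*-identityˡ _)))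

∏-swap : ∀ {X Y : Set} xs ys (f : X → Y → ℤ) → ∏ xs (λ x → ∏ ys (f x)) ≡ ∏ ys (λ y → ∏ xs λ x → f x y)
∏-swap [] ys f = sym (∏-1 ys λ _ _ → refl)
∏-swap (x ∷ xs) ys f = trans (cong (∏ ys (f x) *_) (∏-swap xs ys f)) (sym (∏-* ys (f x) _))

∏-sgn-const : ∀ {X : Set} (xs : List X) k → ∏ xs (λ _ → sgn k) ≡ sgn (length xs ℕ.* k)
∏-sgn-const [] k = refl
∏-sgn-const (x ∷ xs) k = trans (cong (sgn k *_) (∏-sgn-const xs k)) (sym (sgn-+ k _))

∏-at : ∀ {m α} → IsTuple m α → (F : ℕ → ℤ) → ∏ (positions m) (λ l → F (at α l)) ≡ ∏ α F
∏-at {α = α} record { len = refl } F = trans (sym (∏-map (at α) (positions (length α)) {F})) (cong (λ l → ∏ l F) (at-positions α))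

∏-sgn-ζ : ∀ {m α} → IsTuple m α → ∏ (positions m) (λ l → sgn (bit (at α l ℕ.≟ 0))) ≡ sgn (ζ α)
∏-sgn-ζ {m} {α} t = trans (∏-at t λ v → sgn (bit (v ℕ.≟ 0)))
  (trans (sym (sgn-# (ℕ._≟ 0) α)) (cong sgn (sym (length-filter (ℕ._≟ 0) α))))

-- Each of the `m` positions contributes -1, and each zero entry corrects this by another -1.
tupleSign-ζ : ∀ {m α} → IsTuple m α → tupleSign m α ≡ sgn m * sgn (ζ α)
tupleSign-ζ {m} {α} t = begin
  tupleSign m α
    ≡⟨ ∏-cong (positions m) (λ l _ → signOf-bit (at α l)) ⟩
  ∏ (positions m) (λ l → sgn 1 * sgn (bit (at α l ℕ.≟ 0)))
    ≡⟨ ∏-* (positions m) (λ _ → sgn 1) _ ⟩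
  ∏ (positions m) (λ _ → sgn 1) * ∏ (positions m) (λ l → sgn (bit (at α l ℕ.≟ 0)))
    ≡⟨ cong₂ _*_ (trans (∏-sgn-const (positions m) 1) (cong sgn (trans (ℕₚ.*-identityʳ _) (length-positions m)))) (∏-sgn-ζ t) ⟩
  sgn m * sgn (ζ α) ∎
  where
  open ≡-Reasoning
  signOf-bit : ∀ v → signOf v ≡ sgn 1 * sgn (bit (v ℕ.≟ 0))
  signOf-bit zero = refl
  signOf-bit (suc v) = refl

∏-sgn-ΣW : ∀ m {n} (a : Vec (List ℕ) n) → (∀ j → lookup a j ∈ A m) →
  ∏ (allFin n) (λ j → sgn (ζ (lookup a j))) ≡ sgn (ΣW m (content m a))
∏-sgn-ΣW m {n} a a∈ = sym (begin
  sgn (ΣW m (content m a))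
    ≡⟨ cong sgn (sumWhere-content (λ α → ζ α ℕ.% 2 ≡ᵇ 1) m a a∈) ⟩
  sgn (# (λ j → T? (ζ (lookup a j) ℕ.% 2 ≡ᵇ 1)) (allFin n))
    ≡⟨ sgn-# _ (allFin n) ⟩
  ∏ (allFin n) (λ j → sgn (bit (T? (ζ (lookup a j) ℕ.% 2 ≡ᵇ 1))))
    ≡⟨ ∏-cong (allFin n) (λ j _ → sgn-parity (ζ (lookup a j))) ⟩
  ∏ (allFin n) (λ j → sgn (ζ (lookup a j))) ∎)
  where open ≡-Reasoning

∏-tupleSign : ∀ m {n} (a : Vec (List ℕ) n) → (∀ j → lookup a j ∈ A m) →
  ∏ (allFin n) (λ j → tupleSign m (lookup a j)) ≡ sgn (n ℕ.* m ℕ.+ ΣW m (content m a))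
∏-tupleSign m {n} a a∈ = begin
  ∏ (allFin n) (λ j → tupleSign m (lookup a j))
    ≡⟨ ∏-cong (allFin n) (λ j _ → tupleSign-ζ (A-tuple m (a∈ j))) ⟩
  ∏ (allFin n) (λ j → sgn m * sgn (ζ (lookup a j)))
    ≡⟨ ∏-* (allFin n) (λ _ → sgn m) _ ⟩
  ∏ (allFin n) (λ _ → sgn m) * ∏ (allFin n) (λ j → sgn (ζ (lookup a j)))
    ≡⟨ cong₂ _*_ (trans (∏-sgn-const (allFin n) m) (cong (λ k → sgn (k ℕ.* m)) (length-allFin n))) (∏-sgn-ΣW m a a∈) ⟩
  sgn (n ℕ.* m) * sgn (ΣW m (content m a))
    ≡⟨ sgn-+ (n ℕ.* m) _ ⟨
  sgn (n ℕ.* m ℕ.+ ΣW m (content m a)) ∎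
  where open ≡-Reasoning

-- Every column lies in ζ(a_j) components, so ∑ q(Z) and ΣW have the same parity.
∏-sgn-qsum : ∀ m {n} (a : Vec (List ℕ) n) → (∀ j → lookup a j ∈ A m) →
  ∏ (positions m) (λ l → ∏ (comps-l m l) λ z → sgn (qsum m l (content m a) z)) ≡ sgn (ΣW m (content m a))
∏-sgn-qsum m {n} a a∈ = begin
  ∏ (positions m) (λ l → ∏ (comps-l m l) λ z → sgn (qsum m l (content m a) z))
    ≡⟨ ∏-cong (positions m) (λ l _ → trans
         (∏-cong (comps-l m l) λ z _ → trans (cong sgn (sumWhere-content (λ β → sameComp m l β z) m a a∈)) (sgn-# _ (allFin n)))
         (∏-swap (comps-l m l) (allFin n) _)) ⟩
  ∏ (positions m) (λ l → ∏ (allFin n) λ j → ∏ (comps-l m l) λ z → sgn (bit (same? m l (lookup a j) z)))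
    ≡⟨ ∏-cong (positions m) (λ l _ → ∏-cong (allFin n) λ j _ →
         trans (sym (sgn-# (same? m l (lookup a j)) (comps-l m l))) (cong sgn (component-count l j))) ⟩
  ∏ (positions m) (λ l → ∏ (allFin n) λ j → sgn (bit (at (lookup a j) l ℕ.≟ 0)))
    ≡⟨ ∏-swap (positions m) (allFin n) _ ⟩
  ∏ (allFin n) (λ j → ∏ (positions m) λ l → sgn (bit (at (lookup a j) l ℕ.≟ 0)))
    ≡⟨ ∏-cong (allFin n) (λ j _ → ∏-sgn-ζ (A-tuple m (a∈ j))) ⟩
  ∏ (allFin n) (λ j → sgn (ζ (lookup a j)))
    ≡⟨ ∏-sgn-ΣW m a a∈ ⟩
  sgn (ΣW m (content m a)) ∎
  where
  open ≡-Reasoning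
  component-count : ∀ l j → # (same? m l (lookup a j)) (comps-l m l) ≡ bit (at (lookup a j) l ℕ.≟ 0)
  component-count l j with at (lookup a j) l ℕ.≟ 0
  ... | yes e = trans (#-cong _ _ (comps-l m l) λ z _ → same-sym m l (lookup a j) z , same-sym m l z (lookup a j))
    (trans (comps-l-one m l (a∈ j) e) (sym (bit-yes (at (lookup a j) l ℕ.≟ 0) e)))
  ... | no ne = trans (#-none _ (comps-l m l) λ z _ s → ne (proj₁ (sameComp⁻ m l (lookup a j) z s)))
    (sym (bit-no (at (lookup a j) l ℕ.≟ 0) ne))

rising-neg : ∀ q → rising (- (+ q)) q ≡ sgn q * + (q !)
rising-neg zero = refl
rising-neg (suc q) = begin
  - (+ suc q) * rising (- (+ suc q) + 1ℤ) q
    ≡⟨ cong (λ x → - (+ suc q) * rising x q) (next q) ⟩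
  - (+ suc q) * rising (- (+ q)) q
    ≡⟨ cong₂ _*_ (sym (ℤₚ.-1*i≡-i (+ suc q))) (rising-neg q) ⟩
  - 1ℤ * + suc q * (sgn q * + (q !))
    ≡⟨ interchange (- 1ℤ) (+ suc q) (sgn q) (+ (q !)) ⟩
  - 1ℤ * sgn q * (+ suc q * + (q !))
    ≡⟨ cong (sgn (suc q) *_) (sym (ℤₚ.pos-* (suc q) (q !))) ⟩
  sgn (suc q) * + (suc q !) ∎
  where
  open ≡-Reasoning
  next : ∀ q → - (+ suc q) + 1ℤ ≡ - (+ q)
  next zero = refl
  next (suc q) = refl

-- The contribution of one pair of contents

families : ℕ → ℕ → List (List ℕ)
families m n = comps (length (A m)) n

module _ (k n : ℕ) where

  private
    m = suc k
    As = vecs n (A m)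
    Fs = families m n

  summand : Vec (List ℕ) n → Vec (List ℕ) n → ℤ
  summand a b = ∏ (allFin n) (λ j → tupleSign m (lookup a j)) *
    (𝟙 (firstComponents? m a b) * ∏ (map suc (positions k)) (rowFactor m a b))

  -- The part of the double sum over `a` and `b` in which their contents are `r` and `c`; it is the
  -- integer value of the corresponding quotient in the formula.
  contribution : List ℕ → List ℕ → ℤ
  contribution r c = ∑ As λ a → 𝟙 (r ≟L content m a) * ∑ As λ b → 𝟙 (c ≟L content m b) * summand a b

  once-content : ∀ {a : Vec (List ℕ) n} → a ∈ As → Once _≟L_ Fs (content m a)
  once-content {a} a∈ = once-comps (length (A m)) n (length-map _ (A m)) (content-sum m a (∈-vecs n a∈))

  ∑-contribution : + K m n ≡ ∑ Fs (λ r → ∑ Fs (contribution r))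
  ∑-contribution = sym (begin
    ∑ Fs (λ r → ∑ Fs λ c → ∑ As λ a → 𝟙 (r ≟L content m a) * inner a c)
      ≡⟨ ∑-cong Fs (λ r _ → ∑-swap Fs As _) ⟩
    ∑ Fs (λ r → ∑ As λ a → ∑ Fs λ c → 𝟙 (r ≟L content m a) * inner a c)
      ≡⟨ ∑-swap Fs As _ ⟩
    ∑ As (λ a → ∑ Fs λ r → ∑ Fs λ c → 𝟙 (r ≟L content m a) * inner a c)
      ≡⟨ ∑-cong As (λ a a∈ → trans (∑-cong Fs λ r _ → sym (*-∑ (𝟙 (r ≟L content m a)) Fs _))
           (once-content a∈ λ _ → ∑ Fs (inner a))) ⟩
    ∑ As (λ a → ∑ Fs λ c → ∑ As λ b → 𝟙 (c ≟L content m b) * summand a b)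
      ≡⟨ ∑-cong As (λ a _ → trans (∑-swap Fs As _) (∑-cong As λ b b∈ → once-content b∈ λ _ → summand a b)) ⟩
    ∑ As (λ a → ∑ As (summand a))
      ≡⟨ +K k n ⟨
    + K m n ∎)
    where
    open ≡-Reasoning
    inner : Vec (List ℕ) n → List ℕ → ℤ
    inner a c = ∑ As λ b → 𝟙 (c ≟L content m b) * summand a b

  numerator : List ℕ → ℤ
  numerator r = sgn (n ℕ.* m ℕ.+ ΣW m r) * + prodComp ℕ._*_ 1 _! m n r

  rowFactor′ : List ℕ → List ℕ → ℕ → ℤ
  rowFactor′ r c l = 𝟙 (T? (countsAgree m l r c)) * + ∏q! m l r

  𝟙-allB : ∀ {X : Set} (p : X → Bool) xs → 𝟙 (T? (allB p xs)) ≡ ∏ xs (λ x → 𝟙 (T? (p x)))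
  𝟙-allB p [] = refl
  𝟙-allB p (x ∷ xs) with p x
  ... | true = trans (𝟙-allB p xs) (sym (ℤₚ.*-identityˡ _))
  ... | false = refl

  ∏-rowFactor : ∀ r c → ∏ (positions m) (rowFactor′ r c) ≡
    𝟙 (T? (validC m r c)) * + prodL (map (λ l → ∏q! m l r) (positions m))
  ∏-rowFactor r c = trans (∏-* (positions m) (λ l → 𝟙 (T? (countsAgree m l r c))) _)
    (cong₂ _*_ (sym (𝟙-allB (λ l → countsAgree m l r c) (positions m))) (sym (+prodL (λ l → ∏q! m l r) (positions m))))

  sgnᵣ : List ℕ → ℤ
  sgnᵣ r = sgn (n ℕ.* m ℕ.+ ΣW m r)

  module _ {r c} (r∈ : r ∈ Fs) (c∈ : c ∈ Fs) where

    private
      later = ∏ (map suc (positions k)) (rowFactor′ r c)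

    summand-content : ∀ {a b} → a ∈ As → r ≡ content m a → c ≡ content m b →
      summand a b ≡ sgnᵣ r * later * 𝟙 (firstComponents? m a b)
    summand-content {a} {b} a∈ refl refl = trans (cong (_* (𝟙 (firstComponents? m a b) * later)) (∏-tupleSign m a (∈-vecs n a∈)))
      (x∙yz≈xz∙y (sgnᵣ r) (𝟙 (firstComponents? m a b)) later)

    ∏-later : ∏ (positions m) (rowFactor′ r c) ≡ rowFactor′ r c 1 * later
    ∏-later = cong (λ ls → ∏ ls (rowFactor′ r c)) (positions-cons k)

    -- The sum over `b` supplies the factor of row 1 and `summand` those of the later rows, which
    -- completes the product over all positions.
    inner-sum : ∀ {a} → a ∈ As → r ≡ content m a →
      ∑ As (λ b → 𝟙 (c ≟L content m b) * summand a b) * + prodL (map _! c) ≡ sgnᵣ r * ∏ (positions m) (rowFactor′ r c)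
    inner-sum {a} a∈ e with std , std∈ , refl ← content-surjective m n c c∈ = begin
      ∑ As (λ b → 𝟙 (content m std ≟L content m b) * summand a b) * c!
        ≡⟨ cong (_* c!) (trans
             (∑-cong As λ b _ → trans (𝟙-guard (content m std ≟L content m b) λ e′ → summand-content {a} {b} a∈ e e′)
               (x∙yz≈y∙xz (𝟙 (content m std ≟L content m b)) (sgnᵣ r * later) (𝟙 (firstComponents? m a b))))
             (sym (*-∑ (sgnᵣ r * later) As _))) ⟩
      sgnᵣ r * later * ∑ As (λ b → 𝟙 (content m std ≟L content m b) * 𝟙 (firstComponents? m a b)) * c!
        ≡⟨ ℤₚ.*-assoc (sgnᵣ r * later) (∑ As (λ b → 𝟙 (content m std ≟L content m b) * 𝟙 (firstComponents? m a b))) c! ⟩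
      sgnᵣ r * later * (∑ As (λ b → 𝟙 (content m std ≟L content m b) * 𝟙 (firstComponents? m a b)) * c!)
        ≡⟨ cong (sgnᵣ r * later *_) (∑-firstComponents {n} {m} (s≤s z≤n) a std (∈-vecs n a∈) std∈) ⟩
      sgnᵣ r * later * rowFactor m a std 1
        ≡⟨ cong (λ r′ → sgnᵣ r * later * rowFactor′ r′ (content m std) 1) (sym e) ⟩
      sgnᵣ r * later * rowFactor′ r (content m std) 1
        ≡⟨ xy∙z≈x∙zy (sgnᵣ r) later (rowFactor′ r (content m std) 1) ⟩
      sgnᵣ r * (rowFactor′ r (content m std) 1 * later)
        ≡⟨ cong (sgnᵣ r *_) (sym ∏-later) ⟩
      sgnᵣ r * ∏ (positions m) (rowFactor′ r (content m std)) ∎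
      where
      open ≡-Reasoning
      c! = + prodL (map _! (content m std))

    ∑-content-r : ∑ As (λ a → 𝟙 (r ≟L content m a)) * + prodL (map _! r) ≡ + (n !)
    ∑-content-r with std , std∈ , refl ← content-surjective m n r r∈ = begin
      ∑ As (λ a → 𝟙 (content m std ≟L content m a)) * + prodL (map _! (content m std))
        ≡⟨ cong (_* + prodL (map _! (content m std))) (∑-cong As λ a _ → sym (ℤₚ.*-identityʳ _)) ⟩
      ∑ As (λ a → 𝟙 (content m std ≟L content m a) * 1ℤ) * + prodL (map _! (content m std))
        ≡⟨ Exchange.∑-content m std std∈ (λ _ → 1ℤ) ⟩
      ∑ (rows n) (λ σ → 𝟙 (distinctRow? σ) * 1ℤ)
        ≡⟨ ∑-cong (rows n) (λ σ _ → ℤₚ.*-identityʳ _) ⟩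
      ∑ (rows n) (λ σ → 𝟙 (distinctRow? σ))
        ≡⟨ ∑-distinct n ⟩
      + (n !) ∎
      where open ≡-Reasoning

    -- The first formula term by term, cross-multiplied. It shows that each quotient summed there is
    -- an integer and that pairs violating the constraint contribute nothing.
    contribution-denom : contribution r c * + denom r c ≡ 𝟙 (T? (validC m r c)) * numerator r
    contribution-denom = begin
      contribution r c * + denom r c
        ≡⟨ cong (contribution r c *_) (ℤₚ.pos-* (prodL (map _! r)) (prodL (map _! c))) ⟩
      contribution r c * (r! * c!)
        ≡⟨ x∙yz≈xz∙y (contribution r c) r! c! ⟩
      contribution r c * c! * r!
        ≡⟨ cong (_* r!) (trans (∑-*ʳ As _ c!) (trans (∑-cong As λ a a∈ → trans
             (ℤₚ.*-assoc (𝟙 (r ≟L content m a)) (inner a) c!)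
             (𝟙-guard (r ≟L content m a) (inner-sum a∈))) (sym (∑-*ʳ As _ G)))) ⟩
      ∑ As (λ a → 𝟙 (r ≟L content m a)) * G * r!
        ≡⟨ xy∙z≈xz∙y (∑ As (λ a → 𝟙 (r ≟L content m a))) G r! ⟩
      ∑ As (λ a → 𝟙 (r ≟L content m a)) * r! * G
        ≡⟨ cong₂ (λ x y → x * (sgnᵣ r * y)) ∑-content-r (∏-rowFactor r c) ⟩
      + (n !) * (sgnᵣ r * (valid * ∏∏q!))
        ≡⟨ rearrange (+ (n !)) (sgnᵣ r) valid ∏∏q! ⟩
      valid * (sgnᵣ r * (+ (n !) * ∏∏q!))
        ≡⟨ cong (λ x → valid * (sgnᵣ r * x)) (sym (ℤₚ.pos-* (n !) (prodL (map (λ l → ∏q! m l r) (positions m))))) ⟩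
      valid * numerator r ∎
      where
      open ≡-Reasoning
      r! = + prodL (map _! r)
      c! = + prodL (map _! c)
      inner = λ a → ∑ As (λ b → 𝟙 (c ≟L content m b) * summand a b)
      G = sgnᵣ r * ∏ (positions m) (rowFactor′ r c)
      valid = 𝟙 (T? (validC m r c))
      ∏∏q! = + prodL (map (λ l → ∏q! m l r) (positions m))
      rearrange : ∀ f s v q → f * (s * (v * q)) ≡ v * (s * (f * q))
      rearrange f s v q = trans (cong (f *_) (x∙yz≈y∙xz s v q)) (trans (x∙yz≈y∙xz f v (s * q)) (cong (v *_) (x∙yz≈y∙xz f s q)))

  foldr-∏ : ∀ {X : Set} (f : X → ℤ) xs → Data.List.foldr _*_ 1ℤ (map f xs) ≡ ∏ xs f
  foldr-∏ f [] = refl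
  foldr-∏ f (x ∷ xs) = cong (f x *_) (foldr-∏ f xs)

  risingNumerator : List ℕ → ℤ
  risingNumerator r = prodComp _*_ (+ 1) (λ q → rising (- (+ q)) q) m n r

  -- The rising factorials give the sign (-1)^(n + Σ q(Z)), and Σ q(Z) over the components has the
  -- parity of `ΣW`. Against (-1)^(nm + ΣW) the difference is (-1)^(n(m - 1)), with `k` for m - 1.
  risingNumerator-sign : ∀ {r} → r ∈ Fs → risingNumerator r ≡ sgn (n ℕ.* k) * numerator r
  risingNumerator-sign {r} r∈ with a , a∈ , refl ← content-surjective m n r r∈ = begin
    risingNumerator r
      ≡⟨ cong₂ _*_ (rising-neg n) (begin
           Data.List.foldr _*_ 1ℤ (map risingRow (positions m))
             ≡⟨ foldr-∏ risingRow (positions m) ⟩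
           ∏ (positions m) risingRow
             ≡⟨ ∏-cong (positions m) (λ l _ → risingRow-sign l) ⟩
           ∏ (positions m) (λ l → signs l * + ∏q! m l r)
             ≡⟨ ∏-* (positions m) signs (λ l → + ∏q! m l r) ⟩
           ∏ (positions m) signs * ∏ (positions m) (λ l → + ∏q! m l r)
             ≡⟨ cong₂ _*_ (∏-sgn-qsum m a a∈) (sym (+prodL (λ l → ∏q! m l r) (positions m))) ⟩
           sgn (ΣW m r) * ∏∏q! ∎) ⟩
    sgn n * + (n !) * (sgn (ΣW m r) * ∏∏q!)
      ≡⟨ interchange (sgn n) (+ (n !)) (sgn (ΣW m r)) ∏∏q! ⟩
    sgn n * sgn (ΣW m r) * (+ (n !) * ∏∏q!)
      ≡⟨ cong₂ _*_ total-sign (sym (ℤₚ.pos-* (n !) (prodL (map (λ l → ∏q! m l r) (positions m))))) ⟩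
    sgn (n ℕ.* k) * sgnᵣ r * + prodComp ℕ._*_ 1 _! m n r
      ≡⟨ ℤₚ.*-assoc (sgn (n ℕ.* k)) (sgnᵣ r) _ ⟩
    sgn (n ℕ.* k) * numerator r ∎
    where
    open ≡-Reasoning
    ∏∏q! = + prodL (map (λ l → ∏q! m l r) (positions m))
    risingTerm : ℕ → List ℕ → ℤ
    risingTerm l z = rising (- (+ qsum m l r z)) (qsum m l r z)
    risingRow signs : ℕ → ℤ
    risingRow l = Data.List.foldr _*_ 1ℤ (map (risingTerm l) (comps-l m l))
    signs l = ∏ (comps-l m l) λ z → sgn (qsum m l r z)
    risingRow-sign : ∀ l → risingRow l ≡ signs l * + ∏q! m l r
    risingRow-sign l = begin
      risingRow l
        ≡⟨ foldr-∏ (risingTerm l) (comps-l m l) ⟩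
      ∏ (comps-l m l) (risingTerm l)
        ≡⟨ ∏-cong (comps-l m l) (λ z _ → rising-neg (qsum m l r z)) ⟩
      ∏ (comps-l m l) (λ z → sgn (qsum m l r z) * + (qsum m l r z !))
        ≡⟨ ∏-* (comps-l m l) (λ z → sgn (qsum m l r z)) (λ z → + (qsum m l r z !)) ⟩
      signs l * ∏ (comps-l m l) (λ z → + (qsum m l r z !))
        ≡⟨ cong (signs l *_) (sym (+prodL (λ z → qsum m l r z !) (comps-l m l))) ⟩
      signs l * + ∏q! m l r ∎
    total-sign : sgn n * sgn (ΣW m r) ≡ sgn (n ℕ.* k) * sgnᵣ r
    total-sign = sym (begin
      sgn (n ℕ.* k) * sgn (n ℕ.* m ℕ.+ ΣW m r)
        ≡⟨ cong (sgn (n ℕ.* k) *_) (trans (sgn-+ (n ℕ.* m) (ΣW m r)) (cong (_* sgn (ΣW m r))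
             (trans (cong sgn (trans (ℕₚ.*-suc n k) (ℕₚ.+-comm n (n ℕ.* k)))) (sgn-+ (n ℕ.* k) n)))) ⟩
      sgn (n ℕ.* k) * (sgn (n ℕ.* k) * sgn n * sgn (ΣW m r))
        ≡⟨ trans (cong (sgn (n ℕ.* k) *_) (ℤₚ.*-assoc (sgn (n ℕ.* k)) (sgn n) _)) (sym (ℤₚ.*-assoc (sgn (n ℕ.* k)) (sgn (n ℕ.* k)) _)) ⟩
      sgn (n ℕ.* k) * sgn (n ℕ.* k) * (sgn n * sgn (ΣW m r))
        ≡⟨ cong (_* (sgn n * sgn (ΣW m r))) (sgn-square (n ℕ.* k)) ⟩
      1ℤ * (sgn n * sgn (ΣW m r))
        ≡⟨ ℤₚ.*-identityˡ _ ⟩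
      sgn n * sgn (ΣW m r) ∎)

-- Passing to the rationals

/-integral : ∀ p d .{{_ : NonZero d}} w → p ≡ w * + d → p / d ≡ w / 1
/-integral p (suc d) w e = ℚₚ.fromℚᵘ-cong {ℚᵘ.mkℚᵘ p d} {ℚᵘ.mkℚᵘ w 0} (ℚᵘ.*≡* (trans (ℤₚ.*-identityʳ p) e))

/1-+ : ∀ x y → (x / 1) ℚ.+ (y / 1) ≡ (x + y) / 1
/1-+ x y = ℚₚ.toℚᵘ-injective (begin
  ℚ.toℚᵘ ((x / 1) ℚ.+ (y / 1)) ≈⟨ ℚₚ.toℚᵘ-homo-+ (x / 1) (y / 1) ⟩
  ℚ.toℚᵘ (x / 1) ℚᵘ.+ ℚ.toℚᵘ (y / 1) ≈⟨ ℚᵘₚ.+-cong (ℚₚ.toℚᵘ-fromℚᵘ (ℚᵘ.mkℚᵘ x 0)) (ℚₚ.toℚᵘ-fromℚᵘ (ℚᵘ.mkℚᵘ y 0)) ⟩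
  ℚᵘ.mkℚᵘ x 0 ℚᵘ.+ ℚᵘ.mkℚᵘ y 0 ≈⟨ ℚᵘ.*≡* (cong (_* 1ℤ) (cong₂ _+_ (ℤₚ.*-identityʳ x) (ℤₚ.*-identityʳ y))) ⟩
  ℚᵘ.mkℚᵘ (x + y) 0 ≈⟨ ℚₚ.toℚᵘ-fromℚᵘ (ℚᵘ.mkℚᵘ (x + y) 0) ⟨
  ℚ.toℚᵘ ((x + y) / 1) ∎)
  where open ℚᵘₚ.≃-Reasoning

/1-* : ∀ x y → (x / 1) ℚ.* (y / 1) ≡ (x * y) / 1
/1-* x y = ℚₚ.toℚᵘ-injective (begin
  ℚ.toℚᵘ ((x / 1) ℚ.* (y / 1)) ≈⟨ ℚₚ.toℚᵘ-homo-* (x / 1) (y / 1) ⟩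
  ℚ.toℚᵘ (x / 1) ℚᵘ.* ℚ.toℚᵘ (y / 1) ≈⟨ ℚᵘₚ.*-cong (ℚₚ.toℚᵘ-fromℚᵘ (ℚᵘ.mkℚᵘ x 0)) (ℚₚ.toℚᵘ-fromℚᵘ (ℚᵘ.mkℚᵘ y 0)) ⟩
  ℚᵘ.mkℚᵘ (x * y) 0 ≈⟨ ℚₚ.toℚᵘ-fromℚᵘ (ℚᵘ.mkℚᵘ (x * y) 0) ⟨
  ℚ.toℚᵘ ((x * y) / 1) ∎)
  where open ℚᵘₚ.≃-Reasoning

sumℚ-integral : ∀ {X : Set} xs (t : X → ℚ) (w : X → ℤ) → (∀ x → x ∈ xs → t x ≡ w x / 1) → sumℚ (map t xs) ≡ ∑ xs w / 1
sumℚ-integral [] t w h = refl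
sumℚ-integral (x ∷ xs) t w h = trans
  (cong₂ ℚ._+_ (h x (here refl)) (sumℚ-integral xs t w λ y y∈ → h y (there y∈))) (/1-+ (w x) (∑ xs w))

∑-filter-all : ∀ {X : Set} {P : X → Set} (P? : ∀ x → Dec (P x)) xs (w : X → ℤ) → (∀ x → x ∈ xs → ¬ P x → w x ≡ 0ℤ) →
  ∑ (filter P? xs) w ≡ ∑ xs w
∑-filter-all P? xs w h = trans (∑-filter P? xs) (∑-cong xs λ x x∈ → keep (P? x) (h x x∈))
  where
  keep : ∀ {P : Set} (d : Dec P) {y} → (¬ P → y ≡ 0ℤ) → 𝟙 d * y ≡ y
  keep (yes _) _ = ℤₚ.*-identityˡ _
  keep (no ¬p) h = sym (h ¬p)

ΣRC-integral : ∀ m n (num : List ℕ → ℤ) (w : List ℕ → List ℕ → ℤ) →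
  (∀ {r c} → r ∈ families m n → c ∈ families m n →
    w r c * + denom r c ≡ 𝟙 (T? (validC m r c)) * num r) →
  ΣRC m n (λ r c → (num r / denom r c) {{denom-nz r c}}) ≡
  ∑ (families m n) (λ r → ∑ (families m n) (w r)) / 1
ΣRC-integral m n num w h = sumℚ-integral Fs _ _ λ r r∈ → trans
  (sumℚ-integral (filter (λ c → T? (validC m r c)) Fs) _ (w r) λ c c∈ → term r∈ (∈-filter⁻ (λ c → T? (validC m r c)) {xs = Fs} c∈))
  (cong (λ z → z / 1) (∑-filter-all (λ c → T? (validC m r c)) Fs (w r) λ c c∈ ¬v → vanish r∈ c∈ ¬v))
  where
  Fs = families m n
  term : ∀ {r c} → r ∈ Fs → c ∈ Fs × T (validC m r c) → (num r / denom r c) {{denom-nz r c}} ≡ w r c / 1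
  term {r} {c} r∈ (c∈ , v) = /-integral (num r) (denom r c) {{denom-nz r c}} (w r c) (sym (trans (h r∈ c∈)
    (trans (cong (_* num r) (𝟙-yes (T? (validC m r c)) v)) (ℤₚ.*-identityˡ _))))
  vanish : ∀ {r c} → r ∈ Fs → c ∈ Fs → ¬ T (validC m r c) → w r c ≡ 0ℤ
  vanish {r} {c} r∈ c∈ ¬v with ℤₚ.i*j≡0⇒i≡0∨j≡0 (w r c) (trans (h r∈ c∈) (cong (_* num r) (𝟙-no (T? (validC m r c)) ¬v)))
  ... | inj₁ e = e
  ... | inj₂ e = ⊥-elim (ℕ.≢-nonZero⁻¹ (denom r c) {{denom-nz r c}} (ℤₚ.+-injective e))

theorem5p1 : ∀ m n → 1 ≤ m → m ≤ n →
    ((+ K m n) / 1 ≡ K₁ m n) × ((+ K m n) / 1 ≡ K₂ m n)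
theorem5p1 (suc k) n 1≤m m≤n = first , second
  where
  m = suc k
  s = sgn (n ℕ.* k)

  first : (+ K m n) / 1 ≡ K₁ m n
  first = trans (cong (λ z → z / 1) (∑-contribution k n))
    (sym (ΣRC-integral m n (numerator k n) (contribution k n) (contribution-denom k n)))

  -- The two numerators differ by the sign `s`, so the witnesses acquire `s` too; it then cancels
  -- against the prefactor of `K₂`.
  signed : ∀ {r c} → r ∈ families m n → c ∈ families m n →
    s * contribution k n r c * + denom r c ≡ 𝟙 (T? (validC m r c)) * risingNumerator k n r
  signed {r} {c} r∈ c∈ = begin
    s * contribution k n r c * + denom r c ≡⟨ ℤₚ.*-assoc s (contribution k n r c) (+ denom r c) ⟩
    s * (contribution k n r c * + denom r c) ≡⟨ cong (s *_) (contribution-denom k n r∈ c∈) ⟩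
    s * (𝟙 (T? (validC m r c)) * numerator k n r) ≡⟨ x∙yz≈y∙xz s (𝟙 (T? (validC m r c))) (numerator k n r) ⟩
    𝟙 (T? (validC m r c)) * (s * numerator k n r) ≡⟨ cong (𝟙 (T? (validC m r c)) *_) (sym (risingNumerator-sign k n r∈)) ⟩
    𝟙 (T? (validC m r c)) * risingNumerator k n r ∎
    where open ≡-Reasoning

  second : (+ K m n) / 1 ≡ K₂ m n
  second = sym (begin
    K₂ m n
      ≡⟨ cong ((s / 1) ℚ.*_) (ΣRC-integral m n (risingNumerator k n) (λ r c → s * contribution k n r c) signed) ⟩
    (s / 1) ℚ.* (∑ (families m n) (λ r → ∑ (families m n) λ c → s * contribution k n r c) / 1)
      ≡⟨ /1-* s _ ⟩
    (s * ∑ (families m n) (λ r → ∑ (families m n) λ c → s * contribution k n r c)) / 1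
      ≡⟨ cong (λ z → (s * z) / 1) (trans (∑-cong (families m n) λ r _ → sym (*-∑ s (families m n) _))
           (trans (sym (*-∑ s (families m n) _)) (cong (s *_) (sym (∑-contribution k n))))) ⟩
    (s * (s * + K m n)) / 1
      ≡⟨ cong (λ z → z / 1) (trans (sym (ℤₚ.*-assoc s s _)) (trans (cong (_* + K m n) (sgn-square (n ℕ.* k))) (ℤₚ.*-identityˡ _))) ⟩
    (+ K m n) / 1 ∎)
    where open ≡-Reasoning
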